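{- Let $m\geq 2$ be an integer and let $n\in\mathbb N$ be composite. The following are equivalent: (1) $n$ is an $m$-Carmichael number, i.e. $A^{K_m(n)}=I$ for all $A\in\mathrm{GL}(m,\mathbb Z/n\mathbb Z)$; (2) for every prime $p$ dividing $n$, we have $D_m(p)\mid K_m(n)$.
   Context: For $k\geq1$, $\Phi_k(X)$ denotes the $k$th cyclotomic polynomial. For $n\in\mathbb N$ set $D_m(n)=\prod_{k=1}^m\Phi_k(n)$, $\nabla_m(n)=\prod_{p\mid n}p^{\lceil\log_p m\rceil-1}$ (product over the prime divisors $p$ of $n$), and $K_m(n)=n\,\nabla_m(n)\,D_m(n)$. A composite $n\in\mathbb N$ is called an $m$-Carmichael number if $A^{K_m(n)}=I$ for all $A\in\mathrm{GL}(m,\mathbb Z/n\mathbb Z)$. -}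

module Defs where

open import Data.Nat as ℕ using (ℕ; zero; suc; _≤?_; _∸_)
open import Data.Nat.Divisibility using (_∣?_)
open import Data.Nat.Primality using (Prime; prime?; Composite)
open import Data.Integer as ℤ using (ℤ; +_; -_; _-_; ∣_∣)
import Data.Integer.Divisibility as ℤD
open import Data.Fin using (Fin; zero; suc; _≟_)
open import Data.List using (List; []; _∷_; _++_; [_]; replicate; length; foldl; foldr; map)
open import Data.Product using (_×_; _,_; proj₂; Σ)
open import Data.Bool using (Bool; true; false; if_then_else_; _∧_)
open import Relation.Nullary using (does)

-- Polynomials over ℤ as coefficient lists, BIG-ENDIAN
-- (head = leading coefficient).

Poly : Set
Poly = List ℤ

addH : Poly → Poly → Poly
addH [] q = q
addH p [] = p
addH (a ∷ p) (b ∷ q) = (a ℤ.+ b) ∷ addH p q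

-- Index convolution c_k = Σ_{i+j=k} a_i b_j.  This is the product of
-- polynomials in either coefficient orientation (reversal commutes with
-- convolution), in particular for big-endian lists.
polyMul : Poly → Poly → Poly
polyMul [] q = []
polyMul (a ∷ p) q = addH (map (a ℤ.*_) q) (+ 0 ∷ polyMul p q)

polyProd : List Poly → Poly
polyProd = foldr polyMul (+ 1 ∷ [])

subFront : Poly → Poly → Poly
subFront [] f = f
subFront (b ∷ s) [] = []
subFront (b ∷ s) (a ∷ f) = (a - b) ∷ subFront s f

-- Long division of f by a MONIC polynomial g = 1 ∷ gt (big-endian):
-- quotient coefficients, using 'fuel' steps.
divMonicAux : ℕ → Poly → Poly → Poly
divMonicAux zero gt f = []
divMonicAux (suc k) gt [] = []
divMonicAux (suc k) gt (a ∷ f) =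
  a ∷ divMonicAux k gt (subFront (map (a ℤ.*_) gt) f)

divMonic : Poly → Poly → Poly
divMonic f [] = f
divMonic f (_ ∷ gt) = divMonicAux (length f ∸ length gt) gt f

xPowMinusOne : ℕ → Poly
xPowMinusOne zero = + 0 ∷ []
xPowMinusOne (suc k) = (+ 1 ∷ replicate k (+ 0)) ++ [ - (+ 1) ]

-- Given the table of (d , Φ_d) for d < k, the k-th cyclotomic
-- polynomial Φ_k = (X^k - 1) / ∏_{d ∣ k, d < k} Φ_d.
newCyclo : ℕ → List (ℕ × Poly) → Poly
newCyclo k prev = divMonic (xPowMinusOne k) (polyProd (divisorPolys prev))
  where
  divisorPolys : List (ℕ × Poly) → List Poly
  divisorPolys [] = []
  divisorPolys ((d , φ) ∷ r) =
    if does (d ∣? k) then φ ∷ divisorPolys r else divisorPolys r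

cycloTable : ℕ → List (ℕ × Poly)
cycloTable zero = []
cycloTable (suc k) = cycloTable k ++ [ (suc k , newCyclo (suc k) (cycloTable k)) ]

cyclotomic : ℕ → Poly
cyclotomic k = newCyclo k (cycloTable (k ∸ 1))

eval : Poly → ℤ → ℤ
eval p x = foldl (λ acc c → acc ℤ.* x ℤ.+ c) (+ 0) p

D : ℕ → ℕ → ℤ
D zero n = + 1
D (suc m) n = D m n ℤ.* eval (cyclotomic (suc m)) (+ n)

-- ⌈log_p m⌉ : the least e with m ≤ p^e (searched among e ≤ m; for
-- p ≥ 2 and m ≥ 1 the least such e is ≤ m)
ceilLog : ℕ → ℕ → ℕ
ceilLog p m = go m 0
  where
  go : ℕ → ℕ → ℕ
  go zero e = e
  go (suc f) e = if does (m ≤? p ℕ.^ e) then e else go f (suc e)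

nablaUpTo : ℕ → ℕ → ℕ → ℕ
nablaUpTo m n zero = 1
nablaUpTo m n (suc p) =
  (if does (prime? (suc p)) ∧ does (suc p ∣? n)
     then suc p ℕ.^ (ceilLog (suc p) m ∸ 1) else 1)
  ℕ.* nablaUpTo m n p

nabla : ℕ → ℕ → ℕ
nabla m n = nablaUpTo m n n

K : ℕ → ℕ → ℤ
K m n = + (n ℕ.* nabla m n) ℤ.* D m n

-- m×m matrices over ℤ/nℤ, represented by integer matrices with entries
-- compared modulo n.

Mat : ℕ → Set
Mat m = Fin m → Fin m → ℤ

sumFin : ∀ {m} → (Fin m → ℤ) → ℤ
sumFin {zero} f = + 0
sumFin {suc m} f = f zero ℤ.+ sumFin (λ i → f (suc i))

_⊗_ : ∀ {m} → Mat m → Mat m → Mat m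
(A ⊗ B) i j = sumFin (λ k → A i k ℤ.* B k j)

idMat : ∀ {m} → Mat m
idMat i j = if does (i ≟ j) then + 1 else + 0

matPow : ∀ {m} → Mat m → ℕ → Mat m
matPow A zero = idMat
matPow A (suc k) = A ⊗ matPow A k

_≡[mod_]_ : ℤ → ℕ → ℤ → Set
a ≡[mod n ] b = (+ n) ℤD.∣ (a - b)

MatEq : ∀ {m} → ℕ → Mat m → Mat m → Set
MatEq n A B = ∀ i j → A i j ≡[mod n ] B i j

InGL : (m n : ℕ) → Mat m → Set
InGL m n A = Σ (Mat m) λ B → MatEq n (A ⊗ B) idMat × MatEq n (B ⊗ A) idMat

-- n is an m-Carmichael number: n composite and A^{K_m(n)} = I for all
-- A ∈ GL(m, ℤ/nℤ).  (K_m(n) > 0 for n ≥ 2, so the exponent is ∣K_m(n)∣.)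
IsMCarmichael : ℕ → ℕ → Set
IsMCarmichael m n =
  Composite n × (∀ (A : Mat m) → InGL m n A → MatEq n (matPow A ∣ K m n ∣) idMat)

{-# OPTIONS --safe #-}
-- D_m(p) is the least common multiple of the numbers p^k - 1 for k ≤ m: when d and e do not divide
-- each other, the ideal (Φ_d(p) , Φ_e(p)) contains the coprime integers d/g and e/g, g = gcd d e.
--
-- If D_m(p) ∣ K, then A^K = 1 modulo each p^r ∣ n.  Over the prime field every polynomial f of degree
-- at most m satisfies f(a) ∣ Π_{j≤m} (a^(p^j) - a) (a divided-difference argument), and each column
-- of Π_{j≤m} (A^(p^j) - A) is killed because the columns of 1, A, …, A^m are dependent.  Hence
-- (A^L - 1)^m = 0 for L = D_m(p), so A^(L p^e) = 1 modulo p as soon as p^e ≥ m, and raising to the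
-- power p^(r-1) lifts this to p^r.
--
-- Conversely let N = p^k - 1 with k ≤ m not divide K, and let x be the cyclic shift of order N modulo
-- p, so that x^(p^k) = x and y = x^K - 1 ≠ 0.  The coefficients of (T - 1)^(m-k) Π_{i<k} (T - x^(p^i))
-- are invariant under Frobenius, so on some nonzero multiple z of y they act as integers.  The
-- companion matrix of these integers is invertible and its K-th power is not 1 modulo p, since
-- otherwise y z = 0, contradicting y^(p^k) = y.
module Submission where

-- The cyclotomic polynomials come from list division with fuel, so even the factorisation of x^k -
-- 1 has to be established. Polynomials enter only through integer values: identities are derived
-- from divisibilities that hold at every X ≥ 2 up to a fixed constant, by comparing growth.
-- Commutative arguments about a matrix A take place in the ring of matrices that commute with
-- everything commuting with A, read modulo p. Such a ring usually has zero divisors, and so has the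
-- one of the cyclic shift, which stands in for the field with p^k elements. Hence divided
-- differences are built without division, roots are split off only at points whose differences are
-- units, and Frobenius-invariant coefficients become integers only after multiplication by a
-- suitable element. The factor (T - 1)^(m-k) raises the degree to m while keeping the coefficients
-- invariant and the constant term regular. The exponent ⌈log_p m⌉ - 1 in ∇ is a matter of counting:
-- p^⌈log_p m⌉ removes the unipotent part modulo p, the lift from p to p^r costs r - 1 further
-- factors, and n itself already supplies r factors.

open import Defs

-- Values of big-endian coefficient lists under sum, product and division.

module BigEndian where

  open import Data.Nat as ℕ using (ℕ; zero; suc)
  import Data.Nat.Properties as ℕₚ
  open import Data.Nat.Divisibility using ()
  open import Data.Integer using (ℤ; +_; -_; _-_; _+_; _*_; _^_)
  import Data.Integer.Properties as ℤₚ
  open import Data.Integer.Solver using (module +-*-Solver)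
  open +-*-Solver using (solve; _:=_; _:+_; _:*_; _:-_; :-_; con)
  open import Data.List using (List; []; _∷_; _++_; length; foldl; map)
  import Data.List.Properties as Listₚ
  open import Data.List.Relation.Unary.All using (All; []; _∷_)
  open import Data.Product using (_×_; _,_; proj₁; proj₂; ∃-syntax)
  open import Relation.Binary.PropositionalEquality
  open ≡-Reasoning

  -- `eval` accumulates from the left; here each coefficient carries its own power, given by the
  -- number of coefficients behind it, which suits induction on the list.
  H : Poly → ℤ → ℤ
  H []      x = + 0
  H (c ∷ p) x = c * x ^ length p + H p x

  foldl-H : ∀ p x a → foldl (λ acc c → acc * x + c) a p ≡ a * x ^ length p + H p x
  foldl-H [] x a = solve 1 (λ a → a := a :* con (+ 1) :+ con (+ 0)) refl a
  foldl-H (c ∷ p) x a = trans (foldl-H p x (a * x + c))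
    (solve 5 (λ a x c l h → (a :* x :+ c) :* l :+ h := a :* (x :* l) :+ (c :* l :+ h))
      refl a x c (x ^ length p) (H p x))

  eval≡H : ∀ p x → eval p x ≡ H p x
  eval≡H p x = trans (foldl-H p x (+ 0)) (ℤₚ.+-identityˡ (H p x))

  H-map-* : ∀ a p x → H (map (a *_) p) x ≡ a * H p x
  H-map-* a [] x = sym (ℤₚ.*-zeroʳ a)
  H-map-* a (c ∷ p) x rewrite Listₚ.length-map (a *_) p | H-map-* a p x =
    solve 4 (λ a c l h → a :* c :* l :+ a :* h := a :* (c :* l :+ h)) refl a c (x ^ length p) (H p x)

  length-addH : ∀ u w d → length w ≡ d ℕ.+ length u → length (addH u w) ≡ length w
  length-addH [] w d eq = refl
  length-addH (a ∷ u) [] d eq with () ← trans eq (ℕₚ.+-suc d (length u))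
  length-addH (a ∷ u) (b ∷ w) d eq =
    cong suc (length-addH u w d (ℕₚ.suc-injective (trans eq (ℕₚ.+-suc d (length u)))))

  -- Big-endian lists are added with their heads aligned, so the shorter list is shifted.
  H-addH : ∀ u w d x → length w ≡ d ℕ.+ length u → H (addH u w) x ≡ H u x * x ^ d + H w x
  H-addH [] w d x eq = sym (ℤₚ.+-identityˡ (H w x))
  H-addH (a ∷ u) [] d x eq with () ← trans eq (ℕₚ.+-suc d (length u))
  H-addH (a ∷ u) (b ∷ w) d x eq = begin
    (a + b) * x ^ length (addH u w) + H (addH u w) x
      ≡⟨ cong₂ (λ l h → (a + b) * x ^ l + h) (length-addH u w d eq′) (H-addH u w d x eq′) ⟩
    (a + b) * x ^ length w + (H u x * x ^ d + H w x)
      ≡⟨ cong (λ t → (a + b) * t + (H u x * x ^ d + H w x)) split ⟩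
    (a + b) * (x ^ d * x ^ length u) + (H u x * x ^ d + H w x)
      ≡⟨ solve 6 (λ a b e l h k → (a :+ b) :* (e :* l) :+ (h :* e :+ k) :=
           (a :* l :+ h) :* e :+ (b :* (e :* l) :+ k)) refl a b (x ^ d) (x ^ length u) (H u x) (H w x) ⟩
    (a * x ^ length u + H u x) * x ^ d + (b * (x ^ d * x ^ length u) + H w x)
      ≡⟨ cong (λ t → (a * x ^ length u + H u x) * x ^ d + (b * t + H w x)) split ⟨
    (a * x ^ length u + H u x) * x ^ d + (b * x ^ length w + H w x) ∎
    where
    eq′ : length w ≡ d ℕ.+ length u
    eq′ = ℕₚ.suc-injective (trans eq (ℕₚ.+-suc d (length u)))
    split : x ^ length w ≡ x ^ d * x ^ length u
    split = trans (cong (x ^_) eq′) (ℤₚ.^-distribˡ-+-* x d (length u))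

  addH-[] : ∀ p → addH p [] ≡ p
  addH-[] [] = refl
  addH-[] (_ ∷ _) = refl

  length-polyMul : ∀ a p b q → length (polyMul (a ∷ p) (b ∷ q)) ≡ length p ℕ.+ suc (length q)
  private
    shifted-length : ∀ a a′ p b q →
      length (+ 0 ∷ polyMul (a′ ∷ p) (b ∷ q)) ≡ suc (length p) ℕ.+ length (map (a *_) (b ∷ q))
    shifted-length a a′ p b q = trans (cong suc (length-polyMul a′ p b q))
      (cong (λ l → suc (length p) ℕ.+ l) (sym (Listₚ.length-map (a *_) (b ∷ q))))
  length-polyMul a [] b q = cong suc (trans (cong length (addH-[] (map (a *_) q))) (Listₚ.length-map (a *_) q))
  length-polyMul a (a′ ∷ p) b q =
    trans (length-addH (map (a *_) (b ∷ q)) (+ 0 ∷ polyMul (a′ ∷ p) (b ∷ q)) (suc (length p))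
            (shifted-length a a′ p b q))
          (cong suc (length-polyMul a′ p b q))

  H-polyMul : ∀ a p b q x → H (polyMul (a ∷ p) (b ∷ q)) x ≡ H (a ∷ p) x * H (b ∷ q) x
  -- For a constant factor the second summand `+ 0 ∷ []` may be the shorter list, so `H-addH` does
  -- not apply; it merely adds 0 to the head.
  H-polyMul a [] b q x rewrite addH-[] (map (a *_) q) | Listₚ.length-map (a *_) q | H-map-* a q x =
    solve 4 (λ a b l h → (a :* b :+ con (+ 0)) :* l :+ a :* h :=
                         (a :* con (+ 1) :+ con (+ 0)) :* (b :* l :+ h)) refl a b (x ^ length q) (H q x)
  H-polyMul a (a′ ∷ p) b q x = begin
    H (addH (map (a *_) (b ∷ q)) (+ 0 ∷ r)) x
      ≡⟨ H-addH (map (a *_) (b ∷ q)) (+ 0 ∷ r) (suc (length p)) x (shifted-length a a′ p b q) ⟩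
    H (map (a *_) (b ∷ q)) x * x ^ suc (length p) + (+ 0 * x ^ length r + H r x)
      ≡⟨ cong₂ (λ s t → s * x ^ suc (length p) + (+ 0 * x ^ length r + t))
           (H-map-* a (b ∷ q) x) (H-polyMul a′ p b q x) ⟩
    a * H (b ∷ q) x * x ^ suc (length p) + (+ 0 * x ^ length r + H (a′ ∷ p) x * H (b ∷ q) x)
      ≡⟨ solve 5 (λ a h l z k → a :* h :* l :+ (con (+ 0) :* z :+ k :* h) := (a :* l :+ k) :* h) refl
           a (H (b ∷ q) x) (x ^ suc (length p)) (x ^ length r) (H (a′ ∷ p) x) ⟩
    (a * x ^ suc (length p) + H (a′ ∷ p) x) * H (b ∷ q) x ∎
    where r = polyMul (a′ ∷ p) (b ∷ q)

  Monic : Poly → Set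
  Monic p = ∃[ t ] p ≡ + 1 ∷ t

  prodH : List Poly → ℤ → ℤ
  prodH []       x = + 1
  prodH (p ∷ ps) x = H p x * prodH ps x

  prodH-++ : ∀ ps qs x → prodH (ps ++ qs) x ≡ prodH ps x * prodH qs x
  prodH-++ [] qs x = sym (ℤₚ.*-identityˡ _)
  prodH-++ (p ∷ ps) qs x = trans (cong (H p x *_) (prodH-++ ps qs x)) (sym (ℤₚ.*-assoc (H p x) _ _))

  monic-polyMul : ∀ {p q} → Monic p → Monic q → Monic (polyMul p q)
  monic-polyMul ([] , refl) (q , refl) = _ , refl
  monic-polyMul (_ ∷ _ , refl) (q , refl) = _ , refl

  monic-polyProd : ∀ {ps} → All Monic ps → Monic (polyProd ps)
  monic-polyProd [] = _ , refl
  monic-polyProd (m ∷ ms) = monic-polyMul m (monic-polyProd ms)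

  H-polyProd : ∀ {ps} → All Monic ps → ∀ x → H (polyProd ps) x ≡ prodH ps x
  H-polyProd [] x = refl
  H-polyProd {p ∷ ps} (m ∷ ms) x = trans (mul m (monic-polyProd ms)) (cong (H p x *_) (H-polyProd ms x))
    where
    mul : ∀ {p q} → Monic p → Monic q → H (polyMul p q) x ≡ H p x * H q x
    mul (p , refl) (q , refl) = H-polyMul (+ 1) p (+ 1) q x

  length-subFront : ∀ s f → length (subFront s f) ≡ length f
  length-subFront [] f = refl
  length-subFront (b ∷ s) [] = refl
  length-subFront (b ∷ s) (a ∷ f) = cong suc (length-subFront s f)

  H-subFront : ∀ s f k x → length f ≡ k ℕ.+ length s → H (subFront s f) x ≡ H f x - H s x * x ^ k
  H-subFront [] f k x eq = solve 1 (λ h → h := h :- con (+ 0)) refl (H f x)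
  H-subFront (b ∷ s) [] k x eq with () ← trans eq (ℕₚ.+-suc k (length s))
  H-subFront (b ∷ s) (a ∷ f) k x eq = begin
    (a - b) * x ^ length (subFront s f) + H (subFront s f) x
      ≡⟨ cong₂ (λ l h → (a - b) * x ^ l + h) (length-subFront s f) (H-subFront s f k x eq′) ⟩
    (a - b) * x ^ length f + (H f x - H s x * x ^ k)
      ≡⟨ cong (λ t → (a - b) * t + (H f x - H s x * x ^ k)) split ⟩
    (a - b) * (x ^ k * x ^ length s) + (H f x - H s x * x ^ k)
      ≡⟨ solve 6 (λ a b e l h g → (a :- b) :* (e :* l) :+ (h :- g :* e) :=
           (a :* (e :* l) :+ h) :- (b :* l :+ g) :* e) refl a b (x ^ k) (x ^ length s) (H f x) (H s x) ⟩
    (a * (x ^ k * x ^ length s) + H f x) - (b * x ^ length s + H s x) * x ^ k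
      ≡⟨ cong (λ t → (a * t + H f x) - (b * x ^ length s + H s x) * x ^ k) split ⟨
    (a * x ^ length f + H f x) - (b * x ^ length s + H s x) * x ^ k ∎
    where
    eq′ : length f ≡ k ℕ.+ length s
    eq′ = ℕₚ.suc-injective (trans eq (ℕₚ.+-suc k (length s)))
    split : x ^ length f ≡ x ^ k * x ^ length s
    split = trans (cong (x ^_) eq′) (ℤₚ.^-distribˡ-+-* x k (length s))

  length-divMonicAux : ∀ k gt f → length f ≡ k ℕ.+ length gt → length (divMonicAux k gt f) ≡ k
  length-divMonicAux zero gt f eq = refl
  length-divMonicAux (suc k) gt (a ∷ f) eq = cong suc (length-divMonicAux k gt _
    (trans (length-subFront (map (a *_) gt) f) (ℕₚ.suc-injective eq)))

  -- The remainder is the list that `divMonicAux` drops when the fuel is spent. The length condition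
  -- says that the fuel runs out exactly when what is left is shorter than the divisor `+ 1 ∷ gt`.
  divMonicAux-remainder : ∀ k gt f → length f ≡ k ℕ.+ length gt →
    ∃[ r ] length r ≡ length gt × (∀ x → H f x ≡ H (divMonicAux k gt f) x * H (+ 1 ∷ gt) x + H r x)
  divMonicAux-remainder zero gt f eq = f , eq , λ x → sym (ℤₚ.+-identityˡ (H f x))
  divMonicAux-remainder (suc k) gt (a ∷ f) eq = r , lr , λ x → begin
    a * x ^ length f + H f x
      ≡⟨ cong (λ t → a * t + H f x) (split x) ⟩
    a * (x ^ k * x ^ length gt) + H f x
      ≡⟨ solve 5 (λ a e l h g → a :* (e :* l) :+ h :=
           (h :- a :* g :* e) :+ a :* e :* (con (+ 1) :* l :+ g)) refl a (x ^ k) (x ^ length gt) (H f x) (H gt x) ⟩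
    (H f x - a * H gt x * x ^ k) + a * x ^ k * H (+ 1 ∷ gt) x
      ≡⟨ cong (λ t → (H f x - t * x ^ k) + a * x ^ k * H (+ 1 ∷ gt) x) (H-map-* a gt x) ⟨
    (H f x - H (map (a *_) gt) x * x ^ k) + a * x ^ k * H (+ 1 ∷ gt) x
      ≡⟨ cong (_+ a * x ^ k * H (+ 1 ∷ gt) x) (H-subFront (map (a *_) gt) f k x eqs) ⟨
    H f′ x + a * x ^ k * H (+ 1 ∷ gt) x
      ≡⟨ cong (_+ a * x ^ k * H (+ 1 ∷ gt) x) (Hr x) ⟩
    (H q x * H (+ 1 ∷ gt) x + H r x) + a * x ^ k * H (+ 1 ∷ gt) x
      ≡⟨ solve 5 (λ q g r a e → (q :* g :+ r) :+ a :* e :* g := (a :* e :+ q) :* g :+ r) refl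
           (H q x) (H (+ 1 ∷ gt) x) (H r x) a (x ^ k) ⟩
    (a * x ^ k + H q x) * H (+ 1 ∷ gt) x + H r x
      ≡⟨ cong (λ l → (a * x ^ l + H q x) * H (+ 1 ∷ gt) x + H r x) (length-divMonicAux k gt f′ eq′) ⟨
    (a * x ^ length q + H q x) * H (+ 1 ∷ gt) x + H r x ∎
    where
    f′ = subFront (map (a *_) gt) f
    q = divMonicAux k gt f′
    eq′ : length f′ ≡ k ℕ.+ length gt
    eq′ = trans (length-subFront (map (a *_) gt) f) (ℕₚ.suc-injective eq)
    eqs : length f ≡ k ℕ.+ length (map (a *_) gt)
    eqs = trans (ℕₚ.suc-injective eq) (cong (k ℕ.+_) (sym (Listₚ.length-map (a *_) gt)))
    split : ∀ x → x ^ length f ≡ x ^ k * x ^ length gt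
    split x = trans (cong (x ^_) (ℕₚ.suc-injective eq)) (ℤₚ.^-distribˡ-+-* x k (length gt))
    rec = divMonicAux-remainder k gt f′ eq′
    r = proj₁ rec
    lr = proj₁ (proj₂ rec)
    Hr = proj₂ (proj₂ rec)

-- Growth of polynomial values at large integers.

module Growth where

  open import Data.Nat as ℕ using (ℕ; zero; suc; s≤s; z≤n)
  import Data.Nat.Properties as ℕₚ
  open import Data.Nat.Divisibility as ℕD using ()
  open import Data.Integer using (ℤ; +_; -_; _-_; _+_; _*_; ∣_∣; _^_)
  import Data.Integer as ℤ
  import Data.Integer.Properties as ℤₚ
  open import Data.Integer.Divisibility.Signed using (_∣_; ∣⇒∣ᵤ)
  open import Data.Integer.Solver using (module +-*-Solver)
  open +-*-Solver using (solve; _:=_; _:+_; _:*_; _:-_; :-_; con)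
  open import Data.List using ([]; _∷_; length)
  open import Relation.Nullary using (yes; no; contradiction)
  open import Relation.Binary.PropositionalEquality
  open BigEndian
  open ℕₚ.≤-Reasoning

  height : Poly → ℕ
  height []      = 0
  height (c ∷ p) = ∣ c ∣ ℕ.+ height p

  ∣x^k∣ : ∀ X k → ∣ (+ X) ^ k ∣ ≡ X ℕ.^ k
  ∣x^k∣ X zero = refl
  ∣x^k∣ X (suc k) = trans (ℤₚ.abs-* (+ X) ((+ X) ^ k)) (cong (X ℕ.*_) (∣x^k∣ X k))

  -- Each monomial is at most X^(length r - 1) times the absolute value of its coefficient; the
  -- additional factor X on the left avoids the exponent `length r - 1`.
  H-bound : ∀ r X → 1 ℕ.≤ X → ∣ H r (+ X) ∣ ℕ.* X ℕ.≤ height r ℕ.* X ℕ.^ length r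
  H-bound [] X 1≤X = z≤n
  H-bound (a ∷ r) X@(suc _) 1≤X = begin
    ∣ a * x ^ l + H r x ∣ ℕ.* X
      ≤⟨ ℕₚ.*-monoˡ-≤ X (ℤₚ.∣i+j∣≤∣i∣+∣j∣ (a * x ^ l) (H r x)) ⟩
    (∣ a * x ^ l ∣ ℕ.+ ∣ H r x ∣) ℕ.* X
      ≡⟨ ℕₚ.*-distribʳ-+ X ∣ a * x ^ l ∣ ∣ H r x ∣ ⟩
    ∣ a * x ^ l ∣ ℕ.* X ℕ.+ ∣ H r x ∣ ℕ.* X
      ≡⟨ cong (λ t → t ℕ.* X ℕ.+ ∣ H r x ∣ ℕ.* X) (trans (ℤₚ.abs-* a (x ^ l)) (cong (∣ a ∣ ℕ.*_) (∣x^k∣ X l))) ⟩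
    ∣ a ∣ ℕ.* X ℕ.^ l ℕ.* X ℕ.+ ∣ H r x ∣ ℕ.* X
      ≡⟨ cong (ℕ._+ ∣ H r x ∣ ℕ.* X) (trans (ℕₚ.*-assoc ∣ a ∣ (X ℕ.^ l) X) (cong (∣ a ∣ ℕ.*_) (ℕₚ.*-comm (X ℕ.^ l) X))) ⟩
    ∣ a ∣ ℕ.* (X ℕ.* X ℕ.^ l) ℕ.+ ∣ H r x ∣ ℕ.* X
      ≤⟨ ℕₚ.+-monoʳ-≤ (∣ a ∣ ℕ.* (X ℕ.* X ℕ.^ l)) (ℕₚ.≤-trans (H-bound r X 1≤X)
           (ℕₚ.*-monoʳ-≤ (height r) (ℕₚ.m≤n*m (X ℕ.^ l) X))) ⟩
    ∣ a ∣ ℕ.* (X ℕ.* X ℕ.^ l) ℕ.+ height r ℕ.* (X ℕ.* X ℕ.^ l)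
      ≡⟨ ℕₚ.*-distribʳ-+ (X ℕ.* X ℕ.^ l) ∣ a ∣ (height r) ⟨
    (∣ a ∣ ℕ.+ height r) ℕ.* (X ℕ.* X ℕ.^ l) ∎
    where x = + X
          l = length r

  -- At a zero X larger than the height of the tail, a nonzero leading coefficient would give a term
  -- too large for the tail to cancel. So it is 0, and the tail vanishes at the same points.
  H-zero : ∀ r X₀ → (∀ X → X₀ ℕ.≤ X → H r (+ X) ≡ + 0) → ∀ x → H r x ≡ + 0
  H-zero [] X₀ h x = refl
  H-zero (a ∷ r) X₀ h x = trans (Hr x) (H-zero r X₀ (λ X le → trans (sym (Hr (+ X))) (h X le)) x)
    where
    B = height r
    X = X₀ ℕ.+ suc B
    instance
      X≢0 : ℕ.NonZero X
      X≢0 = ℕ.>-nonZero (ℕₚ.≤-trans (s≤s z≤n) (ℕₚ.m≤n+m (suc B) X₀))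
    l = length r
    eq : ∣ a ∣ ℕ.* X ℕ.^ l ≡ ∣ H r (+ X) ∣
    eq = trans (sym (trans (ℤₚ.abs-* a ((+ X) ^ l)) (cong (∣ a ∣ ℕ.*_) (∣x^k∣ X l))))
      (trans (cong ∣_∣ (solve 2 (λ u v → u := (u :+ v) :+ (:- v)) refl (a * (+ X) ^ l) (H r (+ X))))
      (trans (cong (λ t → ∣ t + (- H r (+ X)) ∣) (h X (ℕₚ.m≤m+n X₀ (suc B))))
      (trans (cong ∣_∣ (ℤₚ.+-identityˡ (- H r (+ X)))) (ℤₚ.∣-i∣≡∣i∣ (H r (+ X))))))
    le : ∣ a ∣ ℕ.* X ℕ.≤ B
    le = ℕₚ.*-cancelʳ-≤ (∣ a ∣ ℕ.* X) B (X ℕ.^ l) {{ℕₚ.m^n≢0 X l}} (begin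
      ∣ a ∣ ℕ.* X ℕ.* X ℕ.^ l   ≡⟨ ℕₚ.*-assoc ∣ a ∣ X (X ℕ.^ l) ⟩
      ∣ a ∣ ℕ.* (X ℕ.* X ℕ.^ l) ≡⟨ cong (∣ a ∣ ℕ.*_) (ℕₚ.*-comm X (X ℕ.^ l)) ⟩
      ∣ a ∣ ℕ.* (X ℕ.^ l ℕ.* X) ≡⟨ ℕₚ.*-assoc ∣ a ∣ (X ℕ.^ l) X ⟨
      ∣ a ∣ ℕ.* X ℕ.^ l ℕ.* X   ≡⟨ cong (ℕ._* X) eq ⟩
      ∣ H r (+ X) ∣ ℕ.* X      ≤⟨ H-bound r X (ℕ.>-nonZero⁻¹ X) ⟩
      B ℕ.* X ℕ.^ l ∎)
    a≡0′ : ∀ n → n ℕ.* X ℕ.≤ B → n ≡ 0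
    a≡0′ zero le = refl
    a≡0′ (suc n) le = contradiction
      (ℕₚ.≤-trans (ℕₚ.m≤n+m (suc B) X₀) (ℕₚ.≤-trans (ℕₚ.m≤m+n X (n ℕ.* X)) le)) ℕₚ.1+n≰n
    a≡0 : a ≡ + 0
    a≡0 = ℤₚ.∣i∣≡0⇒i≡0 (a≡0′ ∣ a ∣ le)
    Hr : ∀ x → a * x ^ l + H r x ≡ H r x
    Hr x rewrite a≡0 = ℤₚ.+-identityˡ (H r x)

  -- A polynomial of lower degree than a monic g, all of whose large values (up to a
  -- constant factor) are multiples of the values of g, is smaller than g there, hence vanishes.
  small-multiple-zero : ∀ gt r c → 1 ℕ.≤ c → length r ℕ.≤ length gt →
    (∀ X → 2 ℕ.≤ X → H (+ 1 ∷ gt) (+ X) ∣ + c * H r (+ X)) → ∀ x → H r x ≡ + 0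
  small-multiple-zero gt r c@(suc _) 1≤c le div = H-zero r X₀ vanish
    where
    n = length gt
    -- A nonzero value of `H r` at X forces X ≤ c * height r + height gt, see `bound`; the summand 2
    -- also secures X ≥ 2 for `div`.
    X₀ = 2 ℕ.+ (c ℕ.* height r ℕ.+ height gt)
    vanish : ∀ X → X₀ ℕ.≤ X → H r (+ X) ≡ + 0
    vanish X X₀≤X with H r (+ X) ℤ.≟ + 0
    ... | yes eq = eq
    ... | no neq = contradiction (ℕₚ.≤-trans (ℕₚ.m≤n⇒m≤1+n (s≤s bound)) X₀≤X) ℕₚ.1+n≰n
      where
      x = + X
      2≤X : 2 ℕ.≤ X
      2≤X = ℕₚ.≤-trans (s≤s (s≤s z≤n)) X₀≤X
      1≤X : 1 ℕ.≤ X
      1≤X = ℕₚ.≤-trans (s≤s z≤n) 2≤X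
      instance
        X≢0 : ℕ.NonZero X
        X≢0 = ℕ.>-nonZero 1≤X
        cr≢0 : ℕ.NonZero ∣ + c * H r x ∣
        cr≢0 = ℕ.≢-nonZero (λ e → neq (ℤₚ.*-cancelˡ-≡ (+ c) (H r x) (+ 0)
          (trans (ℤₚ.∣i∣≡0⇒i≡0 e) (sym (ℤₚ.*-zeroʳ (+ c))))))
      g≤ : ∣ H (+ 1 ∷ gt) x ∣ ℕ.≤ c ℕ.* ∣ H r x ∣
      g≤ = ℕₚ.≤-trans (ℕD.∣⇒≤ (∣⇒∣ᵤ (div X 2≤X))) (ℕₚ.≤-reflexive (ℤₚ.abs-* (+ c) (H r x)))
      x^n≤ : X ℕ.^ n ℕ.≤ c ℕ.* ∣ H r x ∣ ℕ.+ ∣ H gt x ∣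
      x^n≤ = begin
        X ℕ.^ n ≡⟨ ∣x^k∣ X n ⟨
        ∣ x ^ n ∣ ≡⟨ cong ∣_∣ (solve 2 (λ u v → u := (con (+ 1) :* u :+ v) :- v) refl (x ^ n) (H gt x)) ⟩
        ∣ H (+ 1 ∷ gt) x - H gt x ∣ ≤⟨ ℤₚ.∣i-j∣≤∣i∣+∣j∣ (H (+ 1 ∷ gt) x) (H gt x) ⟩
        ∣ H (+ 1 ∷ gt) x ∣ ℕ.+ ∣ H gt x ∣ ≤⟨ ℕₚ.+-monoˡ-≤ ∣ H gt x ∣ g≤ ⟩
        c ℕ.* ∣ H r x ∣ ℕ.+ ∣ H gt x ∣ ∎
      bound : X ℕ.≤ c ℕ.* height r ℕ.+ height gt
      bound = ℕₚ.*-cancelʳ-≤ X _ (X ℕ.^ n) {{ℕₚ.m^n≢0 X n}} (begin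
        X ℕ.* X ℕ.^ n ≡⟨ ℕₚ.*-comm X (X ℕ.^ n) ⟩
        X ℕ.^ n ℕ.* X ≤⟨ ℕₚ.*-monoˡ-≤ X x^n≤ ⟩
        (c ℕ.* ∣ H r x ∣ ℕ.+ ∣ H gt x ∣) ℕ.* X ≡⟨ ℕₚ.*-distribʳ-+ X (c ℕ.* ∣ H r x ∣) ∣ H gt x ∣ ⟩
        c ℕ.* ∣ H r x ∣ ℕ.* X ℕ.+ ∣ H gt x ∣ ℕ.* X
          ≡⟨ cong (ℕ._+ ∣ H gt x ∣ ℕ.* X) (ℕₚ.*-assoc c ∣ H r x ∣ X) ⟩
        c ℕ.* (∣ H r x ∣ ℕ.* X) ℕ.+ ∣ H gt x ∣ ℕ.* X
          ≤⟨ ℕₚ.+-mono-≤ (ℕₚ.*-monoʳ-≤ c (ℕₚ.≤-trans (H-bound r X 1≤X)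
               (ℕₚ.*-monoʳ-≤ (height r) (ℕₚ.^-monoʳ-≤ X le)))) (H-bound gt X 1≤X) ⟩
        c ℕ.* (height r ℕ.* X ℕ.^ n) ℕ.+ height gt ℕ.* X ℕ.^ n
          ≡⟨ cong (ℕ._+ height gt ℕ.* X ℕ.^ n) (ℕₚ.*-assoc c (height r) (X ℕ.^ n)) ⟨
        c ℕ.* height r ℕ.* X ℕ.^ n ℕ.+ height gt ℕ.* X ℕ.^ n
          ≡⟨ ℕₚ.*-distribʳ-+ (X ℕ.^ n) (c ℕ.* height r) (height gt) ⟨
        (c ℕ.* height r ℕ.+ height gt) ℕ.* X ℕ.^ n ∎)

-- The factorisation of x^k - 1 into cyclotomic values.

module Cyclotomic where

  open import Data.Nat as ℕ using (ℕ; zero; suc; s≤s; z≤n)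
  import Data.Nat.Properties as ℕₚ
  open import Data.Nat.Divisibility as ℕD using (_∣?_)
  open import Data.Integer using (ℤ; +_; -_; _-_; _+_; _*_; ∣_∣; _^_)
  import Data.Integer as ℤ
  import Data.Integer.Properties as ℤₚ
  open import Data.Integer.Divisibility.Signed using (_∣_; divides; ∣-refl; ∣-trans)
  import Data.Integer.Divisibility.Signed as ℤS
  open import Data.Integer.Solver using (module +-*-Solver)
  open +-*-Solver using (solve; _:=_; _:+_; _:*_; _:-_; :-_; con)
  open import Data.List using (List; []; _∷_; _++_; [_]; replicate; length)
  open import Data.List.Relation.Unary.All as All using (All; []; _∷_)
  import Data.List.Relation.Unary.All.Properties as Allₚ
  open import Data.Product using (_×_; _,_; proj₁; proj₂; Σ-syntax; ∃-syntax)
  open import Data.Sum using (_⊎_; inj₁; inj₂)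
  open import Data.Bool using (true; false; if_then_else_)
  open import Relation.Nullary using (does; yes; no; ¬_; contradiction)
  open import Relation.Nullary.Decidable using (dec-true)
  open import Relation.Binary.PropositionalEquality hiding ([_])
  open BigEndian
  open Growth
  open ≡-Reasoning
  open import Data.Nat.GCD as GCD using (gcd; gcd[m,n]∣m; gcd[m,n]∣n)
  open import Data.Nat.Induction using (<-rec)

  -- Membership of c in the ideal (a , b) of ℤ. It is applied to polynomial values at one integer X
  -- at a time, in place of ideals of polynomials.
  Ideal : ℤ → ℤ → ℤ → Set
  Ideal a b c = Σ[ u ∈ ℤ ] Σ[ v ∈ ℤ ] c ≡ u * a + v * b

  ideal-∣₁ : ∀ {a b c} → a ∣ c → Ideal a b c
  ideal-∣₁ {a} {b} (divides q eq) = q , + 0 ,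
    trans eq (solve 3 (λ q a b → q :* a := q :* a :+ con (+ 0) :* b) refl q a b)

  ideal-∣₂ : ∀ {a b c} → b ∣ c → Ideal a b c
  ideal-∣₂ {a} {b} (divides q eq) = + 0 , q ,
    trans eq (solve 3 (λ q a b → q :* b := con (+ 0) :* a :+ q :* b) refl q a b)

  ideal-sub : ∀ {a b c d} → Ideal a b c → Ideal a b d → Ideal a b (c - d)
  ideal-sub {a} {b} (u , v , refl) (u′ , v′ , refl) = u - u′ , v - v′ ,
    solve 6 (λ a b u v u′ v′ → (u :* a :+ v :* b) :- (u′ :* a :+ v′ :* b) :=
      (u :- u′) :* a :+ (v :- v′) :* b) refl a b u v u′ v′

  ideal-scale : ∀ {a b c} d → Ideal a b c → Ideal a b (d * c)
  ideal-scale {a} {b} d (u , v , refl) = d * u , d * v ,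
    solve 5 (λ a b u v d → d :* (u :* a :+ v :* b) := d :* u :* a :+ d :* v :* b) refl a b u v d

  ideal-∣ : ∀ {a b c d} → Ideal a b c → c ∣ d → Ideal a b d
  ideal-∣ {a} {b} i (divides q refl) = ideal-scale q i

  -- In the product of the two combinations every term other than `u * u′ * (a * a′)` contains b.
  -- This passes from single cyclotomic values to products of them.
  ideal-mul : ∀ {a a′ b c c′} → Ideal a b c → Ideal a′ b c′ → Ideal (a * a′) b (c * c′)
  ideal-mul {a} {a′} {b} (u , v , refl) (u′ , v′ , refl) =
    u * u′ , u * a * v′ + v * (u′ * a′ + v′ * b) ,
    solve 7 (λ a a′ b u v u′ v′ → (u :* a :+ v :* b) :* (u′ :* a′ :+ v′ :* b) :=
      u :* u′ :* (a :* a′) :+ (u :* a :* v′ :+ v :* (u′ :* a′ :+ v′ :* b)) :* b) refl a a′ b u v u′ v′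

  -- Both `a * M` and `b * M` are multiples of `a * b`, hence so is every combination of them. For c
  -- = 1 this is the rule for coprime divisors; a general c records the failure of coprimality.
  ideal⇒∣ : ∀ {a b c M} → Ideal a b c → a ∣ M → b ∣ M → a * b ∣ c * M
  ideal⇒∣ {a} {b} (u , v , refl) (divides s refl) (divides t eq) = divides (u * t + v * s) (begin
    (u * a + v * b) * (s * a)
      ≡⟨ solve 5 (λ u a v b m → (u :* a :+ v :* b) :* m := u :* a :* m :+ v :* b :* m) refl u a v b (s * a) ⟩
    u * a * (s * a) + v * b * (s * a) ≡⟨ cong (λ m → u * a * m + v * b * (s * a)) eq ⟩
    u * a * (t * b) + v * b * (s * a)
      ≡⟨ solve 6 (λ u a v b s t → u :* a :* (t :* b) :+ v :* b :* (s :* a) := (u :* t :+ v :* s) :* (a :* b))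
         refl u a v b s t ⟩
    (u * t + v * s) * (a * b) ∎)

  geometric : ℕ → ℤ → ℤ
  geometric zero    y = + 0
  geometric (suc n) y = + 1 + y * geometric n y

  geometric-telescope : ∀ n y → (y - + 1) * geometric n y ≡ y ^ n - + 1
  geometric-telescope zero y = ℤₚ.*-zeroʳ (y - + 1)
  geometric-telescope (suc n) y = begin
    (y - + 1) * (+ 1 + y * geometric n y)
      ≡⟨ solve 2 (λ y g → (y :- con (+ 1)) :* (con (+ 1) :+ y :* g) :=
           y :* ((y :- con (+ 1)) :* g) :+ (y :- con (+ 1))) refl y (geometric n y) ⟩
    y * ((y - + 1) * geometric n y) + (y - + 1) ≡⟨ cong (λ t → y * t + (y - + 1)) (geometric-telescope n y) ⟩
    y * (y ^ n - + 1) + (y - + 1)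
      ≡⟨ solve 2 (λ y g → y :* (g :- con (+ 1)) :+ (y :- con (+ 1)) := y :* g :- con (+ 1)) refl y (y ^ n) ⟩
    y * y ^ n - + 1 ∎

  -- Modulo `y - + 1` each of the n powers of y in the sum equals 1.
  geometric≡length : ∀ n y → y - + 1 ∣ geometric n y - + n
  geometric≡length zero y = divides (+ 0) refl
  geometric≡length (suc n) y with geometric≡length n y
  ... | divides q eq = divides (y * q + + n) (begin
    (+ 1 + y * geometric n y) - (+ 1 + + n)
      ≡⟨ solve 3 (λ y g n → (con (+ 1) :+ y :* g) :- (con (+ 1) :+ n) :=
           y :* (g :- n) :+ n :* (y :- con (+ 1))) refl y (geometric n y) (+ n) ⟩
    y * (geometric n y - + n) + + n * (y - + 1) ≡⟨ cong (λ t → y * t + + n * (y - + 1)) eq ⟩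
    y * (q * (y - + 1)) + + n * (y - + 1)
      ≡⟨ solve 3 (λ y q n → y :* (q :* (y :- con (+ 1))) :+ n :* (y :- con (+ 1)) :=
           (y :* q :+ n) :* (y :- con (+ 1))) refl y q (+ n) ⟩
    (y * q + + n) * (y - + 1) ∎)

  x^d-1∣x^kd-1 : ∀ x d k → x ^ d - + 1 ∣ x ^ (k ℕ.* d) - + 1
  x^d-1∣x^kd-1 x d k = divides (geometric k (x ^ d)) (trans (cong (_- + 1)
    (trans (cong (x ^_) (ℕₚ.*-comm k d)) (sym (ℤₚ.^-*-assoc x d k))))
    (trans (sym (geometric-telescope k (x ^ d))) (ℤₚ.*-comm (x ^ d - + 1) _)))

  -- Bézout with natural numbers reads s d = g + t e or the same with d and e exchanged, and (x^(s
  -- d) - 1) - x^g (x^(t e) - 1) = x^g - 1 needs no negative exponents.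
  x^g-1∈ideal : ∀ {a b} x d e → a ∣ x ^ d - + 1 → b ∣ x ^ e - + 1 → Ideal a b (x ^ gcd d e - + 1)
  x^g-1∈ideal {a} {b} x d e a∣ b∣ with GCD.Bézout.identity (GCD.gcd-GCD d e)
  ... | GCD.Bézout.+- s t eq = subst (Ideal a b) (begin
      (x ^ (s ℕ.* d) - + 1) - x ^ g * (x ^ (t ℕ.* e) - + 1)
        ≡⟨ cong (λ k → (x ^ k - + 1) - x ^ g * (x ^ (t ℕ.* e) - + 1)) eq ⟨
      (x ^ (g ℕ.+ t ℕ.* e) - + 1) - x ^ g * (x ^ (t ℕ.* e) - + 1)
        ≡⟨ cong (λ k → (k - + 1) - x ^ g * (x ^ (t ℕ.* e) - + 1)) (ℤₚ.^-distribˡ-+-* x g (t ℕ.* e)) ⟩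
      (x ^ g * x ^ (t ℕ.* e) - + 1) - x ^ g * (x ^ (t ℕ.* e) - + 1)
        ≡⟨ solve 2 (λ u v → (u :* v :- con (+ 1)) :- u :* (v :- con (+ 1)) := u :- con (+ 1)) refl (x ^ g) _ ⟩
      x ^ g - + 1 ∎)
    (ideal-sub (ideal-∣₁ (∣-trans a∣ (x^d-1∣x^kd-1 x d s)))
               (ideal-scale (x ^ g) (ideal-∣₂ (∣-trans b∣ (x^d-1∣x^kd-1 x e t)))))
    where g = gcd d e
  ... | GCD.Bézout.-+ s t eq = subst (Ideal a b) (begin
      (x ^ (t ℕ.* e) - + 1) - x ^ g * (x ^ (s ℕ.* d) - + 1)
        ≡⟨ cong (λ k → (x ^ k - + 1) - x ^ g * (x ^ (s ℕ.* d) - + 1)) eq ⟨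
      (x ^ (g ℕ.+ s ℕ.* d) - + 1) - x ^ g * (x ^ (s ℕ.* d) - + 1)
        ≡⟨ cong (λ k → (k - + 1) - x ^ g * (x ^ (s ℕ.* d) - + 1)) (ℤₚ.^-distribˡ-+-* x g (s ℕ.* d)) ⟩
      (x ^ g * x ^ (s ℕ.* d) - + 1) - x ^ g * (x ^ (s ℕ.* d) - + 1)
        ≡⟨ solve 2 (λ u v → (u :* v :- con (+ 1)) :- u :* (v :- con (+ 1)) := u :- con (+ 1)) refl (x ^ g) _ ⟩
      x ^ g - + 1 ∎)
    (ideal-sub (ideal-∣₂ (∣-trans b∣ (x^d-1∣x^kd-1 x e t)))
               (ideal-scale (x ^ g) (ideal-∣₁ (∣-trans a∣ (x^d-1∣x^kd-1 x d s)))))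
    where g = gcd d e

  x^k-1≢0 : ∀ X k → 2 ℕ.≤ X → 1 ℕ.≤ k → (+ X) ^ k - + 1 ≢ + 0
  x^k-1≢0 X k 2≤X 1≤k eq with ℕₚ.m^n≡1⇒n≡0∨m≡1 X k
    (trans (sym (∣x^k∣ X k)) (cong ∣_∣ (ℤₚ.i-j≡0⇒i≡j ((+ X) ^ k) (+ 1) eq)))
  ... | inj₁ refl = contradiction 1≤k λ ()
  ... | inj₂ refl = contradiction 2≤X λ { (s≤s ()) }

  Φ : ℕ → ℤ → ℤ
  Φ d x = eval (cyclotomic d) x

  -- The bound on the divisors is separate from k: j = k - 1 gives the proper divisors, and products
  -- can be compared by induction on j.
  divProd : ℕ → ℕ → ℤ → ℤ
  divProd k zero    x = + 1
  divProd k (suc j) x = (if does (suc j ∣? k) then Φ (suc j) x else + 1) * divProd k j x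

  divisorsOf : ℕ → List (ℕ × Poly) → List Poly
  divisorsOf k [] = []
  divisorsOf k ((d , φ) ∷ r) = if does (d ∣? k) then φ ∷ divisorsOf k r else divisorsOf k r

  -- The metavariable stands for the local function of newCyclo, which has no name here; it is
  -- determined once polyProd has been abstracted to a variable.  That function does not use the
  -- enclosing table, so its values on a tail agree for both tables.
  mutual
    newCyclo≡ : ∀ k prev → newCyclo k prev ≡ divMonic (xPowMinusOne k) (polyProd (divisorsOf k prev))
    newCyclo≡ k prev with polyProd
    ... | c = cong (λ ps → divMonic (xPowMinusOne k) (c ps)) (local≡divisorsOf k prev)

    local≡divisorsOf : ∀ k (l : List (ℕ × Poly)) → _ ≡ divisorsOf k l
    local≡divisorsOf k [] = refl
    local≡divisorsOf k ((d , φ) ∷ l) with does (d ∣? k)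
    ... | true  = cong (φ ∷_) (local≡divisorsOf k l)
    ... | false = local≡divisorsOf k l

  divisorsOf-++ : ∀ k l l′ → divisorsOf k (l ++ l′) ≡ divisorsOf k l ++ divisorsOf k l′
  divisorsOf-++ k [] l′ = refl
  divisorsOf-++ k ((d , φ) ∷ l) l′ with does (d ∣? k)
  ... | true  = cong (φ ∷_) (divisorsOf-++ k l l′)
  ... | false = divisorsOf-++ k l l′

  tableDivisors : ∀ k j → (∀ d → 1 ℕ.≤ d → d ℕ.≤ j → Monic (cyclotomic d)) →
    All Monic (divisorsOf k (cycloTable j)) ×
    (∀ x → prodH (divisorsOf k (cycloTable j)) x ≡ divProd k j x)
  tableDivisors k zero monic = [] , λ x → refl
  tableDivisors k (suc j) monic
    rewrite divisorsOf-++ k (cycloTable j) [ (suc j , cyclotomic (suc j)) ]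
    with tableDivisors k j (λ d 1≤d d≤j → monic d 1≤d (ℕₚ.m≤n⇒m≤1+n d≤j)) | does (suc j ∣? k)
  ... | ms , eq | true = Allₚ.++⁺ ms (monic (suc j) (s≤s z≤n) ℕₚ.≤-refl ∷ []) , λ x → begin
    prodH (divisorsOf k (cycloTable j) ++ [ cyclotomic (suc j) ]) x
      ≡⟨ prodH-++ (divisorsOf k (cycloTable j)) [ cyclotomic (suc j) ] x ⟩
    prodH (divisorsOf k (cycloTable j)) x * (H (cyclotomic (suc j)) x * + 1)
      ≡⟨ cong₂ _*_ (eq x) (trans (ℤₚ.*-identityʳ _) (sym (eval≡H (cyclotomic (suc j)) x))) ⟩
    divProd k j x * Φ (suc j) x ≡⟨ ℤₚ.*-comm (divProd k j x) _ ⟩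
    Φ (suc j) x * divProd k j x ∎
  ... | ms , eq | false = Allₚ.++⁺ ms [] , λ x → begin
    prodH (divisorsOf k (cycloTable j) ++ []) x ≡⟨ prodH-++ (divisorsOf k (cycloTable j)) [] x ⟩
    prodH (divisorsOf k (cycloTable j)) x * + 1 ≡⟨ ℤₚ.*-comm _ (+ 1) ⟩
    + 1 * prodH (divisorsOf k (cycloTable j)) x ≡⟨ cong (+ 1 *_) (eq x) ⟩
    + 1 * divProd k j x ∎

  divProd-mono : ∀ k {j j′} x → j ℕ.≤′ j′ → divProd k j x ∣ divProd k j′ x
  divProd-mono k x ℕ.≤′-refl = ∣-refl
  divProd-mono k {j} {suc j′} x (ℕ.≤′-step le) =
    ℤS.∣n⇒∣m*n (if does (suc j′ ∣? k) then Φ (suc j′) x else + 1) (divProd-mono k x le)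

  *-mono-∣ : ∀ {a b c d} → a ∣ b → c ∣ d → a * c ∣ b * d
  *-mono-∣ {a} {b} {c} {d} a∣b c∣d = ∣-trans (ℤS.*-monoʳ-∣ a c∣d) (ℤS.*-monoˡ-∣ d a∣b)

  1∣ : ∀ a → + 1 ∣ a
  1∣ a = divides a (sym (ℤₚ.*-identityʳ a))

  if-∣-mono : ∀ d {g k a} → g ℕD.∣ k → (if does (d ∣? g) then a else + 1) ∣ (if does (d ∣? k) then a else + 1)
  if-∣-mono d {g} {k} g∣k with d ∣? g | d ∣? k
  ... | yes p | yes q = ∣-refl
  ... | yes p | no ¬q = contradiction (ℕD.∣-trans p g∣k) ¬q
  ... | no _  | yes q = 1∣ _
  ... | no _  | no _  = ∣-refl

  divProd-∣-divProd : ∀ {g k} j x → g ℕD.∣ k → divProd g j x ∣ divProd k j x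
  divProd-∣-divProd zero x g∣k = ∣-refl
  divProd-∣-divProd (suc j) x g∣k = *-mono-∣ (if-∣-mono (suc j) g∣k) (divProd-∣-divProd j x g∣k)

  Factorised : ℕ → Set
  Factorised k = ∀ x → divProd k k x ≡ x ^ k - + 1

  divProd-top : ∀ k x → divProd (suc k) (suc k) x ≡ Φ (suc k) x * divProd (suc k) k x
  divProd-top k x rewrite dec-true (suc k ∣? suc k) ℕD.∣-refl = refl

  Φ∣x^k-1 : ∀ k x → 1 ℕ.≤ k → Factorised k → Φ k x ∣ x ^ k - + 1
  Φ∣x^k-1 (suc k) x _ fact = divides (divProd (suc k) k x)
    (trans (sym (fact x)) (trans (divProd-top k x) (ℤₚ.*-comm (Φ (suc k) x) _)))

  -- Φ_e divides (x^e - 1)/(x^g - 1) ≡ e/g modulo x^g - 1, and x^g - 1 lies in (Φ_d , Φ_e).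
  e/g∈ideal : ∀ {d e} → 1 ℕ.≤ d → 1 ℕ.≤ e → Factorised d → Factorised e → Factorised (gcd d e) →
    ∀ q → e ≡ q ℕ.* gcd d e → gcd d e ℕ.< e → ∀ X → 2 ℕ.≤ X → Ideal (Φ d (+ X)) (Φ e (+ X)) (+ q)
  e/g∈ideal {d} {e@(suc e′)} 1≤d 1≤e fd fe fg q eq (s≤s g≤e′) X 2≤X =
    subst (Ideal (Φ d x) (Φ e x)) (solve 2 (λ G q → G :- (G :- q) := q) refl G (+ q))
      (ideal-sub (ideal-∣₂ Φ∣G) (ideal-∣ (x^g-1∈ideal x d e (Φ∣x^k-1 d x 1≤d fd) (Φ∣x^k-1 e x 1≤e fe))
        (geometric≡length q (x ^ g))))
    where
    x = + X
    g = gcd d e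
    G = geometric q (x ^ g)
    1≤g : 1 ℕ.≤ g
    1≤g = ℕₚ.n≢0⇒n>0 λ g≡0 → contradiction (trans eq (trans (cong (q ℕ.*_) g≡0) (ℕₚ.*-zeroʳ q))) λ ()
    instance
      y≢0 : ℤ.NonZero (x ^ g - + 1)
      y≢0 = ℤ.≢-nonZero (x^k-1≢0 X g 2≤X 1≤g)
    g∣e : g ℕD.∣ e
    g∣e = gcd[m,n]∣n d e
    -- Every divisor of g is a divisor of e below e, so Φ_e times the product for g divides the
    -- product for e, that is, Φ_e (x^g - 1) divides G (x^g - 1). The common factor is nonzero
    -- because X ≥ 2.
    Φ∣G : Φ e x ∣ G
    Φ∣G = ℤS.*-cancelʳ-∣ (x ^ g - + 1) (subst₂ _∣_ (cong (Φ e x *_) (fg x))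
      (trans (sym (divProd-top e′ x)) (trans (fe x) (trans
        (cong (λ k → x ^ k - + 1) (trans eq (ℕₚ.*-comm q g)))
        (trans (cong (_- + 1) (sym (ℤₚ.^-*-assoc x g q)))
        (trans (sym (geometric-telescope q (x ^ g))) (ℤₚ.*-comm _ G))))))
      (ℤS.*-monoʳ-∣ (Φ e x) (∣-trans (divProd-∣-divProd g x g∣e) (divProd-mono e x (ℕₚ.≤⇒≤′ g≤e′)))))

  module _ (e : ℕ) (1≤e : 1 ℕ.≤ e) (fact : ∀ d → 1 ℕ.≤ d → d ℕ.≤ e → Factorised d) where

    -- The constant is e / gcd d e. What matters is that it is chosen before X: growth arguments
    -- tolerate a constant factor only if it is the same for all X.
    Φ-pair : ∀ d → 1 ℕ.≤ d → d ℕ.< e → ∃[ c ] 1 ℕ.≤ c ×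
      (∀ X → 2 ℕ.≤ X → Ideal (Φ d (+ X)) (Φ e (+ X)) (+ c))
    Φ-pair d@(suc _) 1≤d d<e with gcd[m,n]∣n d e
    ... | ℕD.divides q eq = q , 1≤q ,
      e/g∈ideal 1≤d 1≤e (fact d 1≤d (ℕₚ.<⇒≤ d<e)) (fact e 1≤e ℕₚ.≤-refl)
        (fact (gcd d e) 1≤g (ℕₚ.≤-trans g≤d (ℕₚ.<⇒≤ d<e))) q eq (ℕₚ.≤-<-trans g≤d d<e)
      where
      g≤d = ℕD.∣⇒≤ (gcd[m,n]∣m d e)
      positive : ∀ {a b} → e ≡ a ℕ.* b → 1 ℕ.≤ a × 1 ℕ.≤ b
      positive {zero} refl = contradiction 1≤e λ ()
      positive {suc a} {zero} e≡ = contradiction 1≤e (λ le → contradiction (subst (1 ℕ.≤_) (trans e≡ (ℕₚ.*-zeroʳ a)) le) λ ())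
      positive {suc a} {suc b} _ = s≤s z≤n , s≤s z≤n
      1≤q = proj₁ (positive eq)
      1≤g = proj₂ (positive {q} eq)

    divProd-Φ : ∀ k j → j ℕ.< e → ∃[ c ] 1 ℕ.≤ c ×
      (∀ X → 2 ℕ.≤ X → Ideal (divProd k j (+ X)) (Φ e (+ X)) (+ c))
    divProd-Φ k zero j<e = 1 , s≤s z≤n , λ X 2≤X → ideal-∣₁ ∣-refl
    divProd-Φ k (suc j) j<e with divProd-Φ k j (ℕₚ.<-trans (ℕₚ.n<1+n j) j<e) | does (suc j ∣? k)
    ... | c , 1≤c , i | false = c , 1≤c , λ X 2≤X →
          subst (λ t → Ideal t (Φ e (+ X)) (+ c)) (sym (ℤₚ.*-identityˡ _)) (i X 2≤X)
    ... | c , 1≤c , i | true with Φ-pair (suc j) (s≤s z≤n) j<e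
    ... | c′ , 1≤c′ , i′ = c′ ℕ.* c , ℕₚ.*-mono-≤ 1≤c′ 1≤c , λ X 2≤X →
          subst (Ideal _ _) (sym (ℤₚ.pos-* c′ c)) (ideal-mul (i′ X 2≤X) (i X 2≤X))

  does-∣? : ∀ d k → (d ℕD.∣ k × does (d ∣? k) ≡ true) ⊎ (¬ d ℕD.∣ k × does (d ∣? k) ≡ false)
  does-∣? d k with d ∣? k
  ... | yes p = inj₁ (p , refl)
  ... | no ¬p = inj₂ (¬p , refl)

  -- Values of different cyclotomic polynomials can have common factors, so multiplying the
  -- individual divisibilities costs a constant at each step, namely the integer supplied by
  -- `divProd-Φ`. The accumulated constant is absorbed later by `small-multiple-zero`.
  divProd-∣ : ∀ k j → j ℕ.< k → (∀ d → 1 ℕ.≤ d → d ℕ.< k → Factorised d) → ∃[ c ] 1 ℕ.≤ c ×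
    (∀ X → 2 ℕ.≤ X → divProd k j (+ X) ∣ + c * ((+ X) ^ k - + 1))
  divProd-∣ k zero j<k fact = 1 , s≤s z≤n , λ X 2≤X → 1∣ _
  divProd-∣ k (suc j) j<k fact
    with divProd-∣ k j (ℕₚ.<-trans (ℕₚ.n<1+n j) j<k) fact | does-∣? (suc j) k
  ... | c , 1≤c , h | inj₂ (_ , eq) rewrite eq = c , 1≤c , λ X 2≤X → subst (_∣ _) (sym (ℤₚ.*-identityˡ _)) (h X 2≤X)
  ... | c , 1≤c , h | inj₁ (ℕD.divides q eq , does≡) rewrite does≡
    with divProd-Φ (suc j) (s≤s z≤n) (λ d 1≤d d≤ → fact d 1≤d (ℕₚ.≤-<-trans d≤ j<k)) k j ℕₚ.≤-refl
  ... | c′ , 1≤c′ , i = c′ ℕ.* c , ℕₚ.*-mono-≤ 1≤c′ 1≤c , λ X 2≤X →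
    subst₂ _∣_ (ℤₚ.*-comm _ (Φ (suc j) (+ X)))
      (trans (sym (ℤₚ.*-assoc (+ c′) (+ c) _)) (cong (_* ((+ X) ^ k - + 1)) (sym (ℤₚ.pos-* c′ c))))
      (ideal⇒∣ (i X 2≤X) (h X 2≤X)
        (ℤS.∣n⇒∣m*n (+ c) (∣-trans (Φ∣x^k-1 (suc j) (+ X) (s≤s z≤n) (fact (suc j) (s≤s z≤n) j<k))
          (subst (λ t → (+ X) ^ suc j - + 1 ∣ (+ X) ^ t - + 1) (sym eq) (x^d-1∣x^kd-1 (+ X) (suc j) q)))))

  H-replicate : ∀ k x → H (replicate k (+ 0) ++ [ - (+ 1) ]) x ≡ - (+ 1)
  H-replicate zero x = refl
  H-replicate (suc k) x = trans (ℤₚ.+-identityˡ _) (H-replicate k x)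

  length-xPowMinusOne : ∀ k → length (replicate k (+ 0) ++ [ - (+ 1) ]) ≡ suc k
  length-xPowMinusOne zero = refl
  length-xPowMinusOne (suc k) = cong suc (length-xPowMinusOne k)

  H-xPowMinusOne : ∀ k x → H (xPowMinusOne (suc k)) x ≡ x ^ suc k - + 1
  H-xPowMinusOne k x = cong₂ _+_ (trans (ℤₚ.*-identityˡ _) (cong (x ^_) (length-xPowMinusOne k))) (H-replicate k x)

  -- The two claims need each other in the induction: the division for k requires the earlier
  -- polynomials to be monic, and its exactness rests on their factorisations.
  cyclotomic-correct : ∀ k → 1 ℕ.≤ k → Monic (cyclotomic k) × Factorised k
  cyclotomic-correct = <-rec _ step
    where
    step : ∀ k → (∀ {d} → d ℕ.< k → 1 ℕ.≤ d → Monic (cyclotomic d) × Factorised d) →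
           1 ℕ.≤ k → Monic (cyclotomic k) × Factorised k
    step (suc k) ih _ with tableDivisors (suc k) k (λ d 1≤d d≤k → proj₁ (ih (s≤s d≤k) 1≤d))
                         | divProd-∣ (suc k) k ℕₚ.≤-refl (λ d 1≤d d<k → proj₂ (ih d<k 1≤d))
    ... | ms , prodEq | c , 1≤c , div = divide (monic-polyProd ms) (λ x → trans (H-polyProd ms x) (prodEq x))
      where
      f = xPowMinusOne (suc k)
      divide : Monic (polyProd (divisorsOf (suc k) (cycloTable k))) →
               (∀ x → H (polyProd (divisorsOf (suc k) (cycloTable k))) x ≡ divProd (suc k) k x) →
               Monic (cyclotomic (suc k)) × Factorised (suc k)
      divide (gt , G≡) HG with length gt ℕ.<? length f
      -- Were the divisor of larger degree than X^k - 1, the latter would itself be the small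
      -- multiple that has to vanish identically; its value at 2 is not 0.
      ... | no ≮ = contradiction
            (trans (sym (H-xPowMinusOne k (+ 2))) (small-multiple-zero gt f c 1≤c (ℕₚ.≮⇒≥ ≮)
              (λ X 2≤X → subst₂ (λ a b → a ∣ + c * b)
                (trans (sym (HG (+ X))) (cong (λ p → H p (+ X)) G≡)) (sym (H-xPowMinusOne k (+ X))) (div X 2≤X)) (+ 2)))
            (x^k-1≢0 2 (suc k) ℕₚ.≤-refl (s≤s z≤n))
      ... | yes (s≤s lt) = (_ , Φ≡) , λ x → begin
          divProd (suc k) (suc k) x             ≡⟨ divProd-top k x ⟩
          Φ (suc k) x * divProd (suc k) k x     ≡⟨ cong₂ _*_ (trans (eval≡H (cyclotomic (suc k)) x) (cong (λ p → H p x) cyc≡)) (sym (HG′ x)) ⟩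
          H q x * H (+ 1 ∷ gt) x                ≡⟨ exact x ⟨
          H f x                                 ≡⟨ H-xPowMinusOne k x ⟩
          x ^ suc k - + 1                       ∎
        where
        n = length f ℕ.∸ length gt
        q = divMonicAux n gt f
        -- With positive fuel the quotient starts with the leading coefficient 1 of `f`, hence is
        -- monic.
        n≡ : n ≡ suc (length (replicate k (+ 0) ++ [ - (+ 1) ]) ℕ.∸ length gt)
        n≡ = ℕₚ.+-∸-assoc 1 lt
        cyc≡ : cyclotomic (suc k) ≡ q
        cyc≡ = trans (newCyclo≡ (suc k) (cycloTable k)) (cong (divMonic f) G≡)
        Φ≡ : cyclotomic (suc k) ≡ + 1 ∷ _
        Φ≡ = trans cyc≡ (cong (λ m → divMonicAux m gt f) n≡)
        HG′ : ∀ x → H (+ 1 ∷ gt) x ≡ divProd (suc k) k x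
        HG′ x = trans (sym (cong (λ p → H p x) G≡)) (HG x)
        rem = divMonicAux-remainder n gt f (sym (ℕₚ.m∸n+n≡m (ℕₚ.m≤n⇒m≤1+n lt)))
        r = proj₁ rem
        f≡qG+r = proj₂ (proj₂ rem)
        -- The divisor divides both c (X^k - 1) and c times the quotient part, hence c times the
        -- remainder, whose degree is too small.
        r≡0 : ∀ x → H r x ≡ + 0
        r≡0 = small-multiple-zero gt r c 1≤c (ℕₚ.≤-reflexive (proj₁ (proj₂ rem))) λ X 2≤X →
          subst (λ t → H (+ 1 ∷ gt) (+ X) ∣ t)
            (trans (cong (λ t → + c * t - + c * (H q (+ X) * H (+ 1 ∷ gt) (+ X)))
                     (trans (sym (H-xPowMinusOne k (+ X))) (f≡qG+r (+ X))))
              (solve 3 (λ c qg r → c :* (qg :+ r) :- c :* qg := c :* r) refl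
                (+ c) (H q (+ X) * H (+ 1 ∷ gt) (+ X)) (H r (+ X))))
            (ℤS.∣m∣n⇒∣m-n (subst (λ t → t ∣ + c * ((+ X) ^ suc k - + 1)) (sym (HG′ (+ X))) (div X 2≤X))
              (ℤS.∣n⇒∣m*n (+ c) (ℤS.∣n⇒∣m*n (H q (+ X)) ∣-refl)))
        exact : ∀ x → H f x ≡ H q x * H (+ 1 ∷ gt) x
        exact x = trans (f≡qG+r x) (trans (cong (λ t → H q x * H (+ 1 ∷ gt) x + t) (r≡0 x)) (ℤₚ.+-identityʳ _))

-- `D m p` as a least common multiple of the numbers p^k - 1.

module LeastCommonMultiple where

  open import Data.Nat as ℕ using (ℕ; zero; suc; s≤s; z≤n)
  import Data.Nat.Properties as ℕₚ
  open import Data.Nat.Divisibility as ℕD using (_∣?_)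
  open import Data.Integer using (ℤ; +_; -_; _-_; _+_; _*_; ∣_∣; _^_)
  import Data.Integer as ℤ
  import Data.Integer.Properties as ℤₚ
  open import Data.Integer.Divisibility.Signed using (_∣_; divides; ∣-refl; ∣-trans)
  import Data.Integer.Divisibility.Signed as ℤS
  open import Data.Integer.Solver using (module +-*-Solver)
  open +-*-Solver using (solve; _:=_; _:+_; _:*_; _:-_; :-_; con)
  open import Data.Product using (_,_; proj₂)
  open import Data.Sum using (inj₁; inj₂)
  open import Data.Bool using (true; false; if_then_else_)
  open import Relation.Nullary using (does; yes; no; ¬_; contradiction)
  open import Relation.Binary.PropositionalEquality hiding ([_])
  open BigEndian
  open Growth
  open Cyclotomic
  open ≡-Reasoning
  open import Data.Nat.GCD as GCD using (gcd; gcd[m,n]∣m; gcd[m,n]∣n; gcd-comm)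

  factorised : ∀ k → 1 ℕ.≤ k → Factorised k
  factorised k 1≤k = proj₂ (cyclotomic-correct k 1≤k)

  divProd-∣-D : ∀ k j p → divProd k j (+ p) ∣ D j p
  divProd-∣-D k zero p = ∣-refl
  divProd-∣-D k (suc j) p = subst (divProd k (suc j) (+ p) ∣_) (ℤₚ.*-comm (Φ (suc j) (+ p)) (D j p))
    (*-mono-∣ (factor (suc j) (Φ (suc j) (+ p))) (divProd-∣-D k j p))
    where
    factor : ∀ d a → (if does (d ∣? k) then a else + 1) ∣ a
    factor d a with d ∣? k
    ... | yes _ = ∣-refl
    ... | no _  = 1∣ a

  D-mono : ∀ {k m} p → k ℕ.≤′ m → D k p ∣ D m p
  D-mono p ℕ.≤′-refl = ∣-refl
  D-mono {k} {suc m} p (ℕ.≤′-step le) = ℤS.∣m⇒∣m*n (Φ (suc m) (+ p)) (D-mono p le)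

  p^k-1∣D : ∀ p {k m} → 1 ℕ.≤ k → k ℕ.≤ m → (+ p) ^ k - + 1 ∣ D m p
  p^k-1∣D p {k} 1≤k k≤m = subst (_∣ _) (factorised k 1≤k (+ p))
    (∣-trans (divProd-∣-D k k p) (D-mono p (ℕₚ.≤⇒≤′ k≤m)))

  ideal-swap : ∀ {a b c} → Ideal a b c → Ideal b a c
  ideal-swap {a} {b} (u , v , refl) = v , u , ℤₚ.+-comm (u * a) (v * b)

  gcd-positive : ∀ {d} q e → 1 ℕ.≤ d → d ≡ q ℕ.* gcd d e → 1 ℕ.≤ gcd d e
  gcd-positive {d} q e 1≤d d≡ = ℕₚ.n≢0⇒n>0 λ g≡0 → contradiction
    (subst (1 ℕ.≤_) (trans d≡ (trans (cong (q ℕ.*_) g≡0) (ℕₚ.*-zeroʳ q))) 1≤d) λ ()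

  -- Cancelling g in the Bézout identity leaves 1 + t q = s q′, which writes 1 as a combination of
  -- the two given members.
  ideal-one : ∀ {a b} g q q′ s t → 1 ℕ.≤ g → g ℕ.+ t ℕ.* (q ℕ.* g) ≡ s ℕ.* (q′ ℕ.* g) →
    Ideal a b (+ q) → Ideal a b (+ q′) → Ideal a b (+ 1)
  ideal-one {a} {b} g q q′ s t 1≤g eq iq iq′ = subst (Ideal a b)
    (trans (cong₂ _-_ (trans (sym (ℤₚ.pos-* s q′)) (cong +_ (sym reduced))) (sym (ℤₚ.pos-* t q)))
      (solve 1 (λ m → (con (+ 1) :+ m) :- m := con (+ 1)) refl (+ (t ℕ.* q))))
    (ideal-sub (ideal-scale (+ s) iq′) (ideal-scale (+ t) iq))
    where
    reduced : 1 ℕ.+ t ℕ.* q ≡ s ℕ.* q′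
    reduced = ℕₚ.*-cancelʳ-≡ (1 ℕ.+ t ℕ.* q) (s ℕ.* q′) g {{ℕ.>-nonZero 1≤g}}
      (trans (cong (g ℕ.+_) (ℕₚ.*-assoc t q g)) (trans eq (sym (ℕₚ.*-assoc s q′ g))))

  cofactors-Bézout : ∀ {a b} d e q q′ → 1 ℕ.≤ d → d ≡ q′ ℕ.* gcd d e → e ≡ q ℕ.* gcd d e →
    Ideal a b (+ q) → Ideal a b (+ q′) → Ideal a b (+ 1)
  cofactors-Bézout d e q q′ 1≤d d≡ e≡ iq iq′ with GCD.Bézout.identity (GCD.gcd-GCD d e)
  ... | GCD.Bézout.+- s t eq = ideal-one (gcd d e) q q′ s t (gcd-positive q′ e 1≤d d≡)
    (trans (cong (λ m → gcd d e ℕ.+ t ℕ.* m) (sym e≡)) (trans eq (cong (s ℕ.*_) d≡))) iq iq′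
  ... | GCD.Bézout.-+ s t eq = ideal-one (gcd d e) q′ q t s (gcd-positive q′ e 1≤d d≡)
    (trans (cong (λ m → gcd d e ℕ.+ s ℕ.* m) (sym d≡)) (trans eq (cong (t ℕ.*_) e≡))) iq′ iq

  -- `¬ d ∣ e` makes the gcd smaller than d as well as than e, so `e/g∈ideal` can be used in both
  -- directions. When d divides e the values may share a prime: Φ_1(3) = 2 and Φ_2(3) = 4.
  Φ-coprime : ∀ {d e} → 1 ℕ.≤ d → d ℕ.< e → ¬ d ℕD.∣ e → ∀ X → 2 ℕ.≤ X →
    Ideal (Φ d (+ X)) (Φ e (+ X)) (+ 1)
  Φ-coprime {d} {e} 1≤d d<e d∤e X 2≤X with gcd[m,n]∣m d e | gcd[m,n]∣n d e
  ... | ℕD.divides q′ d≡ | ℕD.divides q e≡ = cofactors-Bézout d e q q′ 1≤d d≡ e≡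
    (e/g∈ideal 1≤d 1≤e (factorised d 1≤d) (factorised e 1≤e) (factorised (gcd d e) 1≤g) q e≡
      (ℕₚ.≤-<-trans g≤d d<e) X 2≤X)
    (ideal-swap (e/g∈ideal 1≤e 1≤d (factorised e 1≤e) (factorised d 1≤d)
      (factorised (gcd e d) (subst (1 ℕ.≤_) (gcd-comm d e) 1≤g)) q′
      (trans d≡ (cong (q′ ℕ.*_) (gcd-comm d e))) (subst (ℕ._< d) (gcd-comm d e) g<d) X 2≤X))
    where
    1≤e = ℕₚ.≤-trans 1≤d (ℕₚ.<⇒≤ d<e)
    1≤g : 1 ℕ.≤ gcd d e
    1≤g = gcd-positive q′ e 1≤d d≡
    g≤d : gcd d e ℕ.≤ d
    g≤d = ℕD.∣⇒≤ {{ℕ.>-nonZero 1≤d}} (gcd[m,n]∣m d e)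
    g<d : gcd d e ℕ.< d
    g<d = ℕₚ.≤∧≢⇒< g≤d λ g≡d → d∤e (subst (ℕD._∣ e) g≡d (gcd[m,n]∣n d e))

  nonDivProd : ℕ → ℕ → ℤ → ℤ
  nonDivProd k zero    x = + 1
  nonDivProd k (suc j) x = (if does (suc j ∣? k) then + 1 else Φ (suc j) x) * nonDivProd k j x

  D-split : ∀ k j p → D j p ≡ nonDivProd k j (+ p) * divProd k j (+ p)
  D-split k zero p = refl
  D-split k (suc j) p rewrite D-split k j p with does (suc j ∣? k)
  ... | true = solve 3 (λ n d a → n :* d :* a := con (+ 1) :* n :* (a :* d)) refl
        (nonDivProd k j (+ p)) (divProd k j (+ p)) (Φ (suc j) (+ p))
  ... | false = solve 3 (λ n d a → n :* d :* a := a :* n :* (con (+ 1) :* d)) refl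
        (nonDivProd k j (+ p)) (divProd k j (+ p)) (Φ (suc j) (+ p))

  nonDivProd-coprime : ∀ e j → j ℕ.< e → ∀ X → 2 ℕ.≤ X → Ideal (nonDivProd e j (+ X)) (Φ e (+ X)) (+ 1)
  nonDivProd-coprime e zero j<e X 2≤X = ideal-∣₁ ∣-refl
  nonDivProd-coprime e (suc j) j<e X 2≤X
    with nonDivProd-coprime e j (ℕₚ.<-trans (ℕₚ.n<1+n j) j<e) X 2≤X | does-∣? (suc j) e
  ... | i | inj₁ (_ , eq) rewrite eq = subst (λ t → Ideal t (Φ e (+ X)) (+ 1)) (sym (ℤₚ.*-identityˡ _)) i
  ... | i | inj₂ (∤ , eq) rewrite eq = ideal-mul (Φ-coprime (s≤s z≤n) j<e ∤ X 2≤X) i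

  -- In the induction step let P collect the Φ_d with d a proper divisor of m + 1, and R the
  -- remaining ones up to m. Then R P and φ P = p^(m+1) - 1 both divide Z. After cancelling P, the
  -- coprime numbers R and φ divide the same integer, so R φ P divides Z.
  D-least : ∀ p m Z → 2 ℕ.≤ p → (∀ k → 1 ℕ.≤ k → k ℕ.≤ m → (+ p) ^ k - + 1 ∣ Z) → D m p ∣ Z
  D-least p zero Z 2≤p h = 1∣ Z
  D-least p (suc m) Z 2≤p h
    with D-least p m Z 2≤p (λ k 1≤k k≤m → h k 1≤k (ℕₚ.m≤n⇒m≤1+n k≤m)) | h (suc m) (s≤s z≤n) ℕₚ.≤-refl
  ... | divides s Z≡ | divides t Z≡′ =
    subst₂ _∣_ (sym D≡) (sym ZP) (ℤS.*-monoˡ-∣ P (subst (R * φ ∣_) (ℤₚ.*-identityˡ (s * R))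
      (ideal⇒∣ (nonDivProd-coprime (suc m) m ℕₚ.≤-refl p 2≤p) (divides s refl) (divides t sR≡tφ))))
    where
    x = + p
    P = divProd (suc m) m x
    R = nonDivProd (suc m) m x
    φ = Φ (suc m) x
    φP≡ : φ * P ≡ x ^ suc m - + 1
    φP≡ = trans (sym (divProd-top m x)) (factorised (suc m) (s≤s z≤n) x)
    instance
      P≢0 : ℤ.NonZero P
      P≢0 = ℤ.≢-nonZero λ P≡0 → x^k-1≢0 p (suc m) 2≤p (s≤s z≤n)
        (trans (sym φP≡) (trans (cong (φ *_) P≡0) (ℤₚ.*-zeroʳ φ)))
    ZP : Z ≡ s * R * P
    ZP = trans Z≡ (trans (cong (s *_) (D-split (suc m) m p)) (sym (ℤₚ.*-assoc s R P)))
    sR≡tφ : s * R ≡ t * φ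
    sR≡tφ = ℤₚ.*-cancelʳ-≡ (s * R) (t * φ) P (trans (sym ZP) (trans Z≡′
      (trans (cong (t *_) (sym φP≡)) (sym (ℤₚ.*-assoc t φ P)))))
    D≡ : D m p * φ ≡ R * φ * P
    D≡ = trans (cong (_* φ) (D-split (suc m) m p)) (solve 3 (λ R P φ → R :* P :* φ := R :* φ :* P) refl R P φ)

-- The ring of matrices modulo n and the bicommutant of an element.

module Matrices where

  open import Algebra.Bundles using (Ring; CommutativeRing)
  open import Data.Nat using (ℕ; zero; suc)
  open import Data.Integer using (ℤ; +_; -_; _-_; _+_; _*_; ∣_∣)
  import Data.Integer.Properties as ℤₚ
  open import Data.Integer.Divisibility.Signed as ℤS using (_∣_; divides; ∣⇒∣ᵤ; ∣ᵤ⇒∣)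
  open import Data.Integer.Solver using (module +-*-Solver)
  open +-*-Solver using (solve; _:=_; _:+_; _:*_; _:-_; :-_)
  open import Data.Fin using (Fin; zero; suc)
  open import Data.Product using (_,_)
  open import Level using (0ℓ)
  open import Relation.Binary.PropositionalEquality

  module _ {n : ℕ} where

    mod⇒∣ : ∀ {a b} → a ≡[mod n ] b → + n ∣ a - b
    mod⇒∣ = ∣ᵤ⇒∣ {+ n}

    mod-reflexive : ∀ {a b} → a ≡ b → a ≡[mod n ] b
    mod-reflexive {a} refl = ∣⇒∣ᵤ {+ n} {a - a} (divides (+ 0) (ℤₚ.i≡j⇒i-j≡0 {a} refl))

    mod-sym : ∀ a b → a ≡[mod n ] b → b ≡[mod n ] a
    mod-sym a b h = ∣⇒∣ᵤ {+ n} (subst (+ n ∣_) (solve 2 (λ a b → :- (a :- b) := b :- a) refl a b)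
      (ℤS.∣m⇒∣-m (mod⇒∣ {a} {b} h)))

    mod-trans : ∀ a b c → a ≡[mod n ] b → b ≡[mod n ] c → a ≡[mod n ] c
    mod-trans a b c h k = ∣⇒∣ᵤ {+ n} (subst (+ n ∣_) (solve 3 (λ a b c → (a :- b) :+ (b :- c) := a :- c) refl a b c)
      (ℤS.∣m∣n⇒∣m+n (mod⇒∣ {a} {b} h) (mod⇒∣ {b} {c} k)))

    mod-+ : ∀ a b c d → a ≡[mod n ] b → c ≡[mod n ] d → (a + c) ≡[mod n ] (b + d)
    mod-+ a b c d h k = ∣⇒∣ᵤ {+ n} (subst (+ n ∣_)
      (solve 4 (λ a b c d → (a :- b) :+ (c :- d) := (a :+ c) :- (b :+ d)) refl a b c d)
      (ℤS.∣m∣n⇒∣m+n (mod⇒∣ {a} {b} h) (mod⇒∣ {c} {d} k)))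

    mod-* : ∀ a b c d → a ≡[mod n ] b → c ≡[mod n ] d → (a * c) ≡[mod n ] (b * d)
    mod-* a b c d h k = ∣⇒∣ᵤ {+ n} (subst (+ n ∣_)
      (solve 4 (λ a b c d → c :* (a :- b) :+ b :* (c :- d) := a :* c :- b :* d) refl a b c d)
      (ℤS.∣m∣n⇒∣m+n (ℤS.∣n⇒∣m*n c (mod⇒∣ {a} {b} h)) (ℤS.∣n⇒∣m*n b (mod⇒∣ {c} {d} k))))

    mod-neg : ∀ a b → a ≡[mod n ] b → (- a) ≡[mod n ] (- b)
    mod-neg a b h = ∣⇒∣ᵤ {+ n} (subst (+ n ∣_) (solve 2 (λ a b → :- (a :- b) := :- a :- :- b) refl a b)
      (ℤS.∣m⇒∣-m (mod⇒∣ {a} {b} h)))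

    sum-mod : ∀ {m} (f g : Fin m → ℤ) → (∀ i → f i ≡[mod n ] g i) → sumFin f ≡[mod n ] sumFin g
    sum-mod {zero}  f g h = mod-reflexive {+ 0} refl
    sum-mod {suc m} f g h = mod-+ (f zero) (g zero) _ _ (h zero)
      (sum-mod (λ i → f (suc i)) (λ i → g (suc i)) (λ i → h (suc i)))

  sum-cong : ∀ {m} {f g : Fin m → ℤ} → (∀ i → f i ≡ g i) → sumFin f ≡ sumFin g
  sum-cong {zero}  h = refl
  sum-cong {suc m} h = cong₂ _+_ (h zero) (sum-cong (λ i → h (suc i)))

  sum-zero : ∀ m → sumFin {m} (λ _ → + 0) ≡ + 0
  sum-zero zero    = refl
  sum-zero (suc m) = trans (ℤₚ.+-identityˡ _) (sum-zero m)

  sum-+ : ∀ {m} (f g : Fin m → ℤ) → sumFin (λ i → f i + g i) ≡ sumFin f + sumFin g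
  sum-+ {zero}  f g = refl
  sum-+ {suc m} f g = trans (cong (λ t → f zero + g zero + t) (sum-+ (λ i → f (suc i)) (λ i → g (suc i))))
    (solve 4 (λ a b c d → a :+ b :+ (c :+ d) := a :+ c :+ (b :+ d)) refl (f zero) (g zero) _ _)

  sum-*ˡ : ∀ {m} c (f : Fin m → ℤ) → sumFin (λ i → c * f i) ≡ c * sumFin f
  sum-*ˡ {zero}  c f = sym (ℤₚ.*-zeroʳ c)
  sum-*ˡ {suc m} c f = trans (cong (λ t → c * f zero + t) (sum-*ˡ c (λ i → f (suc i))))
    (sym (ℤₚ.*-distribˡ-+ c (f zero) _))

  sum-*ʳ : ∀ {m} c (f : Fin m → ℤ) → sumFin (λ i → f i * c) ≡ sumFin f * c
  sum-*ʳ c f = trans (sum-cong (λ i → ℤₚ.*-comm (f i) c)) (trans (sum-*ˡ c f) (ℤₚ.*-comm c (sumFin f)))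

  sum-swap : ∀ {m k} (f : Fin m → Fin k → ℤ) →
    sumFin (λ i → sumFin (f i)) ≡ sumFin (λ j → sumFin (λ i → f i j))
  sum-swap {zero}  {k} f = sym (sum-zero k)
  sum-swap {suc m} f = trans (cong (λ t → sumFin (f zero) + t) (sum-swap (λ i → f (suc i))))
    (sym (sum-+ (f zero) (λ j → sumFin (λ i → f (suc i) j))))

  sum-idˡ : ∀ {m} (i : Fin m) f → sumFin (λ k → idMat i k * f k) ≡ f i
  sum-idˡ {suc m} zero f = trans (cong₂ _+_ (ℤₚ.*-identityˡ (f zero)) (sum-zero m)) (ℤₚ.+-identityʳ (f zero))
  sum-idˡ {suc m} (suc i) f = trans (ℤₚ.+-identityˡ _) (sum-idˡ i (λ k → f (suc k)))

  idMat-sym : ∀ {m} (i j : Fin m) → idMat i j ≡ idMat j i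
  idMat-sym zero zero = refl
  idMat-sym zero (suc j) = refl
  idMat-sym (suc i) zero = refl
  idMat-sym (suc i) (suc j) = idMat-sym i j

  sum-idʳ : ∀ {m} (j : Fin m) f → sumFin (λ k → f k * idMat k j) ≡ f j
  sum-idʳ j f = trans (sum-cong (λ k → trans (ℤₚ.*-comm (f k) _) (cong (_* f k) (idMat-sym k j)))) (sum-idˡ j f)

  -- A record, so that the two matrices can be inferred from a proof of congruence.
  record Congruent (n : ℕ) {m} (A B : Mat m) : Set where
    constructor congruent
    field entries : MatEq n A B
  open Congruent public

  _⊕_ : ∀ {m} → Mat m → Mat m → Mat m
  (A ⊕ B) i j = A i j + B i j

  ⊝_ : ∀ {m} → Mat m → Mat m
  (⊝ A) i j = - A i j

  zeroMat : ∀ {m} → Mat m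
  zeroMat i j = + 0

  ⊗-assoc : ∀ {m} (A B C : Mat m) i j → ((A ⊗ B) ⊗ C) i j ≡ (A ⊗ (B ⊗ C)) i j
  ⊗-assoc A B C i j = trans
    (sum-cong (λ k → sym (sum-*ʳ (C k j) (λ l → A i l * B l k))))
    (trans (sum-swap (λ k l → A i l * B l k * C k j))
      (sum-cong (λ l → trans (sum-cong (λ k → ℤₚ.*-assoc (A i l) (B l k) (C k j)))
        (sum-*ˡ (A i l) (λ k → B l k * C k j)))))

  matRing : ℕ → ℕ → Ring 0ℓ 0ℓ
  matRing n m = record
    { Carrier = Mat m
    ; _≈_ = Congruent n
    ; _+_ = _⊕_
    ; _*_ = _⊗_
    ; -_ = ⊝_
    ; 0# = zeroMat
    ; 1# = idMat
    ; isRing = record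
      { +-isAbelianGroup = record
        { isGroup = record
          { isMonoid = record
            { isSemigroup = record
              { isMagma = record
                { isEquivalence = record
                  { refl = λ {A} → exact λ i j → refl
                  ; sym = λ {A} {B} h → congruent λ i j → mod-sym (A i j) (B i j) (entries h i j)
                  ; trans = λ {A} {B} {C} h k → congruent λ i j →
                      mod-trans (A i j) (B i j) (C i j) (entries h i j) (entries k i j) }
                ; ∙-cong = λ {A} {B} {C} {D} h k → congruent λ i j →
                    mod-+ (A i j) (B i j) (C i j) (D i j) (entries h i j) (entries k i j) }
              ; assoc = λ A B C → exact λ i j → ℤₚ.+-assoc (A i j) (B i j) (C i j) }
            ; identity = (λ A → exact λ i j → ℤₚ.+-identityˡ (A i j))
                       , (λ A → exact λ i j → ℤₚ.+-identityʳ (A i j)) }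
          ; inverse = (λ A → exact λ i j → ℤₚ.+-inverseˡ (A i j))
                    , (λ A → exact λ i j → ℤₚ.+-inverseʳ (A i j))
          ; ⁻¹-cong = λ {A} {B} h → congruent λ i j → mod-neg (A i j) (B i j) (entries h i j) }
        ; comm = λ A B → exact λ i j → ℤₚ.+-comm (A i j) (B i j) }
      ; *-cong = λ {A} {B} {C} {D} h k → congruent λ i j → sum-mod _ _ (λ l →
          mod-* (A i l) (B i l) (C l j) (D l j) (entries h i l) (entries k l j))
      ; *-assoc = λ A B C → exact (⊗-assoc A B C)
      ; *-identity = (λ A → exact λ i j → sum-idˡ i (λ k → A k j))
                   , (λ A → exact λ i j → sum-idʳ j (λ k → A i k))
      ; distrib =
          (λ A B C → exact λ i j → trans (sum-cong (λ k → ℤₚ.*-distribˡ-+ (A i k) (B k j) (C k j)))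
            (sum-+ (λ k → A i k * B k j) (λ k → A i k * C k j)))
        , (λ A B C → exact λ i j → trans (sum-cong (λ k → ℤₚ.*-distribʳ-+ (A k j) (B i k) (C i k)))
            (sum-+ (λ k → B i k * A k j) (λ k → C i k * A k j)))
      }
    }
    where
    exact : {A B : Mat m} → (∀ i j → A i j ≡ B i j) → Congruent n A B
    exact h = congruent λ i j → mod-reflexive (h i j)

  module Bicommutant (M : Ring 0ℓ 0ℓ) (a : Ring.Carrier M) where
    open Ring M renaming (_+_ to _+ᴹ_; _*_ to _*ᴹ_; -_ to -ᴹ_; refl to reflᴹ; sym to symᴹ; trans to transᴹ)
    open import Algebra.Properties.Ring M using (-‿distribˡ-*; -‿distribʳ-*)

    -- An element together with the proof that it commutes with whatever commutes with a. Since a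
    -- commutes with itself, each such element commutes with a, and therefore any two of them
    -- commute. This embeds a in a commutative ring, where the binomial theorem and Frobenius are
    -- available.
    record Elem : Set where
      constructor elem
      field
        value    : Carrier
        commutes : ∀ y → a *ᴹ y ≈ y *ᴹ a → value *ᴹ y ≈ y *ᴹ value
    open Elem public

    generator : Elem
    generator = elem a (λ y h → h)

    bicommutant : CommutativeRing 0ℓ 0ℓ
    bicommutant = record
      { Carrier = Elem
      ; _≈_ = λ x y → value x ≈ value y
      ; _+_ = λ x y → elem (value x +ᴹ value y) λ z h → transᴹ (distribʳ z (value x) (value y))
          (transᴹ (+-cong (commutes x z h) (commutes y z h)) (symᴹ (distribˡ z (value x) (value y))))
      ; _*_ = λ x y → elem (value x *ᴹ value y) λ z h → transᴹ (*-assoc (value x) (value y) z)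
          (transᴹ (*-congˡ (commutes y z h)) (transᴹ (symᴹ (*-assoc (value x) z (value y)))
          (transᴹ (*-congʳ (commutes x z h)) (*-assoc z (value x) (value y)))))
      ; -_ = λ x → elem (-ᴹ value x) λ z h → transᴹ (symᴹ (-‿distribˡ-* (value x) z))
          (transᴹ (-‿cong (commutes x z h)) (-‿distribʳ-* z (value x)))
      ; 0# = elem 0# λ z h → transᴹ (zeroˡ z) (symᴹ (zeroʳ z))
      ; 1# = elem 1# λ z h → transᴹ (*-identityˡ z) (symᴹ (*-identityʳ z))
      ; isCommutativeRing = record
        { isRing = record
          { +-isAbelianGroup = record
            { isGroup = record
              { isMonoid = record
                { isSemigroup = record
                  { isMagma = record
                    { isEquivalence = record { refl = reflᴹ ; sym = symᴹ ; trans = transᴹ }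
                    ; ∙-cong = +-cong }
                  ; assoc = λ x y z → +-assoc (value x) (value y) (value z) }
                ; identity = (λ x → +-identityˡ (value x)) , (λ x → +-identityʳ (value x)) }
              ; inverse = (λ x → -‿inverseˡ (value x)) , (λ x → -‿inverseʳ (value x))
              ; ⁻¹-cong = -‿cong }
            ; comm = λ x y → +-comm (value x) (value y) }
          ; *-cong = *-cong
          ; *-assoc = λ x y z → *-assoc (value x) (value y) (value z)
          ; *-identity = (λ x → *-identityˡ (value x)) , (λ x → *-identityʳ (value x))
          ; distrib = (λ x y z → distribˡ (value x) (value y) (value z))
                    , (λ x y z → distribʳ (value x) (value y) (value z)) }
        ; *-comm = λ x y → commutes x (value y) (symᴹ (commutes y a reflᴹ)) } }

-- Frobenius on algebras over the prime field, and divided differences.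

module Frobenius where

  open Matrices
  open import Algebra.Bundles using (CommutativeRing)
  import Algebra.Solver.Ring as RingSolver
  open import Algebra.Solver.Ring.AlmostCommutativeRing using (fromCommutativeRing; _-Raw-AlmostCommutative⟶_)
  open import Data.Nat as ℕ using (ℕ; zero; suc; s≤s; z≤n; _!; _∸_)
  import Data.Nat.Properties as ℕₚ
  import Data.Nat.Divisibility as ℕD
  open import Data.Nat.DivMod using (m/n*n≡m)
  open import Data.Nat.Combinatorics using (_C_; nCn≡1; nCk≡n!/k![n-k]!; k![n∸k]!∣n!)
  open import Data.Nat.GCD using (module Bézout)
  open import Data.Nat.Coprimality using (Coprime; coprime-Bézout)
  open import Data.Nat.Primality using (Prime; euclidsLemma; prime⇒irreducible; prime⇒nonTrivial)
  open import Data.Integer as ℤ using (ℤ; +_; -[1+_]; ∣_∣)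
  import Data.Integer.Properties as ℤₚ
  open import Data.Integer.Divisibility.Signed as ℤS using (divides; ∣⇒∣ᵤ; ∣ᵤ⇒∣)
  open import Data.Integer.Solver using (module +-*-Solver)
  open import Data.Fin using (zero; suc; toℕ; fromℕ; inject₁)
  import Data.Fin.Properties as Finₚ
  open import Data.List using (List; []; _∷_; _∷ʳ_; [_]; length; map; initLast; _∷ʳ′_)
  import Data.List.Properties as Listₚ
  open import Data.List.Relation.Unary.All using (All; []; _∷_)
  open import Data.List.Relation.Unary.Any as Any using (Any; here)
  import Data.List.Relation.Unary.Any.Properties as Anyₚ
  open import Data.Maybe using (Maybe; just; nothing)
  open import Data.Product using (_,_; ∃-syntax)
  open import Data.Sum using (inj₁; inj₂)
  open import Level using (0ℓ)
  open import Relation.Nullary using (yes; no; ¬_; contradiction)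
  open import Relation.Binary.PropositionalEquality as ≡ using (_≡_)

  mod-inverse : ∀ {n} d → Coprime ∣ d ∣ n → ∃[ u ] (u ℤ.* d) ≡[mod n ] (+ 1)
  mod-inverse {n} d c with coprime-Bézout c
  ... | Bézout.+- x y eq = ℤ.sign d ℤ.◃ x , ∣⇒∣ᵤ {+ n} (divides (+ y) (≡.trans (≡.cong (ℤ._- + 1) eqℤ)
          (≡.trans (+-*-Solver.solve 1 (λ m → (con (+ 1) :+ m) :- con (+ 1) := m) ≡.refl (+ (y ℕ.* n))) (ℤₚ.pos-* y n))))
    where
    open +-*-Solver
    eqℤ : (ℤ.sign d ℤ.◃ x) ℤ.* d ≡ + (1 ℕ.+ y ℕ.* n)
    eqℤ = ≡.trans (signed d) (≡.cong +_ (≡.sym eq))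
      where
      signed : ∀ d → (ℤ.sign d ℤ.◃ x) ℤ.* d ≡ + (x ℕ.* ∣ d ∣)
      signed (+ m) = ≡.trans (≡.cong (ℤ._* + m) (ℤₚ.+◃n≡+n x)) (≡.sym (ℤₚ.pos-* x m))
      signed -[1+ m ] = ≡.trans (≡.cong (ℤ._* -[1+ m ]) (ℤₚ.-◃n≡-n x))
        (≡.trans (+-*-Solver.solve 2 (λ x m → :- x :* :- m := x :* m) ≡.refl (+ x) (+ suc m)) (≡.sym (ℤₚ.pos-* x (suc m))))
  ... | Bézout.-+ x y eq = ℤ.- (ℤ.sign d ℤ.◃ x) , ∣⇒∣ᵤ {+ n} (divides (ℤ.- + y) (≡.trans (≡.cong (ℤ._- + 1) (eqℤ d))
          (≡.trans (+-*-Solver.solve 1 (λ m → (:- m) :- con (+ 1) := :- (con (+ 1) :+ m)) ≡.refl (+ (x ℕ.* ∣ d ∣)))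
            (≡.trans (≡.cong (λ m → ℤ.- + m) eq) (≡.trans (≡.cong ℤ.-_ (ℤₚ.pos-* y n)) (ℤₚ.neg-distribˡ-* (+ y) (+ n)))))))
    where
    open +-*-Solver
    eqℤ : ∀ d → (ℤ.- (ℤ.sign d ℤ.◃ x)) ℤ.* d ≡ ℤ.- + (x ℕ.* ∣ d ∣)
    eqℤ (+ m) = ≡.trans (≡.cong (λ t → (ℤ.- t) ℤ.* + m) (ℤₚ.+◃n≡+n x))
      (≡.trans (≡.sym (ℤₚ.neg-distribˡ-* (+ x) (+ m))) (≡.cong ℤ.-_ (≡.sym (ℤₚ.pos-* x m))))
    eqℤ -[1+ m ] = ≡.trans (≡.cong (λ t → (ℤ.- t) ℤ.* -[1+ m ]) (ℤₚ.-◃n≡-n x))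
      (≡.trans (+-*-Solver.solve 2 (λ x m → (:- :- x) :* :- m := :- (x :* m)) ≡.refl (+ x) (+ suc m))
        (≡.cong ℤ.-_ (≡.sym (ℤₚ.pos-* x (suc m)))))

  prime∤⇒coprime : ∀ {p d} → Prime p → ¬ p ℕD.∣ d → Coprime d p
  prime∤⇒coprime {p} {d} p-prime p∤d (e∣d , e∣p) with prime⇒irreducible p-prime e∣p
  ... | inj₁ e≡1 = e≡1
  ... | inj₂ ≡.refl = contradiction e∣d p∤d

  prime∤! : ∀ {p} → Prime p → ∀ k → k ℕ.< p → ¬ p ℕD.∣ k !
  prime∤! p-prime zero k<p p∣1 = ℕ.nonTrivial⇒≢1 {{prime⇒nonTrivial p-prime}} (ℕD.∣1⇒≡1 p∣1)
  prime∤! p-prime (suc k) k<p p∣ with euclidsLemma (suc k) (k !) p-prime p∣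
  ... | inj₁ p∣1+k = ℕₚ.<⇒≱ k<p (ℕD.∣⇒≤ p∣1+k)
  ... | inj₂ p∣k! = prime∤! p-prime k (ℕₚ.<-trans (ℕₚ.n<1+n k) k<p) p∣k!

  prime∣C : ∀ {p} → Prime p → ∀ k → 0 ℕ.< k → k ℕ.< p → p ℕD.∣ p C k
  prime∣C {p@(suc p-1)} p-prime k 0<k k<p
    with euclidsLemma (p C k) (k ! ℕ.* (p ∸ k) !) p-prime
      (≡.subst (p ℕD.∣_) (≡.sym C*≡) (ℕD.m∣m*n (p-1 !)))
    where
    k≤p = ℕₚ.<⇒≤ k<p
    instance _ = k ℕₚ.!* (p ∸ k) !≢0
    C*≡ : (p C k) ℕ.* (k ! ℕ.* (p ∸ k) !) ≡ p !
    C*≡ = ≡.trans (≡.cong (ℕ._* (k ! ℕ.* (p ∸ k) !)) (nCk≡n!/k![n-k]! k≤p)) (m/n*n≡m (k![n∸k]!∣n! k≤p))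
  ... | inj₁ p∣C = p∣C
  ... | inj₂ p∣k!l! with euclidsLemma (k !) ((p ∸ k) !) p-prime p∣k!l!
  ...   | inj₁ p∣k! = contradiction p∣k! (prime∤! p-prime k k<p)
  ...   | inj₂ p∣l! = contradiction p∣l! (prime∤! p-prime (p ∸ k) (ℕₚ.∸-monoʳ-< 0<k (ℕₚ.<⇒≤ k<p)))

  -- A commutative ring in which p is 0, presented by its structure map from ℤ, so that integers
  -- serve as coefficients and congruences modulo p become equations. Zero divisors are allowed.
  record 𝔽-Algebra (p : ℕ) : Set₁ where
    field
      commutativeRing : CommutativeRing 0ℓ 0ℓ
    open CommutativeRing commutativeRing public
    field
      ι     : ℤ → Carrier
      ι-+   : ∀ a b → ι (a ℤ.+ b) ≈ ι a + ι b
      ι-*   : ∀ a b → ι (a ℤ.* b) ≈ ι a * ι b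
      ι-neg : ∀ a → ι (ℤ.- a) ≈ - ι a
      ι-0   : ι (+ 0) ≈ 0#
      ι-1   : ι (+ 1) ≈ 1#
      ι-p   : ι (+ p) ≈ 0#

  module Theory {p : ℕ} (p-prime : Prime p) (𝔽 : 𝔽-Algebra p) where
    open 𝔽-Algebra 𝔽 public hiding (zero)
    open import Relation.Binary.Reasoning.Setoid setoid
    open import Algebra.Properties.CommutativeSemiring.Exp commutativeSemiring public
      using (_^_; ^-congˡ; ^-congʳ; ^-homo-*; ^-assocʳ; ^-distrib-*)
    open import Algebra.Properties.Semiring.Mult semiring using (_×_; ×-homo-1)
    open import Algebra.Properties.Semiring.Sum semiring using (sum; sum-cong-≋; sum-init-last; sum-replicate-zero)
    open import Algebra.Properties.CommutativeSemiring.Binomial commutativeSemiring using (theorem; binomialTerm)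

    private
      weaklyDecidable : ∀ a b → Maybe (ι a ≈ ι b)
      weaklyDecidable a b with a ℤ.≟ b
      ... | yes ≡.refl = just refl
      ... | no _ = nothing

      ι-morphism : ℤ.+-*-rawRing -Raw-AlmostCommutative⟶ fromCommutativeRing commutativeRing
      ι-morphism = record
        { ⟦_⟧ = ι ; +-homo = ι-+ ; *-homo = ι-* ; -‿homo = ι-neg ; 0-homo = ι-0 ; 1-homo = ι-1 }

    open RingSolver ℤ.+-*-rawRing (fromCommutativeRing commutativeRing) ι-morphism weaklyDecidable
      public using (solve; _:=_; _:+_; _:*_; :-_; _:-_)

    1<p : 1 ℕ.< p
    1<p = ℕ.nonTrivial⇒n>1 p {{prime⇒nonTrivial p-prime}}

    ι-∣ : ∀ {a} → + p ℤS.∣ a → ι a ≈ 0#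
    ι-∣ (divides q ≡.refl) = trans (ι-* q (+ p)) (trans (*-congˡ ι-p) (zeroʳ (ι q)))

    ι-mod : ∀ {a b} → a ≡[mod p ] b → ι a ≈ ι b
    ι-mod {a} {b} h = begin
      ι a                 ≡⟨ ≡.cong ι (+-*-Solver.solve 2 (λ a b → a ℤS:= (a ℤS:- b) ℤS:+ b) ≡.refl a b) ⟩
      ι (a ℤ.- b ℤ.+ b)   ≈⟨ ι-+ (a ℤ.- b) b ⟩
      ι (a ℤ.- b) + ι b   ≈⟨ +-congʳ (ι-∣ (∣ᵤ⇒∣ {+ p} h)) ⟩
      0# + ι b            ≈⟨ +-identityˡ (ι b) ⟩
      ι b                 ∎
      where open +-*-Solver using () renaming (_:=_ to _ℤS:=_; _:-_ to _ℤS:-_; _:+_ to _ℤS:+_)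

    ι-unit : ∀ d → ¬ p ℕD.∣ ∣ d ∣ → ∃[ u ] ι u * ι d ≈ 1#
    ι-unit d p∤d with mod-inverse {p} d (prime∤⇒coprime p-prime p∤d)
    ... | u , ud≡1 = u , trans (sym (ι-* u d)) (trans (ι-mod {u ℤ.* d} {+ 1} ud≡1) ι-1)

    ×≈ι* : ∀ k x → k × x ≈ ι (+ k) * x
    ×≈ι* zero x = sym (trans (*-congʳ ι-0) (zeroˡ x))
    ×≈ι* (suc k) x = begin
      x + k × x                   ≈⟨ +-cong (sym (*-identityˡ x)) (×≈ι* k x) ⟩
      1# * x + ι (+ k) * x        ≈⟨ +-congʳ (*-congʳ (sym ι-1)) ⟩
      ι (+ 1) * x + ι (+ k) * x   ≈⟨ distribʳ x _ _ ⟨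
      (ι (+ 1) + ι (+ k)) * x     ≈⟨ *-congʳ (ι-+ (+ 1) (+ k)) ⟨
      ι (+ suc k) * x             ∎

    ∣⇒×≈0 : ∀ {k} x → p ℕD.∣ k → k × x ≈ 0#
    ∣⇒×≈0 {k} x p∣k = trans (×≈ι* k x) (trans (*-congʳ (ι-∣ (∣ᵤ⇒∣ {+ p} {+ k} p∣k))) (zeroˡ x))

    1^n≈1 : ∀ n → 1# ^ n ≈ 1#
    1^n≈1 zero    = refl
    1^n≈1 (suc n) = trans (*-identityˡ _) (1^n≈1 n)

    0^n≈0 : ∀ {n} → 0 ℕ.< n → 0# ^ n ≈ 0#
    0^n≈0 {suc n} _ = zeroˡ _

    frobenius-+ : ∀ x y → (x + y) ^ p ≈ x ^ p + y ^ p
    -- The exponent is generalised to q, which can be split as a successor to isolate the first and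
    -- last binomial terms, while the divisibility by p is carried along.
    frobenius-+ x y = outer p 1<p (λ k 0<k k<p → prime∣C p-prime k 0<k k<p)
      where
      outer : ∀ q → 1 ℕ.< q → (∀ k → 0 ℕ.< k → k ℕ.< q → p ℕD.∣ q C k) → (x + y) ^ q ≈ x ^ q + y ^ q
      outer (suc q) _ p∣C = begin
        (x + y) ^ suc q                                     ≈⟨ theorem (suc q) x y ⟩
        term zero + sum (λ i → term (suc i))                 ≈⟨ +-cong first (sum-init-last (λ i → term (suc i))) ⟩
        y ^ suc q + (sum (λ i → term (suc (inject₁ i))) + term (suc (fromℕ q)))
          ≈⟨ +-congˡ (+-cong (trans (sum-cong-≋ middle) (sum-replicate-zero q)) last) ⟩
        y ^ suc q + (0# + x ^ suc q)                        ≈⟨ +-congˡ (+-identityˡ _) ⟩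
        y ^ suc q + x ^ suc q                               ≈⟨ +-comm _ _ ⟩
        x ^ suc q + y ^ suc q                               ∎
        where
        term = binomialTerm x y (suc q)
        first : term zero ≈ y ^ suc q
        first = trans (×-homo-1 _) (*-identityˡ _)
        middle : ∀ i → term (suc (inject₁ i)) ≈ 0#
        middle i = ∣⇒×≈0 _ (p∣C (toℕ (suc (inject₁ i))) (s≤s z≤n)
          (s≤s (≡.subst (ℕ._< q) (≡.sym (Finₚ.toℕ-inject₁ i)) (Finₚ.toℕ<n i))))
        last : term (suc (fromℕ q)) ≈ x ^ suc q
        last rewrite Finₚ.toℕ-fromℕ q | nCn≡1 (suc q) | ℕₚ.n∸n≡0 q =
          trans (×-homo-1 _) (*-identityʳ _)

    Fixed : Carrier → Set
    Fixed x = x ^ p ≈ x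

    fixed-cong : ∀ {x y} → x ≈ y → Fixed x → Fixed y
    fixed-cong x≈y fx = trans (^-congˡ p (sym x≈y)) (trans fx x≈y)

    fixed-0 : Fixed 0#
    fixed-0 = 0^n≈0 (ℕₚ.<-trans (s≤s z≤n) 1<p)

    fixed-1 : Fixed 1#
    fixed-1 = 1^n≈1 p

    frobenius-neg : ∀ x → (- x) ^ p ≈ - (x ^ p)
    frobenius-neg x = begin
      (- x) ^ p                       ≈⟨ solve 2 (λ a b → a := (b :+ a) :- b) refl ((- x) ^ p) (x ^ p) ⟩
      (x ^ p + (- x) ^ p) - x ^ p     ≈⟨ +-congʳ (sym (frobenius-+ x (- x))) ⟩
      (x - x) ^ p - x ^ p             ≈⟨ +-congʳ (trans (^-congˡ p (-‿inverseʳ x)) fixed-0) ⟩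
      0# - x ^ p                      ≈⟨ +-identityˡ _ ⟩
      - (x ^ p)                       ∎

    frobenius-sub : ∀ x y → (x - y) ^ p ≈ x ^ p - y ^ p
    frobenius-sub x y = trans (frobenius-+ x (- y)) (+-congˡ (frobenius-neg y))

    fixed-neg : ∀ {x} → Fixed x → Fixed (- x)
    fixed-neg {x} fx = trans (frobenius-neg x) (-‿cong fx)

    fixed-ι-+ : ∀ n → Fixed (ι (+ n))
    fixed-ι-+ zero = fixed-cong (sym ι-0) fixed-0
    fixed-ι-+ (suc n) = fixed-cong (sym (ι-+ (+ 1) (+ n)))
      (trans (frobenius-+ _ _) (+-cong (fixed-cong (sym ι-1) fixed-1) (fixed-ι-+ n)))

    fixed-ι : ∀ a → Fixed (ι a)
    fixed-ι (+ n) = fixed-ι-+ n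
    fixed-ι -[1+ n ] = fixed-cong (sym (ι-neg (+ suc n))) (fixed-neg (fixed-ι-+ (suc n)))

    ^p^-suc : ∀ x e → x ^ (p ℕ.^ suc e) ≈ (x ^ (p ℕ.^ e)) ^ p
    ^p^-suc x e = sym (trans (^-assocʳ x (p ℕ.^ e) p) (^-congʳ x (ℕₚ.*-comm (p ℕ.^ e) p)))

    frobenius-iterate-sub : ∀ e x y → (x - y) ^ (p ℕ.^ e) ≈ x ^ (p ℕ.^ e) - y ^ (p ℕ.^ e)
    frobenius-iterate-sub zero x y = trans (*-identityʳ _) (sym (+-cong (*-identityʳ x) (-‿cong (*-identityʳ y))))
    frobenius-iterate-sub (suc e) x y = begin
      (x - y) ^ (p ℕ.^ suc e)                             ≈⟨ ^p^-suc (x - y) e ⟩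
      ((x - y) ^ (p ℕ.^ e)) ^ p                           ≈⟨ ^-congˡ p (frobenius-iterate-sub e x y) ⟩
      (x ^ (p ℕ.^ e) - y ^ (p ℕ.^ e)) ^ p                 ≈⟨ frobenius-sub _ _ ⟩
      (x ^ (p ℕ.^ e)) ^ p - (y ^ (p ℕ.^ e)) ^ p           ≈⟨ +-cong (^p^-suc x e) (-‿cong (^p^-suc y e)) ⟨
      x ^ (p ℕ.^ suc e) - y ^ (p ℕ.^ suc e)               ∎

    _∣ᴿ_ : Carrier → Carrier → Set
    x ∣ᴿ y = ∃[ q ] y ≈ q * x

    ∣ᴿ-trans : ∀ {x y z} → x ∣ᴿ y → y ∣ᴿ z → x ∣ᴿ z
    ∣ᴿ-trans {x} (q , y≈qx) (r , z≈ry) = r * q , trans z≈ry (trans (*-congˡ y≈qx) (sym (*-assoc r q x)))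

    -- For a polynomial f with coefficients in the prime field, listed from the constant term on,
    -- f(a) divides Π_{1≤j≤deg f} (a^(p^j) - a).  Up to a unit the leading coefficient is the divided
    -- difference of f at the deg f + 1 points a, a^p, a^(p²), …; Frobenius shifts the divided
    -- differences, so (a^(p^j) - a) f[a,…,a^(p^j)] = f[a,…,a^(p^(j-1))]^p - f[a,…,a^(p^(j-1))].
    module Annihilator (a : Carrier) where

      node : ℕ → Carrier
      node i = a ^ (p ℕ.^ i)

      dividedDiff : List Carrier → ℕ → ℕ → Carrier
      dividedDiff []      i j       = 0#
      dividedDiff (c ∷ f) i zero    = c + node i * dividedDiff f i zero
      dividedDiff (c ∷ f) i (suc j) = node i * dividedDiff f i (suc j) + dividedDiff f (suc i) j

      -- The classical quotient formula for divided differences, cleared of its denominator.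
      dividedDiff-recurrence : ∀ f i j → (node (suc j ℕ.+ i) - node i) * dividedDiff f i (suc j) ≈
                                         dividedDiff f (suc i) j - dividedDiff f i j
      dividedDiff-recurrence [] i j = trans (zeroʳ _) (sym (-‿inverseʳ 0#))
      dividedDiff-recurrence (c ∷ f) i zero = begin
        (y - x) * (x * s + t)             ≈⟨ solve 4 (λ y x s t → (y :- x) :* (x :* s :+ t) :=
                                               x :* ((y :- x) :* s) :+ (y :- x) :* t) refl y x s t ⟩
        x * ((y - x) * s) + (y - x) * t   ≈⟨ +-congʳ (*-congˡ (dividedDiff-recurrence f i zero)) ⟩
        x * (t - r) + (y - x) * t         ≈⟨ solve 5 (λ y x t r c → x :* (t :- r) :+ (y :- x) :* t :=
                                               (c :+ y :* t) :- (c :+ x :* r)) refl y x t r c ⟩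
        (c + y * t) - (c + x * r)         ∎
        where
        x = node i
        y = node (suc i)
        s = dividedDiff f i 1
        t = dividedDiff f (suc i) 0
        r = dividedDiff f i 0
      dividedDiff-recurrence (c ∷ f) i (suc j) = begin
        (z - x) * (x * s + t)             ≈⟨ solve 5 (λ z x y s t → (z :- x) :* (x :* s :+ t) :=
                                               x :* ((z :- x) :* s) :+ ((y :- x) :* t :+ (z :- y) :* t)) refl z x y s t ⟩
        x * ((z - x) * s) + ((y - x) * t + (z - y) * t)
          ≈⟨ +-cong (*-congˡ (dividedDiff-recurrence f i (suc j))) (+-congˡ (trans
               (*-congʳ (+-congʳ (^-congʳ a (≡.cong (p ℕ.^_) (≡.sym (ℕₚ.+-suc (suc j) i))))))
               (dividedDiff-recurrence f (suc i) j))) ⟩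
        x * (t - r) + ((y - x) * t + (u - v))
          ≈⟨ solve 6 (λ x y t r u v → x :* (t :- r) :+ ((y :- x) :* t :+ (u :- v)) :=
               (y :* t :+ u) :- (x :* r :+ v)) refl x y t r u v ⟩
        (y * t + u) - (x * r + v)         ∎
        where
        x = node i
        y = node (suc i)
        z = node (suc (suc j) ℕ.+ i)
        s = dividedDiff f i (suc (suc j))
        t = dividedDiff f (suc i) (suc j)
        r = dividedDiff f i (suc j)
        u = dividedDiff f (suc (suc i)) j
        v = dividedDiff f (suc i) j

      dividedDiff-frobenius : ∀ {f} → All Fixed f → ∀ i j → dividedDiff f i j ^ p ≈ dividedDiff f (suc i) j
      dividedDiff-frobenius [] i j = fixed-0
      dividedDiff-frobenius {c ∷ f} (fc ∷ ff) i zero = begin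
        (c + node i * dividedDiff f i 0) ^ p              ≈⟨ frobenius-+ _ _ ⟩
        c ^ p + (node i * dividedDiff f i 0) ^ p          ≈⟨ +-cong fc (^-distrib-* _ _ p) ⟩
        c + node i ^ p * dividedDiff f i 0 ^ p
          ≈⟨ +-congˡ (*-cong (sym (^p^-suc a i)) (dividedDiff-frobenius ff i 0)) ⟩
        c + node (suc i) * dividedDiff f (suc i) 0        ∎
      dividedDiff-frobenius {c ∷ f} (fc ∷ ff) i (suc j) = begin
        (node i * dividedDiff f i (suc j) + dividedDiff f (suc i) j) ^ p          ≈⟨ frobenius-+ _ _ ⟩
        (node i * dividedDiff f i (suc j)) ^ p + dividedDiff f (suc i) j ^ p
          ≈⟨ +-cong (^-distrib-* _ _ p) (dividedDiff-frobenius ff (suc i) j) ⟩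
        node i ^ p * dividedDiff f i (suc j) ^ p + dividedDiff f (suc (suc i)) j
          ≈⟨ +-congʳ (*-cong (sym (^p^-suc a i)) (dividedDiff-frobenius ff i (suc j))) ⟩
        node (suc i) * dividedDiff f (suc i) (suc j) + dividedDiff f (suc (suc i)) j ∎

      dividedDiff-vanish : ∀ f i j → length f ℕ.≤ j → dividedDiff f i j ≈ 0#
      dividedDiff-vanish [] i j le = refl
      dividedDiff-vanish (c ∷ f) i (suc j) (s≤s le) = trans
        (+-cong (trans (*-congˡ (dividedDiff-vanish f i (suc j) (ℕₚ.m≤n⇒m≤1+n le))) (zeroʳ _))
                (dividedDiff-vanish f (suc i) j le)) (+-identityʳ 0#)

      dividedDiff-leading : ∀ f c i → dividedDiff (f ∷ʳ c) i (length f) ≈ c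
      dividedDiff-leading [] c i = trans (+-congˡ (zeroʳ _)) (+-identityʳ c)
      dividedDiff-leading (d ∷ f) c i = trans
        (+-cong (trans (*-congˡ (dividedDiff-vanish (f ∷ʳ c) i (suc (length f))
                  (ℕₚ.≤-reflexive (≡.trans (Listₚ.length-++ f) (ℕₚ.+-comm (length f) 1))))) (zeroʳ _))
                (dividedDiff-leading f c (suc i))) (+-identityˡ c)

      dividedDiff-snoc-0 : ∀ f {c} i j → c ≈ 0# → dividedDiff (f ∷ʳ c) i j ≈ dividedDiff f i j
      dividedDiff-snoc-0 [] i zero c≈0 = trans (+-cong c≈0 (zeroʳ _)) (+-identityʳ 0#)
      dividedDiff-snoc-0 [] i (suc j) c≈0 = trans (+-identityʳ _) (zeroʳ _)
      dividedDiff-snoc-0 (d ∷ f) i zero c≈0 = +-congˡ (*-congˡ (dividedDiff-snoc-0 f i zero c≈0))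
      dividedDiff-snoc-0 (d ∷ f) i (suc j) c≈0 =
        +-cong (*-congˡ (dividedDiff-snoc-0 f i (suc j) c≈0)) (dividedDiff-snoc-0 f (suc i) j c≈0)

      frobProd : ℕ → Carrier
      frobProd zero    = 1#
      frobProd (suc j) = (node (suc j) - a) * frobProd j

      frobProd-mono : ∀ {j k} → j ℕ.≤′ k → frobProd j ∣ᴿ frobProd k
      frobProd-mono ℕ.≤′-refl = 1# , sym (*-identityˡ _)
      frobProd-mono (ℕ.≤′-step le) = ∣ᴿ-trans (frobProd-mono le) (_ , refl)

      -- By the recurrence and Frobenius, a further node difference turns the next divided
      -- difference into δ^p - δ, a multiple of the current one, δ.
      value-∣-dividedDiff : ∀ {f} → All Fixed f → ∀ j →
        dividedDiff f 0 0 ∣ᴿ (frobProd j * dividedDiff f 0 j)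
      value-∣-dividedDiff ff zero = 1# , refl
      value-∣-dividedDiff {f} ff (suc j) with value-∣-dividedDiff ff j
      ... | q , eq = (δ ^ (p ∸ 1) - 1#) * q , (begin
        (node (suc j) - a) * frobProd j * dividedDiff f 0 (suc j)
          ≈⟨ solve 3 (λ n P d → n :* P :* d := P :* (n :* d)) refl (node (suc j) - a) (frobProd j) _ ⟩
        frobProd j * ((node (suc j) - a) * dividedDiff f 0 (suc j))
          ≈⟨ *-congˡ (*-congʳ (+-cong (^-congʳ a (≡.cong (λ k → p ℕ.^ suc k) (≡.sym (ℕₚ.+-identityʳ j))))
               (-‿cong (sym (*-identityʳ a))))) ⟩
        frobProd j * ((node (suc j ℕ.+ 0) - node 0) * dividedDiff f 0 (suc j))
          ≈⟨ *-congˡ (dividedDiff-recurrence f 0 j) ⟩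
        frobProd j * (dividedDiff f 1 j - δ)            ≈⟨ *-congˡ (+-congʳ (dividedDiff-frobenius ff 0 j)) ⟨
        frobProd j * (δ ^ p - δ)                        ≈⟨ *-congˡ (+-congʳ (^-congʳ δ (≡.sym p≡))) ⟩
        frobProd j * (δ * δ ^ (p ∸ 1) - δ)              ≈⟨ *-congˡ (+-congˡ (-‿cong (sym (*-identityˡ δ)))) ⟩
        frobProd j * (δ * δ ^ (p ∸ 1) - 1# * δ)
          ≈⟨ solve 4 (λ P δ e o → P :* (δ :* e :- o :* δ) := (e :- o) :* (P :* δ)) refl (frobProd j) δ _ 1# ⟩
        (δ ^ (p ∸ 1) - 1#) * (frobProd j * δ)           ≈⟨ *-congˡ eq ⟩
        (δ ^ (p ∸ 1) - 1#) * (q * dividedDiff f 0 0)    ≈⟨ *-assoc _ q _ ⟨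
        (δ ^ (p ∸ 1) - 1#) * q * dividedDiff f 0 0      ∎)
        where
        δ = dividedDiff f 0 j
        p≡ : suc (p ∸ 1) ≡ p
        p≡ = ℕₚ.m+[n∸m]≡n (ℕₚ.<⇒≤ 1<p)

      -- If the last coefficient is prime to p, the top divided difference equals this unit and
      -- `value-∣-dividedDiff` applies. Otherwise it acts as 0 and is removed; the `Any` hypothesis
      -- ensures that a unit is met before the list is exhausted.
      value-∣-frobProd : ∀ m ds → length ds ℕ.≤ suc m → Any (λ d → ¬ p ℕD.∣ ∣ d ∣) ds →
        dividedDiff (map ι ds) 0 0 ∣ᴿ frobProd m
      value-∣-frobProd m ds le nz with initLast ds
      value-∣-frobProd m .[] le () | []
      value-∣-frobProd m .(ds ∷ʳ d) le nz | ds ∷ʳ′ d with p ℕD.∣? ∣ d ∣ | Anyₚ.++⁻ ds nz | length≤ ds le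
        where
        length≤ : ∀ ds → length (ds ∷ʳ d) ℕ.≤ suc m → length ds ℕ.≤ m
        length≤ ds le = ℕₚ.≤-pred (≡.subst (ℕ._≤ suc m) (≡.trans (Listₚ.length-++ ds) (ℕₚ.+-comm (length ds) 1)) le)
      ... | no p∤d | _ | le′ with ι-unit d p∤d
                                 | value-∣-dividedDiff {map ι (ds ∷ʳ d)} (all-fixed (ds ∷ʳ d)) (length ds)
        where
        all-fixed : ∀ es → All Fixed (map ι es)
        all-fixed [] = []
        all-fixed (e ∷ es) = fixed-ι e ∷ all-fixed es
      ...   | u , u*d≈1 | q , eq = ∣ᴿ-trans (ι u * q , (begin
        frobProd (length ds)                        ≈⟨ *-identityˡ _ ⟨
        1# * frobProd (length ds)                   ≈⟨ *-congʳ u*d≈1 ⟨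
        ι u * ι d * frobProd (length ds)            ≈⟨ solve 3 (λ u d P → u :* d :* P := u :* (P :* d)) refl (ι u) (ι d) _ ⟩
        ι u * (frobProd (length ds) * ι d)          ≈⟨ *-congˡ (trans (*-congˡ (sym leading)) eq) ⟩
        ι u * (q * dividedDiff (map ι (ds ∷ʳ d)) 0 0) ≈⟨ *-assoc (ι u) q _ ⟨
        ι u * q * dividedDiff (map ι (ds ∷ʳ d)) 0 0 ∎)) (frobProd-mono (ℕₚ.≤⇒≤′ le′))
        where
        leading : dividedDiff (map ι (ds ∷ʳ d)) 0 (length ds) ≈ ι d
        leading = ≡.subst₂ (λ f n → dividedDiff f 0 n ≈ ι d) (≡.sym (Listₚ.map-++ ι ds [ d ]))
          (Listₚ.length-map ι ds) (dividedDiff-leading (map ι ds) (ι d) 0)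
      value-∣-frobProd m .(ds ∷ʳ d) le nz | ds ∷ʳ′ d | yes p∣d | inj₂ (here p∤d) | le′ = contradiction p∣d p∤d
      value-∣-frobProd zero .([] ∷ʳ d) le nz | [] ∷ʳ′ d | yes p∣d | inj₁ () | le′
      value-∣-frobProd (suc m) .(ds ∷ʳ d) le nz | ds ∷ʳ′ d | yes p∣d | inj₁ nz′ | le′
        with value-∣-frobProd m ds le′ nz′
      ... | q , eq = (node (suc m) - a) * q , trans (*-congˡ eq) (trans (sym (*-assoc _ q _)) (*-congˡ (sym value≈)))
        where
        value≈ : dividedDiff (map ι (ds ∷ʳ d)) 0 0 ≈ dividedDiff (map ι ds) 0 0
        value≈ = trans (reflexive (≡.cong (λ f → dividedDiff f 0 0) (Listₚ.map-++ ι ds [ d ])))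
          (dividedDiff-snoc-0 (map ι ds) 0 0 (ι-∣ (∣ᵤ⇒∣ {+ p} p∣d)))

-- Companion matrices and Frobenius-invariant coefficients.

module Companion where

  open Matrices
  open Frobenius
  open import Data.Nat as ℕ using (ℕ; zero; suc; s≤s; z≤n; _∸_)
  import Data.Nat.Properties as ℕₚ
  import Data.Nat.Divisibility as ℕD
  open import Data.Nat.Primality using (Prime)
  open import Data.Integer as ℤ using (ℤ; +_; ∣_∣)
  open import Data.Integer.Divisibility.Signed using (∣ᵤ⇒∣)
  open import Data.Fin using (Fin; zero; suc; toℕ; fromℕ; inject₁)
  import Data.Fin.Properties as Finₚ
  open import Data.List using (List; []; _∷_; length; replicate)
  import Data.List.Properties as Listₚ
  open import Data.Product using (_×_; _,_; proj₁; proj₂; ∃-syntax; Σ-syntax)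
  open import Relation.Nullary using (Dec; yes; no; ¬_; contradiction)
  open import Relation.Binary.PropositionalEquality as ≡ using (_≡_)

  -- Acts on (x^(m-1) z , … , x z , z) as multiplication by x whenever
  -- x^m z + Σ_j a_j x^(m-1-j) z = 0.
  companion : ∀ {m} → (Fin (suc m) → ℤ) → Mat (suc m)
  companion a zero    j = ℤ.- a j
  companion a (suc i) j = idMat (inject₁ i) j

  module CompanionOrder {p : ℕ} (p-prime : Prime p) (𝔽 : 𝔽-Algebra p) where
    open Theory p-prime 𝔽
    open import Relation.Binary.Reasoning.Setoid setoid
    open import Algebra.Properties.Ring ring using (-‿distribˡ-*; -0#≈0#)
    open import Algebra.Properties.Semiring.Sum semiring using (sum; sum-cong-≋; *-distribˡ-sum; *-distribʳ-sum)
    open import Algebra.Properties.CommutativeMonoid.Sum +-commutativeMonoid using (∑-comm)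

    x-y≈0⇒x≈y : ∀ {x y} → x - y ≈ 0# → x ≈ y
    x-y≈0⇒x≈y {x} {y} h = begin
      x           ≈⟨ solve 2 (λ x y → x := (x :- y) :+ y) refl x y ⟩
      (x - y) + y ≈⟨ +-congʳ h ⟩
      0# + y      ≈⟨ +-identityˡ y ⟩
      y           ∎

    x≈y⇒x-y≈0 : ∀ {x y} → x ≈ y → x - y ≈ 0#
    x≈y⇒x-y≈0 {x} {y} h = trans (+-congʳ h) (-‿inverseʳ y)

    monicEval : List Carrier → Carrier → Carrier
    monicEval []      t = 1#
    monicEval (c ∷ f) t = c + t * monicEval f t

    -- Synthetic division of `c ∷ f` by T - r: the coefficients are the values at r of the
    -- successive tails, the empty tail giving the implicit leading 1.
    quotient : Carrier → List Carrier → Carrier → List Carrier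
    quotient c []      r = []
    quotient c (d ∷ f) r = monicEval (d ∷ f) r ∷ quotient d f r

    length-quotient : ∀ c f r → length (quotient c f r) ≡ length f
    length-quotient c [] r = ≡.refl
    length-quotient c (d ∷ f) r = ≡.cong suc (length-quotient d f r)

    monicEval-quotient : ∀ c f r t → monicEval (c ∷ f) t ≈ monicEval (c ∷ f) r + (t - r) * monicEval (quotient c f r) t
    monicEval-quotient c [] r t = solve 4 (λ c r t o → c :+ t :* o := (c :+ r :* o) :+ (t :- r) :* o) refl c r t 1#
    monicEval-quotient c (d ∷ f) r t = begin
      c + t * ft                            ≈⟨ +-congˡ (*-congˡ (monicEval-quotient d f r t)) ⟩
      c + t * (fr + (t - r) * q)            ≈⟨ solve 5 (λ c t fr r q → c :+ t :* (fr :+ (t :- r) :* q) :=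
                                                 (c :+ r :* fr) :+ (t :- r) :* (fr :+ t :* q)) refl c t fr r q ⟩
      (c + r * fr) + (t - r) * (fr + t * q) ∎
      where
      ft = monicEval (d ∷ f) t
      fr = monicEval (d ∷ f) r
      q = monicEval (quotient d f r) t

    rootProd : ℕ → ℕ → Carrier → Carrier
    rootProd a zero    t = 1#
    rootProd a (suc n) t = (t - ι (+ a)) * rootProd (suc a) n t

    -- With zero divisors around, a further root passes to the quotient only if its difference from
    -- the root split off is a unit. Among at most p consecutive integers all these differences are
    -- prime to p.
    factor-roots : ∀ f a n → length f ≡ n → n ℕ.≤ p → (∀ i → i ℕ.< n → monicEval f (ι (+ (i ℕ.+ a))) ≈ 0#) →
      ∀ t → monicEval f t ≈ rootProd a n t
    factor-roots [] a zero len n≤p h t = refl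
    factor-roots (c ∷ f) a (suc n) len n≤p h t = begin
      monicEval (c ∷ f) t                             ≈⟨ monicEval-quotient c f (ι (+ a)) t ⟩
      monicEval (c ∷ f) (ι (+ a)) + (t - ι (+ a)) * monicEval (quotient c f (ι (+ a))) t
        ≈⟨ +-cong (h 0 (s≤s z≤n)) (*-congˡ (factor-roots (quotient c f (ι (+ a))) (suc a) n
             (≡.trans (length-quotient c f _) (ℕₚ.suc-injective len)) (ℕₚ.<⇒≤ n≤p) quotient-roots t)) ⟩
      0# + (t - ι (+ a)) * rootProd (suc a) n t       ≈⟨ +-identityˡ _ ⟩
      (t - ι (+ a)) * rootProd (suc a) n t            ∎
      where
      quotient-roots : ∀ i → i ℕ.< n → monicEval (quotient c f (ι (+ a))) (ι (+ (i ℕ.+ suc a))) ≈ 0#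
      quotient-roots i i<n with ι-unit (+ suc i) (λ p∣1+i → ℕₚ.<⇒≱ (ℕₚ.≤-trans (s≤s i<n) n≤p) (ℕD.∣⇒≤ p∣1+i))
      ... | u , u*d≈1 = begin
        q                               ≈⟨ *-identityˡ q ⟨
        1# * q                          ≈⟨ *-congʳ u*d≈1 ⟨
        ι u * ι (+ suc i) * q           ≈⟨ *-assoc _ _ q ⟩
        ι u * (ι (+ suc i) * q)         ≈⟨ *-congˡ (*-congʳ difference) ⟨
        ι u * ((ι s - ι (+ a)) * q)     ≈⟨ *-congˡ (+-identityˡ _) ⟨
        ι u * (0# + (ι s - ι (+ a)) * q) ≈⟨ *-congˡ (+-congʳ (h 0 (s≤s z≤n))) ⟨
        ι u * (monicEval (c ∷ f) (ι (+ a)) + (ι s - ι (+ a)) * q) ≈⟨ *-congˡ (monicEval-quotient c f (ι (+ a)) (ι s)) ⟨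
        ι u * monicEval (c ∷ f) (ι s)   ≈⟨ *-congˡ (trans (reflexive (≡.cong (λ k → monicEval (c ∷ f) (ι (+ k))) (ℕₚ.+-suc i a))) (h (suc i) (s≤s i<n))) ⟩
        ι u * 0#                        ≈⟨ zeroʳ _ ⟩
        0#                              ∎
        where
        s = + (i ℕ.+ suc a)
        q = monicEval (quotient c f (ι (+ a))) (ι s)
        difference : ι s - ι (+ a) ≈ ι (+ suc i)
        difference = begin
          ι s - ι (+ a)                         ≡⟨ ≡.cong (λ k → ι (+ k) - ι (+ a)) (ℕₚ.+-suc i a) ⟩
          ι (+ suc i ℤ.+ + a) - ι (+ a)         ≈⟨ +-congʳ (ι-+ (+ suc i) (+ a)) ⟩
          (ι (+ suc i) + ι (+ a)) - ι (+ a)     ≈⟨ solve 2 (λ x y → (x :+ y) :- y := x) refl (ι (+ suc i)) (ι (+ a)) ⟩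
          ι (+ suc i)                           ∎

    -- T^p - T is monic with the roots 0, ..., p - 1, so it is the product of the T - i, even in the
    -- presence of zero divisors; c is one of its zeros.
    fixed⇒rootProd≈0 : ∀ {c} → Fixed c → rootProd 0 p c ≈ 0#
    fixed⇒rootProd≈0 {c} fc = shape p ≡.refl 1<p
      where
      shape : ∀ q → p ≡ q → 1 ℕ.< q → rootProd 0 p c ≈ 0#
      shape (suc zero) _ (s≤s ())
      shape (suc (suc q)) p≡ _ = trans (sym (factor-roots T^p-T 0 p
        (≡.trans (≡.cong (λ l → suc (suc l)) (Listₚ.length-replicate q)) (≡.sym p≡)) ℕₚ.≤-refl
        (λ i _ → fixed-root (fixed-ι _)) c)) (fixed-root fc)
        where
        T^p-T = 0# ∷ - 1# ∷ replicate q 0#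
        power : ∀ n t → monicEval (replicate n 0#) t ≈ t ^ n
        power zero t = refl
        power (suc n) t = trans (+-identityˡ _) (*-congˡ (power n t))
        fixed-root : ∀ {t} → Fixed t → monicEval T^p-T t ≈ 0#
        fixed-root {t} ft = begin
          0# + t * (- 1# + t * monicEval (replicate q 0#) t)  ≈⟨ +-identityˡ _ ⟩
          t * (- 1# + t * monicEval (replicate q 0#) t)       ≈⟨ *-congˡ (+-congˡ (*-congˡ (power q t))) ⟩
          t * (- 1# + t * t ^ q)   ≈⟨ solve 3 (λ t o e → t :* (:- o :+ e) := t :* e :- o :* t) refl t 1# (t * t ^ q) ⟩
          t * (t * t ^ q) - 1# * t ≈⟨ x≈y⇒x-y≈0 (trans (^-congʳ t (≡.sym p≡)) (trans ft (sym (*-identityˡ t)))) ⟩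
          0#                       ∎

    module _ (_≈?_ : ∀ x y → Dec (x ≈ y)) where

      -- Multiply z by c, c - 1, c - 2, ... in turn. The product over all p factors is 0 although z
      -- is not, so some factor c - a produces the first 0; the multiple of z just before it is an
      -- eigenvector for a.
      eigenvalue : ∀ {c z} → Fixed c → ¬ z ≈ 0# →
        Σ[ a ∈ ℤ ] ∃[ w ] ¬ z * w ≈ 0# × c * (z * w) ≈ ι a * (z * w)
      eigenvalue {c} {z} fc z≉0 = search 0 p z z≉0 (trans (*-congˡ (fixed⇒rootProd≈0 fc)) (zeroʳ z))
        where
        search : ∀ a n z → ¬ z ≈ 0# → z * rootProd a n c ≈ 0# →
          Σ[ a ∈ ℤ ] ∃[ w ] ¬ z * w ≈ 0# × c * (z * w) ≈ ι a * (z * w)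
        search a zero z z≉0 h = contradiction (trans (sym (*-identityʳ z)) h) z≉0
        search a (suc n) z z≉0 h with (z * (c - ι (+ a))) ≈? 0#
        ... | yes eq = + a , 1# , (λ e → z≉0 (trans (sym (*-identityʳ z)) e)) , x-y≈0⇒x≈y (begin
          c * (z * 1#) - ι (+ a) * (z * 1#)   ≈⟨ solve 4 (λ c z a o → c :* (z :* o) :- a :* (z :* o) :=
                                                   z :* (c :- a) :* o) refl c z (ι (+ a)) 1# ⟩
          z * (c - ι (+ a)) * 1#              ≈⟨ *-congʳ eq ⟩
          0# * 1#                             ≈⟨ zeroˡ 1# ⟩
          0#                                  ∎)
        ... | no neq with search (suc a) n (z * (c - ι (+ a))) neq (trans (*-assoc z _ _) h)
        ...   | b , w , zw≉0 , eq = b , (c - ι (+ a)) * w , (λ e → zw≉0 (trans (*-assoc z _ w) e)) ,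
                trans (*-congˡ (sym (*-assoc z _ w))) (trans eq (*-congˡ (*-assoc z _ w)))

      -- The ring is commutative, so a multiple of an eigenvector stays one for the same integer;
      -- the coefficients can be treated one after another.
      eigenvalues : ∀ n (b : Fin n → Carrier) z → (∀ i → Fixed (b i)) → ¬ z ≈ 0# →
        Σ[ a ∈ (Fin n → ℤ) ] ∃[ w ] ¬ z * w ≈ 0# × (∀ i → b i * (z * w) ≈ ι (a i) * (z * w))
      eigenvalues zero b z fb z≉0 = (λ ()) , 1# , (λ e → z≉0 (trans (sym (*-identityʳ z)) e)) , λ ()
      eigenvalues (suc n) b z fb z≉0 with eigenvalue {b zero} {z} (fb zero) z≉0
      ... | a₀ , w₀ , zw₀≉0 , eq₀ with eigenvalues n (λ i → b (suc i)) (z * w₀) (λ i → fb (suc i)) zw₀≉0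
      ...   | a , w , zw≉0 , eq = (λ { zero → a₀ ; (suc i) → a i }) , w₀ * w ,
              (λ e → zw≉0 (trans (*-assoc z w₀ w) e)) , λ
              { zero → begin
                  b zero * (z * (w₀ * w))   ≈⟨ solve 4 (λ b z u w → b :* (z :* (u :* w)) := b :* (z :* u) :* w) refl (b zero) z w₀ w ⟩
                  b zero * (z * w₀) * w     ≈⟨ *-congʳ eq₀ ⟩
                  ι a₀ * (z * w₀) * w       ≈⟨ solve 4 (λ b z u w → b :* (z :* u) :* w := b :* (z :* (u :* w))) refl (ι a₀) z w₀ w ⟩
                  ι a₀ * (z * (w₀ * w))     ∎
              ; (suc i) → trans (*-congˡ (sym (*-assoc z w₀ w))) (trans (eq i) (*-congˡ (*-assoc z w₀ w))) }

    -- Coefficients are listed from the leading one, so the product with T - r is b_j - r b_(j-1).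
    mulLinear : Carrier → (ℕ → Carrier) → ℕ → Carrier
    mulLinear r b zero    = b zero
    mulLinear r b (suc j) = b (suc j) - r * b j

    mulLinear-cong : ∀ {r s b c} → r ≈ s → (∀ j → b j ≈ c j) → ∀ j → mulLinear r b j ≈ mulLinear s c j
    mulLinear-cong r≈s h zero    = h zero
    mulLinear-cong r≈s h (suc j) = +-cong (h (suc j)) (-‿cong (*-cong r≈s (h j)))

    mulLinear-comm : ∀ r s b j → mulLinear r (mulLinear s b) j ≈ mulLinear s (mulLinear r b) j
    mulLinear-comm r s b zero = refl
    mulLinear-comm r s b (suc zero) =
      solve 4 (λ r s x y → (y :- s :* x) :- r :* x := (y :- r :* x) :- s :* x) refl r s (b 0) (b 1)
    mulLinear-comm r s b (suc (suc j)) =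
      solve 5 (λ r s x y z → (z :- s :* y) :- r :* (y :- s :* x) := (z :- r :* y) :- s :* (y :- r :* x))
        refl r s (b j) (b (suc j)) (b (suc (suc j)))

    mulLinear-frobenius : ∀ r {b c} → (∀ j → b j ^ p ≈ c j) → ∀ j → mulLinear r b j ^ p ≈ mulLinear (r ^ p) c j
    mulLinear-frobenius r h zero = h zero
    mulLinear-frobenius r {b} h (suc j) = trans (frobenius-sub (b (suc j)) (r * b j))
      (+-cong (h (suc j)) (-‿cong (trans (^-distrib-* r (b j) p) (*-congˡ (h j)))))

    Regular : Carrier → Set
    Regular c = ∀ z → c * z ≈ 0# → z ≈ 0#

    regular-1 : Regular 1#
    regular-1 z h = trans (sym (*-identityˡ z)) h

    regular-* : ∀ {c d} → Regular c → Regular d → Regular (c * d)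
    regular-* {c} {d} rc rd z h = rd z (rc (d * z) (trans (sym (*-assoc c d z)) h))

    regular-^ : ∀ {c} n → Regular c → Regular (c ^ n)
    regular-^ zero rc = regular-1
    regular-^ (suc n) rc = regular-* rc (regular-^ n rc)

    -- With the leading coefficient listed first, `b n` is the constant term. Its regularity is what
    -- later keeps the last integer coefficient prime to p, and so the companion matrix invertible.
    record HasDegree (n : ℕ) (b : ℕ → Carrier) : Set where
      constructor degree
      field
        leading  : b 0 ≈ 1#
        constant : Regular (b n)
        beyond   : ∀ j → n ℕ.< j → b j ≈ 0#
    open HasDegree

    mulLinear-degree : ∀ {n r b} → Regular r → HasDegree n b → HasDegree (suc n) (mulLinear r b)
    mulLinear-degree {n} {r} {b} rr d = degree (leading d)
      (λ z h → constant d z (rr (b n * z) (begin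
        r * (b n * z)                           ≈⟨ solve 4 (λ r c d z → r :* (c :* z) := d :* z :- (d :- r :* c) :* z) refl r (b n) (b (suc n)) z ⟩
        b (suc n) * z - (b (suc n) - r * b n) * z ≈⟨ +-cong (trans (*-congʳ (beyond d (suc n) ℕₚ.≤-refl)) (zeroˡ z)) (-‿cong h) ⟩
        0# - 0#                                 ≈⟨ -‿inverseʳ 0# ⟩
        0#                                      ∎)))
      λ { (suc j) (s≤s n<j) → trans (+-cong (beyond d (suc j) (ℕₚ.m≤n⇒m≤1+n n<j))
            (-‿cong (trans (*-congˡ (beyond d j n<j)) (zeroʳ r)))) (-‿inverseʳ 0#) }

    module _ (x : Carrier) where

      horner : (ℕ → Carrier) → ℕ → Carrier
      horner b zero    = b 0
      horner b (suc n) = x * horner b n + b (suc n)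

      horner-mulLinear : ∀ r b n → horner (mulLinear r b) (suc n) ≈ horner b (suc n) - r * horner b n
      horner-mulLinear r b zero =
        solve 4 (λ x r b c → x :* b :+ (c :- r :* b) := (x :* b :+ c) :- r :* b) refl x r (b 0) (b 1)
      horner-mulLinear r b (suc n) = trans (+-congʳ (*-congˡ (horner-mulLinear r b n)))
        (solve 6 (λ x r h k c d → x :* (h :- r :* k) :+ (d :- r :* c) := (x :* h :+ d) :- r :* (x :* k :+ c)) refl
          x r (horner b (suc n)) (horner b n) (b (suc n)) (b (suc (suc n))))

      -- The value of (T - x) b at x telescopes to the coefficient of b beyond its degree.
      horner-root : ∀ {n b} → HasDegree n b → horner (mulLinear x b) (suc n) ≈ 0#
      horner-root {n} {b} d = trans (horner-mulLinear x b n) (trans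
        (solve 2 (λ h c → (h :+ c) :- h := c) refl (x * horner b n) (b (suc n))) (beyond d (suc n) ℕₚ.≤-refl))

      horner-sum : ∀ b n → horner b (suc n) ≈ b 0 * x ^ suc n + sum {suc n} (λ j → b (suc (toℕ j)) * x ^ (n ∸ toℕ j))
      horner-sum b zero = begin
        x * b 0 + b 1                   ≈⟨ +-cong (trans (*-comm x (b 0)) (*-congˡ (sym (*-identityʳ x)))) (sym (trans (+-identityʳ _) (*-identityʳ (b 1)))) ⟩
        b 0 * x ^ 1 + (b 1 * 1# + 0#)   ∎
      horner-sum b (suc n) = trans (shift b n) (+-congˡ (horner-sum (λ j → b (suc j)) n))
        where
        shift : ∀ b n → horner b (suc (suc n)) ≈ b 0 * x ^ suc (suc n) + horner (λ j → b (suc j)) (suc n)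
        shift b zero = trans (solve 4 (λ x b c d → x :* (x :* b :+ c) :+ d := b :* (x :* x) :+ (x :* c :+ d)) refl x (b 0) (b 1) (b 2))
          (+-congʳ (*-congˡ (*-congˡ (sym (*-identityʳ x)))))
        shift b (suc n) = trans (+-congʳ (*-congˡ (shift b n)))
          (solve 5 (λ x b e h d → x :* (b :* e :+ h) :+ d := b :* (x :* e) :+ (x :* h :+ d)) refl
            x (b 0) (x ^ suc (suc n)) _ (b (suc (suc (suc n)))))

      node : ℕ → Carrier
      node i = x ^ (p ℕ.^ i)

      -- (T - 1)^l
      unipotent : ℕ → ℕ → Carrier
      unipotent zero    zero    = 1#
      unipotent zero    (suc j) = 0#
      unipotent (suc l)         = mulLinear 1# (unipotent l)

      unipotent-degree : ∀ l → HasDegree l (unipotent l)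
      unipotent-degree zero    = degree refl regular-1 λ { (suc j) _ → refl }
      unipotent-degree (suc l) = mulLinear-degree regular-1 (unipotent-degree l)

      unipotent-fixed : ∀ l j → Fixed (unipotent l j)
      unipotent-fixed zero    zero    = fixed-1
      unipotent-fixed zero    (suc j) = fixed-0
      unipotent-fixed (suc l) j = trans (mulLinear-frobenius 1# (unipotent-fixed l) j)
        (mulLinear-cong fixed-1 (λ _ → refl) j)

      -- (T - 1)^l Π_{i≤h<i+k} (T - x^(p^h))
      conjugateProd : ℕ → ℕ → ℕ → ℕ → Carrier
      conjugateProd l i zero    = unipotent l
      conjugateProd l i (suc k) = mulLinear (node i) (conjugateProd l (suc i) k)

      conjugateProd-degree : Regular x → ∀ l i k → HasDegree (k ℕ.+ l) (conjugateProd l i k)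
      conjugateProd-degree rx l i zero = unipotent-degree l
      conjugateProd-degree rx l i (suc k) =
        mulLinear-degree (regular-^ (p ℕ.^ i) rx) (conjugateProd-degree rx l (suc i) k)

      -- Linear factors commute, so the last conjugate can be placed outermost as well as the first
      -- one.
      conjugateProd-snoc : ∀ l i k j → conjugateProd l i (suc k) j ≈ mulLinear (node (k ℕ.+ i)) (conjugateProd l i k) j
      conjugateProd-snoc l i zero j = refl
      conjugateProd-snoc l i (suc k) j = begin
        mulLinear (node i) (conjugateProd l (suc i) (suc k)) j
          ≈⟨ mulLinear-cong refl (conjugateProd-snoc l (suc i) k) j ⟩
        mulLinear (node i) (mulLinear (node (k ℕ.+ suc i)) (conjugateProd l (suc i) k)) j
          ≈⟨ mulLinear-comm (node i) _ _ j ⟩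
        mulLinear (node (k ℕ.+ suc i)) (conjugateProd l i (suc k)) j
          ≡⟨ ≡.cong (λ h → mulLinear (node h) (conjugateProd l i (suc k)) j) (ℕₚ.+-suc k i) ⟩
        mulLinear (node (suc k ℕ.+ i)) (conjugateProd l i (suc k)) j ∎

      conjugateProd-frobenius : ∀ l i k j → conjugateProd l i k j ^ p ≈ conjugateProd l (suc i) k j
      conjugateProd-frobenius l i zero j = unipotent-fixed l j
      conjugateProd-frobenius l i (suc k) j = trans (mulLinear-frobenius (node i) (conjugateProd-frobenius l (suc i) k) j)
        (mulLinear-cong (sym (^p^-suc x i)) (λ _ → refl) j)

      -- Frobenius moves the conjugates numbered 0, ..., k to 1, ..., k + 1, and the last of these
      -- is x again, so only the order of the factors has changed.
      conjugateProd-fixed : ∀ l k → x ^ (p ℕ.^ suc k) ≈ x → ∀ j → Fixed (conjugateProd l 0 (suc k) j)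
      conjugateProd-fixed l k x^q≈x j = begin
        conjugateProd l 0 (suc k) j ^ p                           ≈⟨ conjugateProd-frobenius l 0 (suc k) j ⟩
        conjugateProd l 1 (suc k) j                               ≈⟨ conjugateProd-snoc l 1 k j ⟩
        mulLinear (node (k ℕ.+ 1)) (conjugateProd l 1 k) j        ≡⟨ ≡.cong (λ h → mulLinear (node h) (conjugateProd l 1 k) j) (ℕₚ.+-comm k 1) ⟩
        mulLinear (node (suc k)) (conjugateProd l 1 k) j          ≈⟨ mulLinear-cong (trans x^q≈x (sym (*-identityʳ x))) (λ _ → refl) j ⟩
        conjugateProd l 0 (suc k) j                               ∎

    act : ∀ {m} → Mat m → (Fin m → Carrier) → Fin m → Carrier
    act A u i = sum (λ j → ι (A i j) * u j)

    ι-sum : ∀ {m} (f : Fin m → ℤ) → ι (sumFin f) ≈ sum (λ i → ι (f i))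
    ι-sum {zero}  f = ι-0
    ι-sum {suc m} f = trans (ι-+ (f zero) _) (+-congˡ (ι-sum (λ i → f (suc i))))

    act-⊗ : ∀ {m} (A B : Mat m) u i → act (A ⊗ B) u i ≈ act A (act B u) i
    act-⊗ A B u i = begin
      sum (λ j → ι (sumFin (λ l → A i l ℤ.* B l j)) * u j)
        ≈⟨ sum-cong-≋ (λ j → trans (*-congʳ (ι-sum (λ l → A i l ℤ.* B l j))) (*-distribʳ-sum (u j) (λ l → ι (A i l ℤ.* B l j)))) ⟩
      sum (λ j → sum (λ l → ι (A i l ℤ.* B l j) * u j))   ≈⟨ ∑-comm (λ j l → ι (A i l ℤ.* B l j) * u j) ⟩
      sum (λ l → sum (λ j → ι (A i l ℤ.* B l j) * u j))
        ≈⟨ sum-cong-≋ (λ l → sym (trans (*-distribˡ-sum (ι (A i l)) (λ j → ι (B l j) * u j))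
             (sum-cong-≋ (λ j → trans (sym (*-assoc _ _ (u j))) (*-congʳ (sym (ι-* (A i l) (B l j)))))))) ⟩
      sum (λ l → ι (A i l) * sum (λ j → ι (B l j) * u j)) ∎

    act-mod : ∀ {m} {A B : Mat m} → MatEq p A B → ∀ u i → act A u i ≈ act B u i
    act-mod {A = A} {B} h u i = sum-cong-≋ (λ j → *-congʳ (ι-mod {A i j} {B i j} (h i j)))

    act-id : ∀ {m} (u : Fin m → Carrier) i → act idMat u i ≈ u i
    act-id {suc m} u zero = trans (+-cong (trans (*-congʳ ι-1) (*-identityˡ (u zero)))
      (zero-sum m (λ j → u (suc j)))) (+-identityʳ (u zero))
      where
      zero-sum : ∀ m (u : Fin m → Carrier) → sum (λ j → ι (+ 0) * u j) ≈ 0#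
      zero-sum zero u = refl
      zero-sum (suc m) u = trans (+-cong (trans (*-congʳ ι-0) (zeroˡ _)) (zero-sum m (λ j → u (suc j)))) (+-identityʳ 0#)
    act-id {suc m} u (suc i) = trans (+-cong (trans (*-congʳ ι-0) (zeroˡ (u zero))) (act-id (λ j → u (suc j)) i))
      (+-identityˡ (u (suc i)))

    act-power : ∀ {m} (A : Mat m) u x → (∀ i → act A u i ≈ x * u i) → ∀ e i → act (matPow A e) u i ≈ x ^ e * u i
    act-power A u x h zero i = trans (act-id u i) (sym (*-identityˡ (u i)))
    act-power A u x h (suc e) i = begin
      act (A ⊗ matPow A e) u i            ≈⟨ act-⊗ A (matPow A e) u i ⟩
      act A (act (matPow A e) u) i        ≈⟨ sum-cong-≋ (λ j → *-congˡ (act-power A u x h e j)) ⟩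
      sum (λ j → ι (A i j) * (x ^ e * u j))
        ≈⟨ sum-cong-≋ (λ j → solve 3 (λ a e u → a :* (e :* u) := e :* (a :* u)) refl (ι (A i j)) (x ^ e) (u j)) ⟩
      sum (λ j → x ^ e * (ι (A i j) * u j)) ≈⟨ *-distribˡ-sum (x ^ e) (λ j → ι (A i j) * u j) ⟨
      x ^ e * act A u i                   ≈⟨ *-congˡ (h i) ⟩
      x ^ e * (x * u i)                   ≈⟨ solve 3 (λ e x u → e :* (x :* u) := x :* e :* u) refl (x ^ e) x (u i) ⟩
      x * x ^ e * u i                     ∎

    companion-act : ∀ {m} x z (a : Fin (suc m) → ℤ) →
      x ^ suc m * z + sum (λ j → ι (a j) * (x ^ (m ∸ toℕ j) * z)) ≈ 0# →
      ∀ i → act (companion a) (λ j → x ^ (m ∸ toℕ j) * z) i ≈ x * (x ^ (m ∸ toℕ i) * z)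
    companion-act {m} x z a h zero = begin
      sum (λ j → ι (ℤ.- a j) * u j)   ≈⟨ sum-cong-≋ (λ j → trans (*-congʳ (ι-neg (a j))) (sym (-‿distribˡ-* _ (u j)))) ⟩
      sum (λ j → - (ι (a j) * u j))   ≈⟨ sum-neg (λ j → ι (a j) * u j) ⟩
      - s                             ≈⟨ solve 2 (λ e s → :- s := e :- (e :+ s)) refl (x ^ suc m * z) s ⟩
      x ^ suc m * z - (x ^ suc m * z + s) ≈⟨ +-congˡ (-‿cong h) ⟩
      x ^ suc m * z - 0#              ≈⟨ trans (+-congˡ -0#≈0#) (+-identityʳ _) ⟩
      x ^ suc m * z                   ≈⟨ *-assoc x (x ^ m) z ⟩
      x * (x ^ m * z)                 ∎
      where
      u = λ (j : Fin (suc m)) → x ^ (m ∸ toℕ j) * z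
      s = sum (λ j → ι (a j) * u j)
      sum-neg : ∀ {n} (f : Fin n → Carrier) → sum (λ j → - f j) ≈ - sum f
      sum-neg {zero} f = sym -0#≈0#
      sum-neg {suc n} f = trans (+-congˡ (sum-neg (λ j → f (suc j))))
        (solve 2 (λ a b → :- a :+ :- b := :- (a :+ b)) refl (f zero) _)
    companion-act {suc m} x z a h (suc i) = begin
      act idMat (λ j → x ^ (suc m ∸ toℕ j) * z) (inject₁ i)   ≈⟨ act-id (λ j → x ^ (suc m ∸ toℕ j) * z) (inject₁ i) ⟩
      x ^ (suc m ∸ toℕ (inject₁ i)) * z   ≈⟨ *-congʳ (^-congʳ x (≡.trans (≡.cong (suc m ∸_) (Finₚ.toℕ-inject₁ i))
                                                (ℕₚ.+-∸-assoc 1 (Finₚ.toℕ≤pred[n] i)))) ⟩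
      x * x ^ (m ∸ toℕ i) * z             ≈⟨ *-assoc x _ z ⟩
      x * (x ^ (m ∸ toℕ i) * z)           ∎

    module _ (_≈?_ : ∀ x y → Dec (x ≈ y)) where

      -- The coefficients of (T - 1)^l Π_{i≤k} (T - x^(p^i)) are fixed by Frobenius.  On a suitable
      -- nonzero multiple z of x^e - 1 they act as integers a_j, and C^e ≡ 1 for the companion matrix C
      -- of these integers would give (x^e - 1) z = 0, which is impossible as (x^e - 1)^q = x^e - 1.
      companion-power≢1 : ∀ x k l e → Regular x → x ^ (p ℕ.^ suc k) ≈ x → ¬ x ^ e ≈ 1# →
        Σ[ a ∈ (Fin (suc (k ℕ.+ l)) → ℤ) ] ¬ p ℕD.∣ ∣ a (fromℕ (k ℕ.+ l)) ∣ ×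
          (∀ a′ → (∀ i → a′ i ≡[mod p ] a i) → ¬ MatEq p (matPow (companion a′) e) idMat)
      companion-power≢1 x k l e rx x^q≈x x^e≉1 = a , p∤last , power≢1
        where
        m = k ℕ.+ l
        q = p ℕ.^ suc k
        y = x ^ e - 1#
        b = conjugateProd x l 0 (suc k)
        spectrum : Σ[ a ∈ (Fin (suc m) → ℤ) ] ∃[ w ] ¬ y * w ≈ 0# ×
                     (∀ i → b (suc (toℕ i)) * (y * w) ≈ ι (a i) * (y * w))
        spectrum = eigenvalues _≈?_ (suc m) (λ j → b (suc (toℕ j))) y
          (λ j → conjugateProd-fixed x l k x^q≈x (suc (toℕ j))) (λ h → x^e≉1 (x-y≈0⇒x≈y h))
        a = proj₁ spectrum
        w = proj₁ (proj₂ spectrum)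
        z = y * w
        z≉0 = proj₁ (proj₂ (proj₂ spectrum))
        eigen : ∀ i → b (suc (toℕ i)) * z ≈ ι (a i) * z
        eigen = proj₂ (proj₂ (proj₂ spectrum))
        deg : HasDegree (suc m) b
        deg = conjugateProd-degree x rx l 0 (suc k)

        p∤last : ¬ p ℕD.∣ ∣ a (fromℕ m) ∣
        p∤last p∣a = z≉0 (constant deg z (trans
          (trans (*-congʳ (reflexive (≡.cong (λ j → b (suc j)) (≡.sym (Finₚ.toℕ-fromℕ m))))) (eigen (fromℕ m)))
          (trans (*-congʳ (ι-∣ (∣ᵤ⇒∣ {+ p} p∣a))) (zeroˡ z))))

        -- Only residues modulo p matter for the action. The freedom in a′ allows the last
        -- coefficient to be chosen prime to n, so that the matrix is invertible modulo n and not
        -- only modulo p.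
        relation : ∀ a′ → (∀ i → a′ i ≡[mod p ] a i) →
          x ^ suc m * z + sum (λ j → ι (a′ j) * (x ^ (m ∸ toℕ j) * z)) ≈ 0#
        relation a′ a′≡a = begin
          x ^ suc m * z + sum (λ j → ι (a′ j) * (x ^ (m ∸ toℕ j) * z))
            ≈⟨ +-cong (*-congʳ (sym (trans (*-congʳ (leading deg)) (*-identityˡ _)))) (sum-cong-≋ λ j → begin
                 ι (a′ j) * (x ^ (m ∸ toℕ j) * z)   ≈⟨ *-congʳ (ι-mod {a′ j} {a j} (a′≡a j)) ⟩
                 ι (a j) * (x ^ (m ∸ toℕ j) * z)    ≈⟨ solve 3 (λ a u z → a :* (u :* z) := a :* z :* u) refl (ι (a j)) _ z ⟩
                 ι (a j) * z * x ^ (m ∸ toℕ j)      ≈⟨ *-congʳ (eigen j) ⟨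
                 b (suc (toℕ j)) * z * x ^ (m ∸ toℕ j)
                   ≈⟨ solve 3 (λ a u z → a :* z :* u := a :* u :* z) refl (b (suc (toℕ j))) _ z ⟩
                 b (suc (toℕ j)) * x ^ (m ∸ toℕ j) * z ∎) ⟩
          b 0 * x ^ suc m * z + sum {suc m} (λ j → b (suc (toℕ j)) * x ^ (m ∸ toℕ j) * z)
            ≈⟨ +-congˡ (*-distribʳ-sum z (λ (j : Fin (suc m)) → b (suc (toℕ j)) * x ^ (m ∸ toℕ j))) ⟨
          b 0 * x ^ suc m * z + sum {suc m} (λ j → b (suc (toℕ j)) * x ^ (m ∸ toℕ j)) * z  ≈⟨ distribʳ z _ _ ⟨
          (b 0 * x ^ suc m + sum {suc m} (λ j → b (suc (toℕ j)) * x ^ (m ∸ toℕ j))) * z   ≈⟨ *-congʳ (horner-sum x b m) ⟨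
          horner x b (suc m) * z          ≈⟨ *-congʳ root ⟩
          0# * z                          ≈⟨ zeroˡ z ⟩
          0#                              ∎
          where
          hornerCong : ∀ {b c} → (∀ j → b j ≈ c j) → ∀ n → horner x b n ≈ horner x c n
          hornerCong h zero = h 0
          hornerCong h (suc n) = +-cong (*-congˡ (hornerCong h n)) (h (suc n))
          -- The outermost factor of `b` is T - x^(p^0) = T - x.
          root : horner x b (suc m) ≈ 0#
          root = trans (hornerCong (mulLinear-cong (*-identityʳ x) (λ _ → refl)) (suc m))
            (horner-root x (conjugateProd-degree x rx l 1 k))

        y^q≈y : y ^ q ≈ y
        y^q≈y = trans (frobenius-iterate-sub (suc k) (x ^ e) 1#) (+-cong
          (trans (^-assocʳ x e q) (trans (^-congʳ x (ℕₚ.*-comm e q)) (trans (sym (^-assocʳ x q e)) (^-congˡ e x^q≈x))))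
          (-‿cong (1^n≈1 q)))

        power≢1 : ∀ a′ → (∀ i → a′ i ≡[mod p ] a i) → ¬ MatEq p (matPow (companion a′) e) idMat
        power≢1 a′ a′≡a C^e≡1 = z≉0 (begin
          y * w               ≈⟨ *-congʳ y^q≈y ⟨
          y ^ q * w           ≈⟨ *-congʳ (^-congʳ y q≡) ⟩
          y * (y * y ^ (q ∸ 2)) * w ≈⟨ solve 3 (λ y e w → y :* (y :* e) :* w := e :* (y :* (y :* w))) refl y (y ^ (q ∸ 2)) w ⟩
          y ^ (q ∸ 2) * (y * z) ≈⟨ *-congˡ yz≈0 ⟩
          y ^ (q ∸ 2) * 0#    ≈⟨ zeroʳ _ ⟩
          0#                  ∎)
          where
          -- Since q ≥ 2, two factors y can be taken out of y^q: one forms z with w, and the other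
          -- kills it.
          q≡ : q ≡ suc (suc (q ∸ 2))
          q≡ = ≡.sym (ℕₚ.m+[n∸m]≡n (ℕₚ.≤-trans 1<p (ℕₚ.m≤m*n p (p ℕ.^ k) {{ℕₚ.m^n≢0 p k {{ℕ.>-nonZero (ℕₚ.<⇒≤ 1<p)}}}})))
          u = λ (j : Fin (suc m)) → x ^ (m ∸ toℕ j) * z
          u-last : u (fromℕ m) ≈ z
          u-last = trans (*-congʳ (^-congʳ x (≡.trans (≡.cong (m ∸_) (Finₚ.toℕ-fromℕ m)) (ℕₚ.n∸n≡0 m)))) (*-identityˡ z)
          yz≈0 : y * z ≈ 0#
          yz≈0 = begin
            (x ^ e - 1#) * z    ≈⟨ distribʳ z _ _ ⟩
            x ^ e * z + - 1# * z ≈⟨ +-cong (*-congˡ (sym u-last)) (trans (sym (-‿distribˡ-* 1# z)) (-‿cong (*-identityˡ z))) ⟩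
            x ^ e * u (fromℕ m) - z
              ≈⟨ +-congʳ (act-power (companion a′) u x (companion-act x z a′ (relation a′ a′≡a)) e (fromℕ m)) ⟨
            act (matPow (companion a′) e) u (fromℕ m) - z
              ≈⟨ +-congʳ (trans (act-mod {A = matPow (companion a′) e} {idMat} C^e≡1 u (fromℕ m)) (trans (act-id u (fromℕ m)) u-last)) ⟩
            z - z               ≈⟨ -‿inverseʳ z ⟩
            0#                  ∎

-- The exponent of the invertible matrices modulo a prime.

module ExponentModPrime where

  open Matrices
  open Frobenius
  open Companion
  open import Algebra.Bundles using (Ring)
  open import Data.Nat as ℕ using (ℕ; zero; suc; s≤s; z≤n; _∸_)
  import Data.Nat.Properties as ℕₚ
  import Data.Nat.Divisibility as ℕD
  open import Data.Nat.Primality using (Prime)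
  open import Data.Integer as ℤ using (ℤ; +_; ∣_∣)
  import Data.Integer.Properties as ℤₚ
  open import Data.Integer.Divisibility.Signed using (divides; ∣⇒∣ᵤ)
  open import Data.Integer.DivMod using (_%ℕ_; _/ℕ_; n%ℕd<d; a≡a%ℕn+[a/ℕn]*n)
  open import Data.Integer.Solver using (module +-*-Solver)
  open import Data.Fin as Fin using (Fin; zero; suc; toℕ; fromℕ<; finToFun; funToFin)
  import Data.Fin.Properties as Finₚ
  open import Data.List using (tabulate)
  import Data.List as List
  import Data.List.Properties as Listₚ
  import Data.List.Relation.Unary.Any.Properties as Anyₚ
  open import Data.Product using (_×_; _,_; ∃-syntax; Σ-syntax)
  open import Relation.Nullary using (¬_; contradiction)
  open import Relation.Binary.PropositionalEquality as ≡ using (_≡_)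

  scalar : ∀ {m} → ℤ → Mat m
  scalar d i j = d ℤ.* idMat i j

  scalar-⊗ : ∀ {m} d (A : Mat m) i j → (scalar d ⊗ A) i j ≡ d ℤ.* A i j
  scalar-⊗ d A i j = ≡.trans (sum-cong (λ k → ℤₚ.*-assoc d (idMat i k) (A k j)))
    (≡.trans (sum-*ˡ d (λ k → idMat i k ℤ.* A k j)) (≡.cong (d ℤ.*_) (sum-idˡ i (λ k → A k j))))

  ⊗-scalar : ∀ {m} d (A : Mat m) i j → (A ⊗ scalar d) i j ≡ d ℤ.* A i j
  ⊗-scalar d A i j = ≡.trans (sum-cong (λ k → +-*-Solver.solve 3 (λ a d i → a :* (d :* i) := d :* (a :* i)) ≡.refl (A i k) d (idMat k j)))
    (≡.trans (sum-*ˡ d (λ k → A i k ℤ.* idMat k j)) (≡.cong (d ℤ.*_) (sum-idʳ j (A i))))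
    where open +-*-Solver

  bicommutantAlgebra : ∀ p {m} → Mat m → 𝔽-Algebra p
  bicommutantAlgebra p {m} A = record
    { commutativeRing = bicommutant
    ; ι = λ d → elem (scalar d) λ Y _ → exact λ i j → ≡.trans (scalar-⊗ d Y i j) (≡.sym (⊗-scalar d Y i j))
    ; ι-+ = λ a b → exact λ i j → ℤₚ.*-distribʳ-+ (idMat i j) a b
    ; ι-* = λ a b → exact λ i j → ≡.trans (ℤₚ.*-assoc a b (idMat i j)) (≡.sym (scalar-⊗ a (scalar b) i j))
    ; ι-neg = λ a → exact λ i j → ≡.sym (ℤₚ.neg-distribˡ-* a (idMat i j))
    ; ι-0 = exact λ i j → ≡.refl
    ; ι-1 = exact λ i j → ℤₚ.*-identityˡ (idMat i j)
    ; ι-p = congruent λ i j → ∣⇒∣ᵤ {+ p} (divides (idMat i j)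
        (≡.trans (ℤₚ.+-identityʳ _) (ℤₚ.*-comm (+ p) (idMat i j))))
    }
    where
    open Bicommutant (matRing p m) A
    exact : {B C : Mat m} → (∀ i j → B i j ≡ C i j) → Congruent p B C
    exact h = congruent λ i j → mod-reflexive (h i j)

  module PowerOne {p : ℕ} (p-prime : Prime p) (𝔽 : 𝔽-Algebra p) where
    open Theory p-prime 𝔽
    open CompanionOrder p-prime 𝔽 using (Regular; regular-^; x-y≈0⇒x≈y)
    open import Relation.Binary.Reasoning.Setoid setoid

    geometricᴿ : ℕ → Carrier → Carrier
    geometricᴿ zero    x = 0#
    geometricᴿ (suc n) x = 1# + x * geometricᴿ n x

    x-1∣x^n-1 : ∀ n x → x ^ n - 1# ≈ geometricᴿ n x * (x - 1#)
    x-1∣x^n-1 zero x = trans (-‿inverseʳ 1#) (sym (zeroˡ _))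
    x-1∣x^n-1 (suc n) x = begin
      x * x ^ n - 1#                      ≈⟨ solve 3 (λ x e o → x :* e :- o := x :* (e :- o) :+ (x :* o :- o)) refl x (x ^ n) 1# ⟩
      x * (x ^ n - 1#) + (x * 1# - 1#)    ≈⟨ +-cong (*-congˡ (x-1∣x^n-1 n x)) (trans (+-congʳ (*-identityʳ x)) (sym (*-identityˡ _))) ⟩
      x * (geometricᴿ n x * (x - 1#)) + 1# * (x - 1#)
        ≈⟨ solve 4 (λ x g y o → x :* (g :* y) :+ o :* y := (o :+ x :* g) :* y) refl x (geometricᴿ n x) (x - 1#) 1# ⟩
      (1# + x * geometricᴿ n x) * (x - 1#) ∎

    module _ (a : Carrier) where
      open Annihilator a

      -- The factor a^(p^j) - a = a (a^(p^j - 1) - 1) divides a (a^L - 1) as soon as p^j - 1 divides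
      -- L; multiply over j ≤ m.
      frobProd-∣-power : ∀ L m → (∀ j → 1 ℕ.≤ j → j ℕ.≤ m → (p ℕ.^ j ∸ 1) ℕD.∣ L) →
        frobProd m ∣ᴿ (a ^ m * (a ^ L - 1#) ^ m)
      frobProd-∣-power L zero h = 1# , refl
      frobProd-∣-power L (suc m) h
        with frobProd-∣-power L m (λ j 1≤j j≤m → h j 1≤j (ℕₚ.m≤n⇒m≤1+n j≤m)) | h (suc m) (s≤s z≤n) ℕₚ.≤-refl
      ... | q , eq | ℕD.divides t L≡ = geometricᴿ t (a ^ N) * q , (begin
        a * a ^ m * (y * y ^ m)             ≈⟨ solve 4 (λ a u y v → a :* u :* (y :* v) := a :* y :* (u :* v)) refl a (a ^ m) y (y ^ m) ⟩
        a * y * (a ^ m * y ^ m)             ≈⟨ *-cong (*-congˡ y≈) eq ⟩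
        a * (geometricᴿ t (a ^ N) * (a ^ N - 1#)) * (q * frobProd m)
          ≈⟨ solve 5 (λ a g n q f → a :* (g :* n) :* (q :* f) := g :* q :* (a :* n :* f)) refl a (geometricᴿ t (a ^ N)) (a ^ N - 1#) q (frobProd m) ⟩
        geometricᴿ t (a ^ N) * q * (a * (a ^ N - 1#) * frobProd m) ≈⟨ *-congˡ (*-congʳ node≈) ⟩
        geometricᴿ t (a ^ N) * q * ((node (suc m) - a) * frobProd m) ∎)
        where
        N = p ℕ.^ suc m ∸ 1
        y = a ^ L - 1#
        y≈ : y ≈ geometricᴿ t (a ^ N) * (a ^ N - 1#)
        y≈ = trans (+-congʳ (trans (^-congʳ a (≡.trans L≡ (ℕₚ.*-comm t N))) (sym (^-assocʳ a N t)))) (x-1∣x^n-1 t (a ^ N))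
        node≈ : a * (a ^ N - 1#) ≈ node (suc m) - a
        node≈ = trans (solve 3 (λ a e o → a :* (e :- o) := a :* e :- a :* o) refl a (a ^ N) 1#)
          (+-cong (^-congʳ a (ℕₚ.m+[n∸m]≡n (ℕₚ.m^n>0 p {{ℕ.>-nonZero (ℕₚ.<⇒≤ 1<p)}} (suc m)))) (-‿cong (*-identityʳ a)))

      frobProd≈0⇒power≈1 : Regular a → ∀ L m e → (∀ j → 1 ℕ.≤ j → j ℕ.≤ m → (p ℕ.^ j ∸ 1) ℕD.∣ L) →
        m ℕ.≤ p ℕ.^ e → frobProd m ≈ 0# → a ^ (L ℕ.* p ℕ.^ e) ≈ 1#
      frobProd≈0⇒power≈1 ra L m e h m≤p^e frob≈0 with frobProd-∣-power L m h
      ... | q , eq = x-y≈0⇒x≈y (begin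
        a ^ (L ℕ.* p ℕ.^ e) - 1#              ≈⟨ +-cong (^-assocʳ a L (p ℕ.^ e)) (-‿cong (1^n≈1 (p ℕ.^ e))) ⟨
        (a ^ L) ^ (p ℕ.^ e) - 1# ^ (p ℕ.^ e)  ≈⟨ frobenius-iterate-sub e (a ^ L) 1# ⟨
        (a ^ L - 1#) ^ (p ℕ.^ e)              ≈⟨ ^-congʳ (a ^ L - 1#) (ℕₚ.m+[n∸m]≡n m≤p^e) ⟨
        (a ^ L - 1#) ^ (m ℕ.+ (p ℕ.^ e ∸ m))  ≈⟨ ^-homo-* (a ^ L - 1#) m (p ℕ.^ e ∸ m) ⟩
        (a ^ L - 1#) ^ m * (a ^ L - 1#) ^ (p ℕ.^ e ∸ m) ≈⟨ *-congʳ (regular-^ m ra _ (trans eq (trans (*-congˡ frob≈0) (zeroʳ q)))) ⟩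
        0# * (a ^ L - 1#) ^ (p ℕ.^ e ∸ m)     ≈⟨ zeroˡ _ ⟩
        0#                                    ∎)

  %ℕ-mod : ∀ {p} .{{_ : ℕ.NonZero p}} a b → a %ℕ p ≡ b %ℕ p → a ≡[mod p ] b
  %ℕ-mod {p} a b eq = ∣⇒∣ᵤ {+ p} (divides (a /ℕ p ℤ.- b /ℕ p) (begin
    a ℤ.- b   ≡⟨ ≡.cong₂ ℤ._-_ (a≡a%ℕn+[a/ℕn]*n a p) (a≡a%ℕn+[a/ℕn]*n b p) ⟩
    (+ (a %ℕ p) ℤ.+ a /ℕ p ℤ.* + p) ℤ.- (+ (b %ℕ p) ℤ.+ b /ℕ p ℤ.* + p)
      ≡⟨ ≡.cong (λ r → (+ r ℤ.+ a /ℕ p ℤ.* + p) ℤ.- (+ (b %ℕ p) ℤ.+ b /ℕ p ℤ.* + p)) eq ⟩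
    (+ (b %ℕ p) ℤ.+ a /ℕ p ℤ.* + p) ℤ.- (+ (b %ℕ p) ℤ.+ b /ℕ p ℤ.* + p)
      ≡⟨ +-*-Solver.solve 4 (λ r x y p → (r :+ x :* p) :- (r :+ y :* p) := (x :- y) :* p) ≡.refl (+ (b %ℕ p)) (a /ℕ p) (b /ℕ p) (+ p) ⟩
    (a /ℕ p ℤ.- b /ℕ p) ℤ.* + p ∎))
    where
    open ≡.≡-Reasoning
    open +-*-Solver

  funToFin-cong : ∀ {m n} {f g : Fin m → Fin n} → (∀ i → f i ≡ g i) → funToFin f ≡ funToFin g
  funToFin-cong {zero}  h = ≡.refl
  funToFin-cong {suc m} h = ≡.cong₂ Fin.combine (h zero) (funToFin-cong (λ i → h (suc i)))

  funToFin-injective : ∀ {m n} {f g : Fin m → Fin n} → funToFin f ≡ funToFin g → ∀ i → f i ≡ g i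
  funToFin-injective {f = f} {g} h i = ≡.trans (≡.sym (Finₚ.finToFun-funToFin f i))
    (≡.trans (≡.cong (λ c → finToFun c i) h) (Finₚ.finToFun-funToFin g i))

  <-mod⇒≡ : ∀ {p a b} → a ℕ.< p → b ℕ.< p → p ℕD.∣ ∣ + a ℤ.- + b ∣ → a ≡ b
  <-mod⇒≡ {p} {a} {b} a<p b<p p∣ with ∣ + a ℤ.- + b ∣ in eq
  ... | zero = ℤₚ.+-injective (ℤₚ.i-j≡0⇒i≡j (+ a) (+ b) (ℤₚ.∣i∣≡0⇒i≡0 eq))
  ... | suc d = contradiction (ℕD.∣⇒≤ p∣) (ℕₚ.<⇒≱ (≡.subst (ℕ._< p) eq bound))
    where
    bound : ∣ + a ℤ.- + b ∣ ℕ.< p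
    bound = ℕₚ.≤-<-trans (≡.subst (ℕ._≤ a ℕ.⊔ b) (≡.sym (≡.cong ∣_∣ (ℤₚ.m-n≡m⊖n a b))) (ℤₚ.∣m⊝n∣≤m⊔n a b)) (ℕₚ.⊔-lub a<p b<p)

  -- Pigeonhole on the p^(m+1) combinations with coefficients in {0,…,p-1}.
  dependent : ∀ {p m} → 1 ℕ.< p → (w : Fin (suc m) → Fin m → ℤ) →
    Σ[ d ∈ (Fin (suc m) → ℤ) ] (∃[ i ] ¬ p ℕD.∣ ∣ d i ∣) × (∀ r → sumFin (λ i → d i ℤ.* w i r) ≡[mod p ] (+ 0))
  dependent {p@(suc _)} {m} 1<p w = conclude (Finₚ.pigeonhole (ℕₚ.^-monoʳ-< p 1<p (ℕₚ.n<1+n m)) hash)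
    where
    digits : Fin (p ℕ.^ suc m) → Fin (suc m) → ℤ
    digits c i = + toℕ (finToFun {p} {suc m} c i)
    combination : Fin (p ℕ.^ suc m) → Fin m → ℤ
    combination c r = sumFin (λ i → digits c i ℤ.* w i r)
    hash : Fin (p ℕ.^ suc m) → Fin (p ℕ.^ m)
    hash c = funToFin (λ r → fromℕ< (n%ℕd<d (combination c r) p))
    conclude : (∃[ b ] ∃[ c ] b Fin.< c × hash b ≡ hash c) → _
    conclude (b , c , b<c , same) = d ,
      Finₚ.¬∀⟶∃¬ (suc m) (λ i → p ℕD.∣ ∣ d i ∣) (λ i → p ℕD.∣? ∣ d i ∣) (λ all → ℕₚ.<⇒≢ b<c (≡.cong toℕ (equal all))) , relation
      where
      d : Fin (suc m) → ℤ
      d i = digits b i ℤ.- digits c i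
      equal : (∀ i → p ℕD.∣ ∣ d i ∣) → b ≡ c
      equal all = ≡.trans (≡.sym (Finₚ.funToFin-finToFin {suc m} {p} b)) (≡.trans
        (funToFin-cong (λ i → Finₚ.toℕ-injective (<-mod⇒≡ (Finₚ.toℕ<n (finToFun {p} {suc m} b i)) (Finₚ.toℕ<n (finToFun {p} {suc m} c i)) (all i))))
        (Finₚ.funToFin-finToFin {suc m} {p} c))
      relation : ∀ r → sumFin (λ i → d i ℤ.* w i r) ≡[mod p ] (+ 0)
      relation r = ≡.subst (λ s → + p ℤD.∣ s) (≡.sym (≡.trans (ℤₚ.+-identityʳ _) split))
        (%ℕ-mod (combination b r) (combination c r) (≡.trans (≡.sym (Finₚ.toℕ-fromℕ< (n%ℕd<d (combination b r) p)))
          (≡.trans (≡.cong toℕ (funToFin-injective same r)) (Finₚ.toℕ-fromℕ< (n%ℕd<d (combination c r) p)))))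
        where
        import Data.Integer.Divisibility as ℤD
        open +-*-Solver
        split : sumFin (λ i → d i ℤ.* w i r) ≡ combination b r ℤ.- combination c r
        split = ≡.trans (sum-cong (λ i → +-*-Solver.solve 3 (λ x y w → (x :- y) :* w := x :* w :+ (con ℤ.-1ℤ) :* (y :* w)) ≡.refl (digits b i) (digits c i) (w i r)))
          (≡.trans (sum-+ (λ i → digits b i ℤ.* w i r) (λ i → ℤ.-1ℤ ℤ.* (digits c i ℤ.* w i r)))
          (≡.cong (λ t → combination b r ℤ.+ t) (≡.trans (sum-*ˡ ℤ.-1ℤ (λ i → digits c i ℤ.* w i r)) (ℤₚ.-1*i≡-i _))))

  polyMat : ∀ {m n} → Mat m → (Fin n → ℤ) → Mat m
  polyMat A d r j = sumFin (λ i → d i ℤ.* matPow A (toℕ i) r j)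

  polyMat-suc : ∀ {m n} (A : Mat m) (d : Fin (suc n) → ℤ) r j →
    polyMat A d r j ≡ scalar (d zero) r j ℤ.+ (A ⊗ polyMat A (λ i → d (suc i))) r j
  polyMat-suc A d r j = ≡.cong (λ t → d zero ℤ.* idMat r j ℤ.+ t) (≡.trans
    (sum-cong (λ i → ≡.trans (≡.sym (sum-*ˡ (d (suc i)) (λ k → A r k ℤ.* matPow A (toℕ i) k j)))
      (sum-cong (λ k → +-*-Solver.solve 3 (λ d a x → d :* (a :* x) := a :* (d :* x)) ≡.refl (d (suc i)) (A r k) (matPow A (toℕ i) k j)))))
    (≡.trans (sum-swap (λ i k → A r k ℤ.* (d (suc i) ℤ.* matPow A (toℕ i) k j)))
      (sum-cong (λ k → sum-*ˡ (A r k) (λ i → d (suc i) ℤ.* matPow A (toℕ i) k j)))))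
    where open +-*-Solver

  module MatrixExponent {p : ℕ} (p-prime : Prime p) {m : ℕ} (A : Mat m) where
    open Ring (matRing p m) using () renaming (refl to reflᴹ; sym to symᴹ; trans to transᴹ; +-cong to +-congᴹ; *-cong to *-congᴹ;
      *-assoc to *-assocᴹ; *-identityˡ to *-identityˡᴹ; *-identityʳ to *-identityʳᴹ; zeroʳ to zeroʳᴹ)
    open Bicommutant (matRing p m) A using (elem; value; generator) public
    open Theory p-prime (bicommutantAlgebra p A) using (_^_; _≈_; 0#; 1#; _*_; ι; 1<p; _∣ᴿ_; module Annihilator) public
    open Annihilator generator using (dividedDiff; frobProd; value-∣-frobProd)

    value-^ : ∀ x e → value (x ^ e) ≡ matPow (value x) e
    value-^ x zero = ≡.refl
    value-^ x (suc e) = ≡.cong (value x ⊗_) (value-^ x e)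

    value-horner : ∀ {n} (d : Fin n → ℤ) → Congruent p (value (dividedDiff (List.map ι (tabulate d)) 0 0)) (polyMat A d)
    value-horner {zero} d = reflᴹ
    value-horner {suc n} d = transᴹ
      (+-congᴹ {scalar (d zero)} {scalar (d zero)} reflᴹ (*-congᴹ (*-identityʳᴹ A) (value-horner (λ i → d (suc i)))))
      (congruent λ i j → mod-reflexive (≡.sym (polyMat-suc A d i j)))

    -- For column j, the j-th columns of the m + 1 powers of A are dependent, which gives a
    -- polynomial of degree at most m whose value at A has zero j-th column. The polynomial depends
    -- on j, but `frobProd m` is a left multiple of each of these values, so all its columns vanish.
    frobProd≈0 : frobProd m ≈ 0#
    frobProd≈0 = congruent λ r j → column j r
      where
      column : ∀ j r → value (frobProd m) r j ≡[mod p ] (+ 0)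
      column j r = combine (dependent 1<p (λ i r → matPow A (toℕ i) r j))
        where
        combine : (Σ[ d ∈ (Fin (suc m) → ℤ) ] (∃[ i ] ¬ p ℕD.∣ ∣ d i ∣) ×
                    (∀ r → sumFin (λ i → d i ℤ.* matPow A (toℕ i) r j) ≡[mod p ] (+ 0))) →
                  value (frobProd m) r j ≡[mod p ] (+ 0)
        combine (d , (i , p∤di) , relation) = go (value-∣-frobProd m (tabulate d)
          (ℕₚ.≤-reflexive (Listₚ.length-tabulate d)) (Anyₚ.tabulate⁺ {f = d} i p∤di))
          where
          go : dividedDiff (List.map ι (tabulate d)) 0 0 ∣ᴿ frobProd m → value (frobProd m) r j ≡[mod p ] (+ 0)
          go (q , eq) = mod-trans (value (frobProd m) r j) ((value q ⊗ polyMat A d) r j) (+ 0)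
            (entries (transᴹ eq (*-congᴹ {value q} {value q} reflᴹ (value-horner d))) r j)
            (≡.subst (λ s → (value q ⊗ polyMat A d) r j ≡[mod p ] s) (sum-zero m)
              (sum-mod (λ k → value q r k ℤ.* polyMat A d k j) (λ _ → + 0) λ k →
                ≡.subst (λ s → (value q r k ℤ.* polyMat A d k j) ≡[mod p ] s) (ℤₚ.*-zeroʳ (value q r k))
                  (mod-* (value q r k) (value q r k) (polyMat A d k j) (+ 0) (mod-reflexive {p} {value q r k} ≡.refl) (relation k))))

    power≡1 : ∀ {B} → MatEq p (B ⊗ A) idMat → ∀ L e → (∀ j → 1 ℕ.≤ j → j ℕ.≤ m → (p ℕ.^ j ∸ 1) ℕD.∣ L) →
      m ℕ.≤ p ℕ.^ e → MatEq p (matPow A (L ℕ.* p ℕ.^ e)) idMat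
    power≡1 {B} BA≡1 L e h m≤p^e = ≡.subst (λ C → MatEq p C idMat) (value-^ generator (L ℕ.* p ℕ.^ e))
      (entries (PowerOne.frobProd≈0⇒power≈1 p-prime (bicommutantAlgebra p A) generator regular L m e h m≤p^e frobProd≈0))
      where
      regular : ∀ z → generator * z ≈ 0# → z ≈ 0#
      regular z h = transᴹ (symᴹ (*-identityˡᴹ (value z))) (transᴹ
        (*-congᴹ {idMat} {B ⊗ A} {value z} {value z} (symᴹ (congruent BA≡1)) reflᴹ)
        (transᴹ (*-assocᴹ B A (value z)) (transᴹ (*-congᴹ {B} {B} reflᴹ h) (zeroʳᴹ B))))

-- From divisibility by `D m p` to the power identity modulo n.

module Sufficiency where

  open LeastCommonMultiple using (p^k-1∣D)
  open Cyclotomic using (*-mono-∣; Φ; Φ∣x^k-1; cyclotomic-correct)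
  open Matrices
  open Frobenius using (prime∤⇒coprime)
  open ExponentModPrime
  open import Algebra.Bundles using (Ring)
  open import Data.Nat as ℕ using (ℕ; zero; suc; s≤s; z≤n; _∸_; _^_)
  import Data.Nat.Properties as ℕₚ
  open import Data.Nat.Divisibility as ℕD using (_∣_; divides; _∣?_)
  open import Data.Nat.Coprimality as Coprime using (Coprime; coprime-divisor)
  open import Data.Nat.Induction using (<-rec)
  open import Data.Nat.Primality using (Prime; prime?; euclidsLemma; prime⇒nonTrivial; prime⇒nonZero)
  open import Data.Nat.Primality.Factorisation using (factorise)
  open import Data.Integer as ℤ using (ℤ; +_; ∣_∣)
  import Data.Integer.Properties as ℤₚ
  open import Data.Integer.Divisibility.Signed as ℤS using (∣ᵤ⇒∣; ∣⇒∣ᵤ)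
  open import Data.Integer.Solver using (module +-*-Solver)
  open import Data.Fin using (Fin)
  open import Data.Bool using (true; false; if_then_else_; _∧_)
  open import Data.List using ([]; _∷_)
  open import Data.List.Relation.Unary.All using ([]; _∷_)
  open import Data.Product using (_×_; _,_; proj₂; ∃-syntax)
  open import Data.Sum using (inj₁; inj₂)
  open import Relation.Nullary using (Dec; does; yes; no; ¬_; contradiction)
  open import Relation.Nullary.Decidable using (dec-true)
  open import Relation.Binary.PropositionalEquality

  module MatPower (n : ℕ) {m : ℕ} where
    open Ring (matRing n m) using (semiring) renaming (refl to reflᴹ; sym to symᴹ; trans to transᴹ; *-cong to *-congᴹ;
      *-identityˡ to *-identityˡᴹ)
    open import Algebra.Properties.Semiring.Exp semiring using (^-assocʳ; ^-congˡ) renaming (_^_ to _^ᴹ_)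

    ^≡matPow : ∀ A e → A ^ᴹ e ≡ matPow A e
    ^≡matPow A zero = refl
    ^≡matPow A (suc e) = cong (A ⊗_) (^≡matPow A e)

    matPow-* : ∀ A d e → Congruent n (matPow (matPow A d) e) (matPow A (d ℕ.* e))
    matPow-* A d e = subst₂ (Congruent n) (trans (^≡matPow (A ^ᴹ d) e) (cong (λ B → matPow B e) (^≡matPow A d)))
      (^≡matPow A (d ℕ.* e)) (^-assocʳ A d e)

    matPow-cong : ∀ {A B} e → Congruent n A B → Congruent n (matPow A e) (matPow B e)
    matPow-cong {A} {B} e h = subst₂ (Congruent n) (^≡matPow A e) (^≡matPow B e) (^-congˡ e h)

    matPow-id : ∀ e → Congruent n (matPow idMat e) idMat
    matPow-id zero = reflᴹ
    matPow-id (suc e) = transᴹ (*-identityˡᴹ (matPow idMat e)) (matPow-id e)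

    matPow-∣ : ∀ A {d e} → d ∣ e → Congruent n (matPow A d) idMat → Congruent n (matPow A e) idMat
    matPow-∣ A {d} (divides q e≡) h = subst (λ k → Congruent n (matPow A k) idMat) (trans (ℕₚ.*-comm d q) (sym e≡))
      (transᴹ (symᴹ (matPow-* A d q)) (transᴹ (matPow-cong q h) (matPow-id q)))

  geometricMat : ∀ {m} → ℕ → Mat m → Mat m
  geometricMat zero    U = zeroMat
  geometricMat (suc n) U = idMat ⊕ (U ⊗ geometricMat n U)

  ⊗-distribˡ : ∀ {m} (A B C : Mat m) i j → (A ⊗ (B ⊕ C)) i j ≡ (A ⊗ B) i j ℤ.+ (A ⊗ C) i j
  ⊗-distribˡ A B C i j = trans (sum-cong (λ k → ℤₚ.*-distribˡ-+ (A i k) (B k j) (C k j)))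
    (sum-+ (λ k → A i k ℤ.* B k j) (λ k → A i k ℤ.* C k j))

  geometricMat-telescope : ∀ {m} n (U : Mat m) i j →
    (geometricMat n U ⊗ (U ⊕ (⊝ idMat))) i j ≡ matPow U n i j ℤ.- idMat i j
  geometricMat-telescope {m} zero U i j = trans (trans (sum-cong (λ k → ℤₚ.*-zeroˡ ((U ⊕ (⊝ idMat)) k j))) (sum-zero m))
    (sym (ℤₚ.+-inverseʳ (idMat i j)))
  geometricMat-telescope (suc n) U i j = begin
    ((idMat ⊕ (U ⊗ G)) ⊗ V) i j
      ≡⟨ trans (sum-cong (λ k → ℤₚ.*-distribʳ-+ (V k j) (idMat i k) ((U ⊗ G) i k))) (sum-+ (λ k → idMat i k ℤ.* V k j) _) ⟩
    (idMat ⊗ V) i j ℤ.+ ((U ⊗ G) ⊗ V) i j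
      ≡⟨ cong₂ ℤ._+_ (sum-idˡ i (λ k → V k j)) (trans (⊗-assoc U G V i j) (sum-cong (λ k → cong (U i k ℤ.*_) (geometricMat-telescope n U k j)))) ⟩
    V i j ℤ.+ (U ⊗ (matPow U n ⊕ (⊝ idMat))) i j
      ≡⟨ cong (λ t → V i j ℤ.+ t) (trans (⊗-distribˡ U (matPow U n) (⊝ idMat) i j) (cong (λ t → (U ⊗ matPow U n) i j ℤ.+ t)
           (trans (sum-cong (λ k → trans (sym (ℤₚ.neg-distribʳ-* (U i k) (idMat k j))) (sym (ℤₚ.-1*i≡-i _))))
             (trans (sum-*ˡ ℤ.-1ℤ (λ k → U i k ℤ.* idMat k j)) (trans (ℤₚ.-1*i≡-i _) (cong ℤ.-_ (sum-idʳ j (U i)))))))) ⟩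
    (U i j ℤ.- idMat i j) ℤ.+ ((U ⊗ matPow U n) i j ℤ.- U i j)
      ≡⟨ solve 3 (λ u o w → (u :- o) :+ (w :- u) := w :- o) refl (U i j) (idMat i j) ((U ⊗ matPow U n) i j) ⟩
    (U ⊗ matPow U n) i j ℤ.- idMat i j ∎
    where
    open ≡-Reasoning
    open +-*-Solver
    G = geometricMat n U
    V = U ⊕ (⊝ idMat)

  geometricMat-mod : ∀ {p m} n (U : Mat m) → Congruent p U idMat → Congruent p (geometricMat n U) (scalar (+ n))
  geometricMat-mod {p} {m} zero U h = congruent λ i j → mod-reflexive {p} {+ 0} refl
  geometricMat-mod {p} {m} (suc n) U h = R.trans (R.+-cong {idMat} {idMat} R.refl (R.trans
      (R.*-cong {U} {idMat} h (geometricMat-mod n U h)) (R.*-identityˡ (scalar (+ n)))))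
    (congruent λ i j → mod-reflexive (solve 2 (λ n x → x :+ n :* x := (con (+ 1) :+ n) :* x) refl (+ n) (idMat i j)))
    where
    module R = Ring (matRing p m)
    open +-*-Solver

  ∣ᵤ-sum : ∀ {q m} (f : Fin m → ℤ) → (∀ k → + q ℤS.∣ f k) → + q ℤS.∣ sumFin f
  ∣ᵤ-sum {q} {zero} f h = ℤS.divides (+ 0) refl
  ∣ᵤ-sum {q} {suc m} f h = ℤS.∣m∣n⇒∣m+n (h Fin.zero) (∣ᵤ-sum (λ k → f (Fin.suc k)) (λ k → h (Fin.suc k)))

  -- U^p - 1 = (1 + U + … + U^(p-1)) (U - 1), and the first factor is ≡ p ≡ 0 modulo p.
  matPow-lift : ∀ {p m} s (U : Mat m) → Congruent (p ^ suc s) U idMat → Congruent (p ^ suc (suc s)) (matPow U p) idMat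
  matPow-lift {p} {m} s U h = congruent λ i j → ∣⇒∣ᵤ {+ (p ^ suc (suc s))}
    (subst (+ (p ^ suc (suc s)) ℤS.∣_) (geometricMat-telescope p U i j)
      (∣ᵤ-sum (λ k → geometricMat p U i k ℤ.* (U ⊕ (⊝ idMat)) k j) λ k →
        subst (ℤS._∣ geometricMat p U i k ℤ.* (U ⊕ (⊝ idMat)) k j) (sym (ℤₚ.pos-* p (p ^ suc s)))
          (*-mono-∣ (geometric-∣ i k) (∣ᵤ⇒∣ {+ (p ^ suc s)} (entries h k j)))))
    where
    mod-p : Congruent p U idMat
    mod-p = congruent λ i j → ℕD.∣-trans (ℕD.m∣m*n (p ^ s)) (entries h i j)
    geometric-∣ : ∀ i k → + p ℤS.∣ geometricMat p U i k
    geometric-∣ i k = subst (+ p ℤS.∣_) (solve 2 (λ a b → (a :- b) :+ b := a) refl (geometricMat p U i k) (scalar (+ p) i k))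
      (ℤS.∣m∣n⇒∣m+n (∣ᵤ⇒∣ {+ p} {geometricMat p U i k ℤ.- scalar (+ p) i k} (entries (geometricMat-mod p U mod-p) i k)) (ℤS.∣m⇒∣m*n (idMat i k) ℤS.∣-refl))
      where open +-*-Solver

  matPow-lifts : ∀ {p m} (A : Mat m) E s → Congruent p (matPow A E) idMat →
    Congruent (p ^ suc s) (matPow A (E ℕ.* p ^ s)) idMat
  matPow-lifts {p} {m} A E zero h = subst₂ (λ q e → Congruent q (matPow A e) idMat)
    (sym (ℕₚ.*-identityʳ p)) (sym (ℕₚ.*-identityʳ E)) h
  matPow-lifts {p} {m} A E (suc s) h = subst (λ e → Congruent (p ^ suc (suc s)) (matPow A e) idMat)
    (trans (ℕₚ.*-assoc E (p ^ s) p) (cong (E ℕ.*_) (ℕₚ.*-comm (p ^ s) p)))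
    (Ring.trans (matRing (p ^ suc (suc s)) m) (Ring.sym (matRing (p ^ suc (suc s)) m)
        (MatPower.matPow-* (p ^ suc (suc s)) A (E ℕ.* p ^ s) p))
      (matPow-lift {p} s (matPow A (E ℕ.* p ^ s)) (matPow-lifts {p} A E s h)))

  coprime-* : ∀ {a b c} → Coprime a c → Coprime b c → Coprime (a ℕ.* b) c
  coprime-* {a} {b} {c} ac bc {d} (d∣ab , d∣c) = bc (coprime-divisor {d} {a} {b} (λ (e∣d , e∣a) → ac (e∣a , ℕD.∣-trans e∣d d∣c)) d∣ab , d∣c)

  coprime-^ : ∀ {a c} e → Coprime a c → Coprime (a ^ e) c
  coprime-^ zero ac (d∣1 , _) = ℕD.∣1⇒≡1 d∣1
  coprime-^ (suc e) ac = coprime-* ac (coprime-^ e ac)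

  coprime-*-∣ : ∀ {a b c} → Coprime a b → a ∣ c → b ∣ c → a ℕ.* b ∣ c
  coprime-*-∣ {a} {b} coprime a∣c (divides q refl) =
    ℕD.*-monoˡ-∣ b (coprime-divisor {a} {b} {q} coprime (subst (a ∣_) (ℕₚ.*-comm q b) a∣c))

  prime-1< : ∀ {p} → Prime p → 1 ℕ.< p
  prime-1< {p} p-prime = ℕ.nonTrivial⇒n>1 p {{prime⇒nonTrivial p-prime}}

  split-power : ∀ {p} → Prime p → ∀ n → 1 ℕ.≤ n → ∃[ r ] ∃[ n′ ] n ≡ p ^ r ℕ.* n′ × ¬ p ∣ n′
  split-power {p} p-prime = <-rec _ step
    where
    step : ∀ n → (∀ {n′} → n′ ℕ.< n → 1 ℕ.≤ n′ → ∃[ r ] ∃[ k ] n′ ≡ p ^ r ℕ.* k × ¬ p ∣ k) →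
           1 ℕ.≤ n → ∃[ r ] ∃[ k ] n ≡ p ^ r ℕ.* k × ¬ p ∣ k
    step n rec 1≤n with p ∣? n
    ... | no p∤n = 0 , n , sym (ℕₚ.*-identityˡ n) , p∤n
    ... | yes (divides zero refl) = contradiction 1≤n λ ()
    ... | yes (divides q@(suc _) refl) with rec (ℕₚ.m<m*n q p (prime-1< p-prime)) (s≤s z≤n)
    ...   | r , k , q≡ , p∤k = suc r , k , trans (cong (ℕ._* p) q≡)
            (trans (ℕₚ.*-comm (p ^ r ℕ.* k) p) (sym (ℕₚ.*-assoc p (p ^ r) k))) , p∤k

  prime-divisor : ∀ n → 2 ℕ.≤ n → ∃[ p ] Prime p × p ∣ n
  prime-divisor n 2≤n with factorise n {{ℕ.>-nonZero (ℕₚ.<⇒≤ 2≤n)}}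
  ... | record { factors = [] ; isFactorisation = refl } = contradiction 2≤n λ { (s≤s ()) }
  ... | record { factors = p ∷ ps ; isFactorisation = refl ; factorsPrime = p-prime ∷ _ } = p , p-prime , ℕD.m∣m*n _

  -- The full power of one prime is coprime to the remaining factor, which is smaller and inherits
  -- the hypothesis. This reduces congruences modulo n to prime powers.
  prime-powers-∣ : ∀ n → 1 ℕ.≤ n → ∀ x → (∀ p r → Prime p → p ^ suc r ∣ n → p ^ suc r ∣ x) → n ∣ x
  prime-powers-∣ = <-rec _ step
    where
    step : ∀ n → (∀ {n′} → n′ ℕ.< n → 1 ℕ.≤ n′ → ∀ x → (∀ p r → Prime p → p ^ suc r ∣ n′ → p ^ suc r ∣ x) → n′ ∣ x) →
           1 ℕ.≤ n → ∀ x → (∀ p r → Prime p → p ^ suc r ∣ n → p ^ suc r ∣ x) → n ∣ x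
    step (suc zero) rec _ x h = ℕD.1∣ x
    step n@(suc (suc _)) rec 1≤n x h with prime-divisor n (s≤s (s≤s z≤n))
    ... | p , p-prime , p∣n with split-power p-prime n 1≤n
    ... | zero , n′ , n≡ , p∤n′ = contradiction (subst (p ∣_) (trans n≡ (ℕₚ.*-identityˡ n′)) p∣n) p∤n′
    ... | suc r , n′ , n≡ , p∤n′ = subst (_∣ x) (sym n≡) (coprime-*-∣
          (coprime-^ (suc r) (Coprime.sym (prime∤⇒coprime p-prime p∤n′)))
          (h p r p-prime (subst (p ^ suc r ∣_) (sym n≡) (ℕD.m∣m*n n′)))
          (rec n′<n 1≤n′ x λ q s q-prime q∣n′ → h q s q-prime (subst (q ^ suc s ∣_) (sym n≡) (ℕD.∣n⇒∣m*n (p ^ suc r) q∣n′))))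
      where
      1≤n′ : 1 ℕ.≤ n′
      1≤n′ = ℕₚ.n≢0⇒n>0 λ { refl → p∤n′ (p ℕD.∣0) }
      1<p^ : 1 ℕ.< p ^ suc r
      1<p^ = ℕₚ.<-≤-trans (prime-1< p-prime) (ℕₚ.m≤m*n p (p ^ r) {{ℕₚ.m^n≢0 p r {{prime⇒nonZero p-prime}}}})
      n′<n : n′ ℕ.< n
      n′<n = subst (n′ ℕ.<_) (trans (ℕₚ.*-comm n′ (p ^ suc r)) (sym n≡))
        (ℕₚ.m<m*n n′ (p ^ suc r) {{ℕ.>-nonZero 1≤n′}} 1<p^)

  searchLog : ℕ → ℕ → ℕ → ℕ → ℕ
  searchLog p m zero    e = e
  searchLog p m (suc f) e = if does (m ℕ.≤? p ^ e) then e else searchLog p m f (suc e)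

  -- As for newCyclo≡: the two abstractions turn the call of the unnamed local function of
  -- ceilLog into one at distinct variables, which determines the metavariable.
  mutual
    ceilLog≡ : ∀ p f → ceilLog p (2 ℕ.+ f) ≡ searchLog p (2 ℕ.+ f) (2 ℕ.+ f) 0
    ceilLog≡ p f with does (2 ℕ.+ f ℕ.≤? p ^ 1)
    ... | true = refl
    ... | false with suc (suc f) | 2
    ...   | m | e = local≡searchLog p m f e

    local≡searchLog : ∀ p m f e → _ ≡ searchLog p m f e
    local≡searchLog p m zero e = refl
    local≡searchLog p m (suc f) e with does (m ℕ.≤? p ^ e)
    ... | true  = refl
    ... | false = local≡searchLog p m f (suc e)

  searchLog-bound : ∀ p m f e → m ℕ.≤ p ^ (f ℕ.+ e) → m ℕ.≤ p ^ searchLog p m f e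
  searchLog-bound p m zero e h = h
  searchLog-bound p m (suc f) e h with does (m ℕ.≤? p ^ e) in eq
  ... | true  = witness (m ℕ.≤? p ^ e) eq
    where
    witness : ∀ {P : Set} (d : Dec P) → does d ≡ true → P
    witness (yes h) _ = h
  ... | false = searchLog-bound p m f (suc e) (subst (λ k → m ℕ.≤ p ^ k) (sym (ℕₚ.+-suc f e)) h)

  n≤p^n : ∀ {p} → 2 ℕ.≤ p → ∀ n → n ℕ.≤ p ^ n
  n≤p^n 2≤p zero = z≤n
  n≤p^n {p} 2≤p (suc n) = begin
    suc n             ≤⟨ ℕₚ.+-mono-≤ (ℕₚ.m^n>0 p {{ℕ.>-nonZero (ℕₚ.<⇒≤ 2≤p)}} n) (n≤p^n 2≤p n) ⟩
    p ^ n ℕ.+ p ^ n   ≡⟨ cong (p ^ n ℕ.+_) (ℕₚ.+-identityʳ (p ^ n)) ⟨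
    2 ℕ.* p ^ n       ≤⟨ ℕₚ.*-monoˡ-≤ (p ^ n) 2≤p ⟩
    p ℕ.* p ^ n       ∎
    where open ℕₚ.≤-Reasoning

  -- The search ends either with a successful test or with exponent m, its initial fuel, and m ≤
  -- p^m.
  ceilLog-bound : ∀ {p m} → 2 ℕ.≤ p → 2 ℕ.≤ m → m ℕ.≤ p ^ ceilLog p m
  ceilLog-bound {p} {m@(suc (suc f))} 2≤p _ = subst (λ e → m ℕ.≤ p ^ e) (sym (ceilLog≡ p f))
    (searchLog-bound p m m 0 (subst (λ e → m ℕ.≤ p ^ e) (sym (ℕₚ.+-identityʳ m)) (n≤p^n 2≤p m)))
  ceilLog-bound {m = suc zero} _ (s≤s ())

  -- p^0 = 1 is below m. Hence the truncated subtraction in `nabla` really lowers the exponent by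
  -- one.
  ceilLog-positive : ∀ {p m} → 2 ℕ.≤ p → 2 ℕ.≤ m → 1 ℕ.≤ ceilLog p m
  ceilLog-positive {p} {m} 2≤p 2≤m = ℕₚ.n≢0⇒n>0 λ e≡0 →
    ℕₚ.<⇒≱ 2≤m (subst (λ e → m ℕ.≤ p ^ e) e≡0 (ceilLog-bound 2≤p 2≤m))

  nablaUpTo-∣ : ∀ m n {p b} → Prime p → p ∣ n → p ℕ.≤ b → p ^ (ceilLog p m ∸ 1) ∣ nablaUpTo m n b
  nablaUpTo-∣ m n {p} {b} p-prime p∣n p≤b = go b p≤b
    where
    factor : ∀ q → p ≡ q → p ^ (ceilLog p m ∸ 1) ∣
      (if does (prime? q) ∧ does (q ∣? n) then q ^ (ceilLog q m ∸ 1) else 1)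
    factor q refl rewrite dec-true (prime? p) p-prime | dec-true (p ∣? n) p∣n = ℕD.∣-refl
    go : ∀ b → p ℕ.≤ b → p ^ (ceilLog p m ∸ 1) ∣ nablaUpTo m n b
    go zero z≤n = contradiction (prime-1< p-prime) λ ()
    go (suc b) p≤1+b with p ℕ.≟ suc b
    ... | yes p≡ = ℕD.∣m⇒∣m*n (nablaUpTo m n b) (factor (suc b) p≡)
    ... | no p≢ = ℕD.∣n⇒∣m*n
          (if does (prime? (suc b)) ∧ does (suc b ∣? n) then suc b ^ (ceilLog (suc b) m ∸ 1) else 1) (go b (ℕₚ.≤-pred (ℕₚ.≤∧≢⇒< p≤1+b p≢)))

  prime∤p^k-1 : ∀ {p} → Prime p → ∀ k → 1 ℕ.≤ k → ¬ + p ℤS.∣ (+ p) ℤ.^ k ℤ.- + 1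
  prime∤p^k-1 {p} p-prime (suc k) _ p∣ = ℕₚ.<⇒≢ (prime-1< p-prime) (sym (ℕD.∣1⇒≡1 (∣⇒∣ᵤ {+ p}
    (subst (+ p ℤS.∣_) (solve 1 (λ x → x :- (x :- con (+ 1)) := con (+ 1)) refl ((+ p) ℤ.^ suc k))
      (ℤS.∣m∣n⇒∣m-n (ℤS.∣m⇒∣m*n ((+ p) ℤ.^ k) ℤS.∣-refl) p∣)))))
    where open +-*-Solver

  -- Each factor Φ_k(p) divides p^k - 1, which is -1 modulo p.
  prime∤D : ∀ {p} → Prime p → ∀ m → ¬ p ∣ ∣ D m p ∣
  prime∤D p-prime zero p∣1 = ℕₚ.<⇒≢ (prime-1< p-prime) (sym (ℕD.∣1⇒≡1 p∣1))
  prime∤D {p} p-prime (suc m) p∣ with euclidsLemma ∣ D m p ∣ ∣ Φ (suc m) (+ p) ∣ p-prime (subst (p ∣_) (ℤₚ.abs-* (D m p) (Φ (suc m) (+ p))) p∣)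
  ... | inj₁ p∣D = prime∤D p-prime m p∣D
  ... | inj₂ p∣Φ = prime∤p^k-1 p-prime (suc m) (s≤s z≤n) (ℤS.∣-trans (∣ᵤ⇒∣ {+ p} p∣Φ)
        (Φ∣x^k-1 (suc m) (+ p) (s≤s z≤n) (proj₂ (cyclotomic-correct (suc m) (s≤s z≤n)))))

  p^k∸1≡ : ∀ p k → 1 ℕ.≤ p → ∣ (+ p) ℤ.^ k ℤ.- + 1 ∣ ≡ p ^ k ∸ 1
  p^k∸1≡ p k 1≤p = trans (cong (λ t → ∣ t ℤ.- + 1 ∣) (pos-^ k))
    (cong ∣_∣ (trans (ℤₚ.m-n≡m⊖n (p ^ k) 1) (ℤₚ.⊖-≥ (ℕₚ.m^n>0 p {{ℕ.>-nonZero 1≤p}} k))))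
    where
    pos-^ : ∀ k → (+ p) ℤ.^ k ≡ + (p ^ k)
    pos-^ zero = refl
    pos-^ (suc k) = trans (cong (+ p ℤ.*_) (pos-^ k)) (sym (ℤₚ.pos-* p (p ^ k)))

  -- With e = `ceilLog p m`, n contributes p^(r+1) and `nabla` contributes p^(e-1), together exactly
  -- p^(e+r): p^e for the identity modulo p and p^r for the lift to p^(r+1). As `D m p` is prime to
  -- p, the two divisors of `K m n` multiply.
  exponent-∣-K : ∀ m n p r → 2 ℕ.≤ m → 1 ℕ.≤ n → Prime p → p ^ suc r ∣ n → ∣ D m p ∣ ∣ ∣ K m n ∣ →
    ∣ D m p ∣ ℕ.* p ^ ceilLog p m ℕ.* p ^ r ∣ ∣ K m n ∣
  exponent-∣-K m n p r 2≤m 1≤n p-prime p^r∣n D∣K = subst (_∣ ∣ K m n ∣) (sym shape)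
    (coprime-*-∣ (Coprime.sym (coprime-^ (e ℕ.+ r) (Coprime.sym (prime∤⇒coprime p-prime (prime∤D p-prime m))))) D∣K
      (subst (p ^ (e ℕ.+ r) ∣_) (sym (ℤₚ.abs-* (+ (n ℕ.* nabla m n)) (D m n))) (ℕD.∣m⇒∣m*n ∣ D m n ∣ power∣)))
    where
    e = ceilLog p m
    shape : ∣ D m p ∣ ℕ.* p ^ e ℕ.* p ^ r ≡ ∣ D m p ∣ ℕ.* p ^ (e ℕ.+ r)
    shape = trans (ℕₚ.*-assoc ∣ D m p ∣ (p ^ e) (p ^ r)) (cong (∣ D m p ∣ ℕ.*_) (sym (ℕₚ.^-distribˡ-+-* p e r)))
    p∣n : p ∣ n
    p∣n = ℕD.∣-trans (ℕD.m∣m*n (p ^ r)) p^r∣n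
    exponents : suc r ℕ.+ (e ∸ 1) ≡ e ℕ.+ r
    exponents = trans (sym (ℕₚ.+-suc r (e ∸ 1))) (trans (cong (r ℕ.+_) (ℕₚ.m+[n∸m]≡n (ceilLog-positive (prime-1< p-prime) 2≤m))) (ℕₚ.+-comm r e))
    power∣ : p ^ (e ℕ.+ r) ∣ n ℕ.* nabla m n
    power∣ = subst (_∣ n ℕ.* nabla m n)
      (trans (sym (ℕₚ.^-distribˡ-+-* p (suc r) (e ∸ 1))) (cong (p ^_) exponents))
      (ℕD.*-pres-∣ p^r∣n (nablaUpTo-∣ m n p-prime p∣n (ℕD.∣⇒≤ {{ℕ.>-nonZero 1≤n}} p∣n)))

  divisibility⇒power≡1 : ∀ m n → 2 ℕ.≤ m → 1 ℕ.≤ n → (∀ p → Prime p → p ∣ n → ∣ D m p ∣ ∣ ∣ K m n ∣) →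
    ∀ A → InGL m n A → MatEq n (matPow A ∣ K m n ∣) idMat
  divisibility⇒power≡1 m n 2≤m 1≤n h A (B , _ , BA≡1) i j = prime-powers-∣ n 1≤n _ λ p r p-prime p^r∣n →
    let p∣n = ℕD.∣-trans (ℕD.m∣m*n (p ^ r)) p^r∣n
        1<p = prime-1< p-prime
    in entries (MatPower.matPow-∣ (p ^ suc r) A (exponent-∣-K m n p r 2≤m 1≤n p-prime p^r∣n (h p p-prime p∣n))
      (matPow-lifts A (∣ D m p ∣ ℕ.* p ^ ceilLog p m) r
        (congruent (MatrixExponent.power≡1 p-prime A {B} (λ i j → ℕD.∣-trans p∣n (BA≡1 i j)) ∣ D m p ∣ (ceilLog p m)
          (λ k 1≤k k≤m → subst (_∣ ∣ D m p ∣) (p^k∸1≡ p k (ℕₚ.<⇒≤ 1<p)) (∣⇒∣ᵤ (p^k-1∣D p 1≤k k≤m)))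
          (ceilLog-bound 1<p 2≤m))))) i j

-- From the power identity modulo n to divisibility by `D m p`.

module Necessity where

  open LeastCommonMultiple using (D-least)
  open Matrices
  open Frobenius
  open Companion
  open ExponentModPrime
  open Sufficiency
  open import Data.Nat as ℕ using (ℕ; zero; suc; _∸_; _^_; _%_)
  import Data.Nat.Properties as ℕₚ
  open import Data.Nat.Divisibility as ℕD using (_∣_; _∣?_)
  open import Data.Nat.DivMod using (_mod_; %-distribˡ-+; m%n%n≡m%n; [m+n]%n≡m%n; m<n⇒m%n≡m; m%n<n)
  open import Data.Nat.Coprimality as Coprime using (Coprime)
  open import Data.Nat.Primality using (Prime; prime⇒nonZero)
  open import Data.Integer as ℤ using (ℤ; +_; ∣_∣)
  import Data.Integer.Properties as ℤₚ
  open import Data.Integer.Divisibility.Signed as ℤS using (∣ᵤ⇒∣; ∣⇒∣ᵤ)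
  open import Data.Integer.Solver using (module +-*-Solver)
  open import Data.Fin as Fin using (Fin; zero; suc; toℕ; fromℕ; inject₁)
  import Data.Fin.Properties as Finₚ
  open import Data.Fin.Relation.Unary.Top using (view; ‵fromℕ; ‵inject₁)
  open import Data.Product using (_×_; _,_; ∃-syntax; Σ-syntax)
  open import Relation.Nullary using (Dec; ¬_; contradiction)
  open import Relation.Nullary.Decidable using (decidable-stable; map′)
  open import Relation.Binary.PropositionalEquality hiding (setoid)

  module CyclicShift (N′ : ℕ) where

    N : ℕ
    N = suc N′

    next : Fin N → Fin N
    next i = suc (toℕ i) mod N

    iterate : ℕ → Fin N → Fin N
    iterate zero    i = i
    iterate (suc e) i = iterate e (next i)

    -- The regular representation of a generator of the cyclic group of order N. For N = p^k - 1 it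
    -- imitates a generator of the multiplicative group of the field with p^k elements.
    shift : Mat N
    shift i j = idMat (next i) j

    shift-power : ∀ e i j → matPow shift e i j ≡ idMat (iterate e i) j
    shift-power zero i j = refl
    shift-power (suc e) i j = trans (sum-idˡ (next i) (λ k → matPow shift e k j)) (shift-power e (next i) j)

    toℕ-iterate : ∀ e i → toℕ (iterate e i) ≡ (toℕ i ℕ.+ e) % N
    toℕ-iterate zero i = sym (trans (cong (_% N) (ℕₚ.+-identityʳ (toℕ i))) (m<n⇒m%n≡m (Finₚ.toℕ<n i)))
    toℕ-iterate (suc e) i = begin
      toℕ (iterate e (next i))                ≡⟨ toℕ-iterate e (next i) ⟩
      (toℕ (next i) ℕ.+ e) % N                ≡⟨ cong (λ t → (t ℕ.+ e) % N) (Finₚ.toℕ-fromℕ< (m%n<n (suc (toℕ i)) N)) ⟩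
      (suc (toℕ i) % N ℕ.+ e) % N             ≡⟨ %-distribˡ-+ (suc (toℕ i) % N) e N ⟩
      (suc (toℕ i) % N % N ℕ.+ e % N) % N     ≡⟨ cong (λ t → (t ℕ.+ e % N) % N) (m%n%n≡m%n (suc (toℕ i)) N) ⟩
      (suc (toℕ i) % N ℕ.+ e % N) % N         ≡⟨ %-distribˡ-+ (suc (toℕ i)) e N ⟨
      (suc (toℕ i) ℕ.+ e) % N                 ≡⟨ cong (_% N) (ℕₚ.+-suc (toℕ i) e) ⟨
      (toℕ i ℕ.+ suc e) % N                   ∎
      where open ≡-Reasoning

    shift-order : ∀ i j → matPow shift N i j ≡ idMat i j
    shift-order i j = trans (shift-power N i j) (cong (λ k → idMat k j) (Finₚ.toℕ-injective
      (trans (toℕ-iterate N i) (trans ([m+n]%n≡m%n (toℕ i) N) (m<n⇒m%n≡m (Finₚ.toℕ<n i))))))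

    -- The entry at (0 , 0) of a permutation matrix is 0 or 1, which are distinct modulo p. It is 1
    -- only if e steps bring the index 0 back to itself.
    shift-power≡1⇒∣ : ∀ {p} → 1 ℕ.< p → ∀ e → MatEq p (matPow shift e) idMat → N ∣ e
    shift-power≡1⇒∣ {p} 1<p e h = ℕD.m%n≡0⇒n∣m e N (trans (sym (toℕ-iterate e zero))
      (cong toℕ (diagonal (iterate e zero) (subst (λ t → t ≡[mod p ] (+ 1)) (shift-power e zero zero) (h zero zero)))))
      where
      diagonal : ∀ i → idMat i zero ≡[mod p ] (+ 1) → i ≡ zero
      diagonal zero _ = refl
      diagonal (suc i) p∣1 = contradiction (ℕD.∣1⇒≡1 p∣1) (λ { refl → ℕₚ.<-irrefl refl 1<p })

    module _ {p : ℕ} (p-prime : Prime p) where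
      open MatrixExponent p-prime shift using (value-^; generator; value; _≈_; 1#) renaming (_^_ to _^ᴿ_)

      congruent? : ∀ x y → Dec (x ≈ y)
      congruent? x y = map′ congruent entries
        (Finₚ.all? λ i → Finₚ.all? λ j → p ∣? ∣ value x i j ℤ.- value y i j ∣)

      generator^N≈1 : generator ^ᴿ N ≈ 1#
      generator^N≈1 = congruent λ i j → mod-reflexive (trans (cong (λ A → A i j) (value-^ generator N)) (shift-order i j))

      generator^e≈1⇒∣ : 1 ℕ.< p → ∀ e → generator ^ᴿ e ≈ 1# → N ∣ e
      generator^e≈1⇒∣ 1<p e h = shift-power≡1⇒∣ 1<p e (subst (λ A → MatEq p A idMat) (value-^ generator e) (entries h))

  module PeriodicElement {p : ℕ} (p-prime : Prime p) (𝔽 : 𝔽-Algebra p) where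
    open Theory p-prime 𝔽 hiding (refl; sym; trans) renaming (_^_ to _^ᴿ_)
    open CompanionOrder p-prime 𝔽 using (Regular; companion-power≢1)
    open import Relation.Binary.Reasoning.Setoid setoid

    periodic⇒regular : ∀ x N → x ^ᴿ suc N ≈ 1# → Regular x
    periodic⇒regular x N h z xz≈0 = begin
      z                       ≈⟨ *-identityˡ z ⟨
      1# * z                  ≈⟨ *-congʳ h ⟨
      x * x ^ᴿ N * z          ≈⟨ *-congʳ (*-comm x (x ^ᴿ N)) ⟩
      x ^ᴿ N * x * z          ≈⟨ *-assoc (x ^ᴿ N) x z ⟩
      x ^ᴿ N * (x * z)        ≈⟨ *-congˡ xz≈0 ⟩
      x ^ᴿ N * 0#             ≈⟨ zeroʳ _ ⟩
      0#                      ∎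

    periodic-companion : (∀ x y → Dec (x ≈ y)) → ∀ x N k l e → p ^ suc k ≡ suc (suc N) → x ^ᴿ suc N ≈ 1# → ¬ x ^ᴿ e ≈ 1# →
      Σ[ a ∈ (Fin (suc (k ℕ.+ l)) → ℤ) ] ¬ p ∣ ∣ a (fromℕ (k ℕ.+ l)) ∣ ×
        (∀ a′ → (∀ i → a′ i ≡[mod p ] a i) → ¬ MatEq p (matPow (companion a′) e) idMat)
    periodic-companion _≈?_ x N k l e q≡ h = companion-power≢1 _≈?_ x k l e (periodic⇒regular x N h) (begin
      x ^ᴿ (p ^ suc k)    ≈⟨ ^-congʳ x q≡ ⟩
      x * x ^ᴿ suc N      ≈⟨ *-congˡ h ⟩
      x * 1#              ≈⟨ *-identityʳ x ⟩
      x                   ∎)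

  snoc : ∀ {A : Set} {m} → (Fin m → A) → A → Fin (suc m) → A
  snoc {m = zero}  f x i       = x
  snoc {m = suc m} f x zero    = f zero
  snoc {m = suc m} f x (suc i) = snoc (λ i → f (suc i)) x i

  snoc-inject₁ : ∀ {A : Set} {m} (f : Fin m → A) x i → snoc f x (inject₁ i) ≡ f i
  snoc-inject₁ f x zero    = refl
  snoc-inject₁ f x (suc i) = snoc-inject₁ (λ i → f (suc i)) x i

  snoc-last : ∀ {A : Set} {m} (f : Fin m → A) x → snoc f x (fromℕ m) ≡ x
  snoc-last {m = zero}  f x = refl
  snoc-last {m = suc m} f x = snoc-last (λ i → f (suc i)) x

  sum-snoc : ∀ {m} (g : Fin (suc m) → ℤ) f x →
    sumFin (λ j → g j ℤ.* snoc f x j) ≡ sumFin (λ i → g (inject₁ i) ℤ.* f i) ℤ.+ g (fromℕ m) ℤ.* x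
  sum-snoc {zero}  g f x = ℤₚ.+-comm (g zero ℤ.* x) (+ 0)
  sum-snoc {suc m} g f x = trans (cong (λ t → g zero ℤ.* f zero ℤ.+ t) (sum-snoc (λ i → g (suc i)) (λ i → f (suc i)) x))
    (sym (ℤₚ.+-assoc (g zero ℤ.* f zero) _ _))

  idMat-inject₁ : ∀ {m} (i j : Fin m) → idMat (inject₁ i) (inject₁ j) ≡ idMat i j
  idMat-inject₁ zero zero = refl
  idMat-inject₁ zero (suc j) = refl
  idMat-inject₁ (suc i) zero = refl
  idMat-inject₁ (suc i) (suc j) = idMat-inject₁ i j

  idMat-inject₁-last : ∀ {m} (i : Fin m) → idMat (inject₁ i) (fromℕ m) ≡ + 0
  idMat-inject₁-last zero = refl
  idMat-inject₁-last (suc i) = idMat-inject₁-last i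

  idMat-diagonal : ∀ {m} (i : Fin m) → idMat i i ≡ + 1
  idMat-diagonal zero = refl
  idMat-diagonal (suc i) = idMat-diagonal i

  -- The matrix sends u to v with v_0 = - Σ a_j u_j and v_(i+1) = u_i. Solving for the last
  -- coordinate gives u_m = - b (v_0 + Σ_(l<m) a_l v_(l+1)), which is `lastRow`.
  companion∈GL : ∀ {n m} (a : Fin (suc m) → ℤ) b → (b ℤ.* a (fromℕ m)) ≡[mod n ] (+ 1) → InGL (suc m) n (companion a)
  companion∈GL {n} {m} a b ba≡1 = inverse , right , left
    where
    open +-*-Solver
    c = a (fromℕ m)
    lastRow : Fin (suc m) → ℤ
    lastRow zero    = ℤ.- b
    lastRow (suc l) = ℤ.- (b ℤ.* a (inject₁ l))
    inverse : Mat (suc m)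
    inverse i l = snoc (λ i → idMat (suc i) l) (lastRow l) i

    right : MatEq n (companion a ⊗ inverse) idMat
    right (suc i) l = mod-reflexive (trans (sum-idˡ (inject₁ i) (λ k → inverse k l)) (snoc-inject₁ (λ i → idMat (suc i) l) (lastRow l) i))
    right zero zero = subst (λ t → t ≡[mod n ] (+ 1)) (sym (trans (sum-snoc (λ j → ℤ.- a j) (λ i → + 0) (ℤ.- b))
      (trans (cong (ℤ._+ ℤ.- c ℤ.* ℤ.- b) (trans (sum-cong (λ i → ℤₚ.*-zeroʳ (ℤ.- a (inject₁ i)))) (sum-zero m)))
        (solve 2 (λ b c → con (+ 0) :+ :- c :* :- b := b :* c) refl b c)))) ba≡1
    right zero (suc l) = subst₂ (λ s t → s ≡[mod n ] t)
      (sym (trans (sum-snoc (λ j → ℤ.- a j) (λ i → idMat (suc i) (suc l)) (lastRow (suc l)))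
        (trans (cong (ℤ._+ ℤ.- c ℤ.* lastRow (suc l)) (sum-idʳ l (λ i → ℤ.- a (inject₁ i))))
          (solve 3 (λ x b c → :- x :+ :- c :* :- (b :* x) := (:- con (+ 1) :+ b :* c) :* x) refl (a (inject₁ l)) b c))))
      (ℤₚ.*-zeroˡ (a (inject₁ l)))
      (mod-* (ℤ.- + 1 ℤ.+ b ℤ.* c) (+ 0) (a (inject₁ l)) (a (inject₁ l))
        (mod-+ (ℤ.- + 1) (ℤ.- + 1) (b ℤ.* c) (+ 1) (mod-reflexive {n} {ℤ.- + 1} refl) ba≡1)
        (mod-reflexive {n} {a (inject₁ l)} refl))

    left : MatEq n (inverse ⊗ companion a) idMat
    left i l with view i
    ... | ‵inject₁ i′ = mod-reflexive (trans
      (sum-cong (λ j → cong (ℤ._* companion a j l) (snoc-inject₁ (λ i → idMat (suc i) j) (lastRow j) i′)))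
      (sum-idˡ (suc i′) (λ j → companion a j l)))
    ... | ‵fromℕ = mod-trans ((inverse ⊗ companion a) (fromℕ m) l) (sumFin (λ j → lastRow j ℤ.* companion a j l)) (idMat (fromℕ m) l)
      (mod-reflexive (sum-cong (λ j → cong (ℤ._* companion a j l) (snoc-last (λ i → idMat (suc i) j) (lastRow j))))) (last l)
      where
      last : ∀ l → sumFin (λ j → lastRow j ℤ.* companion a j l) ≡[mod n ] idMat (fromℕ m) l
      last l with view l
      ... | ‵fromℕ = subst₂ (λ s t → s ≡[mod n ] t)
        (sym (trans (cong (λ t → ℤ.- b ℤ.* ℤ.- c ℤ.+ t) (trans
            (sum-cong (λ i → trans (cong (lastRow (suc i) ℤ.*_) (idMat-inject₁-last i)) (ℤₚ.*-zeroʳ (lastRow (suc i))))) (sum-zero m)))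
          (solve 2 (λ b c → :- b :* :- c :+ con (+ 0) := b :* c) refl b c)))
        (sym (idMat-diagonal (fromℕ m))) ba≡1
      ... | ‵inject₁ l′ = mod-reflexive (trans (cong (λ t → ℤ.- b ℤ.* ℤ.- a (inject₁ l′) ℤ.+ t) (trans
            (sum-cong (λ i → cong (lastRow (suc i) ℤ.*_) (idMat-inject₁ i l′))) (sum-idʳ l′ (λ i → lastRow (suc i)))))
          (trans (solve 2 (λ b x → :- b :* :- x :+ :- (b :* x) := con (+ 0)) refl b (a (inject₁ l′)))
            (sym (trans (idMat-sym (fromℕ m) (inject₁ l′)) (idMat-inject₁-last l′)))))

  -- Units lift along ℤ/n → ℤ/p: change d by a multiple of p to make it ≡ 1 modulo the part of n prime to p.
  lift-unit : ∀ {p} → Prime p → ∀ n → 1 ℕ.≤ n → ∀ d → ¬ p ∣ ∣ d ∣ → ∃[ d′ ] d′ ≡[mod p ] d × Coprime ∣ d′ ∣ n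
  lift-unit {p} p-prime n 1≤n d p∤d with split-power p-prime n 1≤n
  ... | r , n′ , refl , p∤n′ with mod-inverse {n′} (+ p) (Coprime.sym (prime∤⇒coprime p-prime p∤n′))
  ...   | u , up≡1 = d′ , d′≡d , Coprime.sym (coprime-* (coprime-^ r (Coprime.sym (prime∤⇒coprime p-prime p∤d′))) coprime-n′)
    where
    open +-*-Solver
    d′ = d ℤ.+ (u ℤ.* + p) ℤ.* (+ 1 ℤ.- d)
    d′≡d : d′ ≡[mod p ] d
    d′≡d = ∣⇒∣ᵤ {+ p} (ℤS.divides (u ℤ.* (+ 1 ℤ.- d))
      (solve 3 (λ d u p → (d :+ (u :* p) :* (con (+ 1) :- d)) :- d := (u :* (con (+ 1) :- d)) :* p) refl d u (+ p)))
    p∤d′ : ¬ p ∣ ∣ d′ ∣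
    p∤d′ p∣d′ = p∤d (∣⇒∣ᵤ (subst (+ p ℤS.∣_) (solve 2 (λ x y → x :- (x :- y) := y) refl d′ d)
      (ℤS.∣m∣n⇒∣m-n (∣ᵤ⇒∣ {+ p} {d′} p∣d′) (∣ᵤ⇒∣ {+ p} {d′ ℤ.- d} d′≡d))))
    n′∣d′-1 : + n′ ℤS.∣ d′ ℤ.- + 1
    n′∣d′-1 = subst (+ n′ ℤS.∣_) (solve 2 (λ d w → (con (+ 1) :- d) :* (w :- con (+ 1)) := (d :+ w :* (con (+ 1) :- d)) :- con (+ 1)) refl d (u ℤ.* + p))
      (ℤS.∣n⇒∣m*n (+ 1 ℤ.- d) (∣ᵤ⇒∣ {+ n′} {u ℤ.* + p ℤ.- + 1} up≡1))
    coprime-n′ : Coprime n′ ∣ d′ ∣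
    coprime-n′ {e} (e∣n′ , e∣d′) = ℕD.∣1⇒≡1 (∣⇒∣ᵤ {+ e} {+ 1} (subst (+ e ℤS.∣_) (solve 1 (λ x → x :- (x :- con (+ 1)) := con (+ 1)) refl d′)
      (ℤS.∣m∣n⇒∣m-n (∣ᵤ⇒∣ {+ e} {d′} e∣d′) (ℤS.∣-trans (∣ᵤ⇒∣ {+ e} {+ n′} e∣n′) n′∣d′-1))))

  power≡1⇒p^k-1∣ : ∀ m n e → 1 ℕ.≤ n → (∀ A → InGL m n A → MatEq n (matPow A e) idMat) →
    ∀ {p} → Prime p → p ∣ n → ∀ k → 1 ℕ.≤ k → k ℕ.≤ m → p ^ k ∸ 1 ∣ e
  power≡1⇒p^k-1∣ m n e 1≤n h {p} p-prime p∣n (suc k) _ k<m with ℕₚ.m≤n⇒∃[o]m+o≡n k<m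
  -- `l` counts the factors T - 1 that raise the degree from `suc k` to m.
  ... | l , refl = go (p ^ suc k ∸ 2) (sym (ℕₚ.m+[n∸m]≡n 2≤q))
    where
    1<p = prime-1< p-prime
    2≤q : 2 ℕ.≤ p ^ suc k
    2≤q = ℕₚ.≤-trans 1<p (ℕₚ.m≤m*n p (p ^ k) {{ℕₚ.m^n≢0 p k {{prime⇒nonZero p-prime}}}})
    -- The size of the shift has to be a successor: with p^(k+1) = N + 2 the shift has order N + 1 =
    -- p^(k+1) - 1.
    go : ∀ N → p ^ suc k ≡ suc (suc N) → p ^ suc k ∸ 1 ∣ e
    go N q≡ = subst (λ q → q ∸ 1 ∣ e) (sym q≡) (decidable-stable (suc N ∣? e) λ N∤e →
      refute (PeriodicElement.periodic-companion p-prime (bicommutantAlgebra p shift) (congruent? p-prime) generator N k l e q≡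
        (generator^N≈1 p-prime) (λ x^e≈1 → N∤e (generator^e≈1⇒∣ p-prime 1<p e x^e≈1))))
      where
      open CyclicShift N hiding (N)
      open MatrixExponent p-prime shift using (generator)
      refute : ¬ (Σ[ a ∈ (Fin (suc (k ℕ.+ l)) → ℤ) ] ¬ p ∣ ∣ a (fromℕ (k ℕ.+ l)) ∣ ×
        (∀ a′ → (∀ i → a′ i ≡[mod p ] a i) → ¬ MatEq p (matPow (companion a′) e) idMat))
      -- Invertibility of the companion matrix modulo n depends on the last coefficient alone; it is
      -- replaced by a number with the same residue modulo p that is prime to n.
      refute (a , p∤last , impossible) with lift-unit p-prime n 1≤n (a (fromℕ (k ℕ.+ l))) p∤last
      ... | c , c≡last , coprime with mod-inverse {n} c coprime
      ...   | b , bc≡1 = impossible a′ a′≡a (λ i j → ℕD.∣-trans p∣n (h (companion a′)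
                (companion∈GL a′ b (subst (λ t → (b ℤ.* t) ≡[mod n ] (+ 1)) (sym (snoc-last (λ i → a (inject₁ i)) c)) bc≡1)) i j))
        where
        a′ : Fin (suc (k ℕ.+ l)) → ℤ
        a′ = snoc (λ i → a (inject₁ i)) c
        a′≡a : ∀ i → a′ i ≡[mod p ] a i
        a′≡a i with view i
        ... | ‵fromℕ = subst (λ t → t ≡[mod p ] a (fromℕ (k ℕ.+ l))) (sym (snoc-last (λ i → a (inject₁ i)) c)) c≡last
        ... | ‵inject₁ i′ = mod-reflexive (snoc-inject₁ (λ i → a (inject₁ i)) c i′)

  power≡1⇒divisibility : ∀ m n e → 1 ℕ.≤ n → (∀ A → InGL m n A → MatEq n (matPow A e) idMat) →
    ∀ p → Prime p → p ∣ n → D m p ℤS.∣ + e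
  power≡1⇒divisibility m n e 1≤n h p p-prime p∣n = D-least p m (+ e) (prime-1< p-prime) λ k 1≤k k≤m →
    ∣ᵤ⇒∣ {_} {+ e} (subst (_∣ e) (sym (p^k∸1≡ p k (ℕₚ.<⇒≤ (prime-1< p-prime)))) (power≡1⇒p^k-1∣ m n e 1≤n h p-prime p∣n k 1≤k k≤m))

open import Data.Nat using (ℕ; _≤_)
import Data.Nat as ℕ
open import Data.Nat.Primality using (Prime; Composite; composite⇒nonZero)
open import Data.Integer.Divisibility using (_∣_)
open import Data.Integer.Divisibility.Signed using (∣⇒∣ᵤ)
import Data.Nat.Divisibility as ℕD
open import Data.Product using (_×_; _,_)
open Sufficiency using (divisibility⇒power≡1)
open Necessity using (power≡1⇒divisibility)

theorem2p8 : (m n : ℕ) → 2 ≤ m → Composite n →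
    (IsMCarmichael m n → (∀ (p : ℕ) → Prime p → p ℕD.∣ n → D m p ∣ K m n))
    × ((∀ (p : ℕ) → Prime p → p ℕD.∣ n → D m p ∣ K m n) → IsMCarmichael m n)
theorem2p8 m n 2≤m composite =
  (λ (_ , power≡1) p p-prime p∣n → ∣⇒∣ᵤ (power≡1⇒divisibility m n _ 1≤n power≡1 p p-prime p∣n)) ,
  (λ divisible → composite , divisibility⇒power≡1 m n 2≤m 1≤n divisible)
  where
  1≤n : 1 ≤ n
  1≤n = ℕ.>-nonZero⁻¹ n {{composite⇒nonZero composite}}
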